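{- For a minor-closed class $\mathcal{G}$ of graphs, the following are equivalent: (1) some apex-forest is not in $\mathcal{G}$; (2) $\mathcal{G}$ has bounded local pathwidth; (3) $\mathcal{G}$ has linear local pathwidth; (4) $\mathcal{G}$ has bounded layered pathwidth (there is a constant $c$ with $\operatorname{lpw}(G)\le c$ for all $G\in\mathcal{G}$); (5) there exist integers $w$ and $p$ such that every graph in $\mathcal{G}$ has a $(w,p)$-good tree decomposition.
   Context: Graphs are finite and simple; a class is minor-closed if every minor of a member is a member. A graph $G$ is an apex-forest if $G-v$ is a forest for some vertex $v$. A tree decomposition of $G$ is a family $(B_x\subseteq V(G): x\in V(T))$ indexed by the nodes of a tree $T$ such that each edge of $G$ has both endpoints in some bag, and for each vertex $v$ the set $T[v]$ of nodes $x$ with $v\in B_x$ induces a non-empty connected subtree of $T$; its width is the maximum bag size minus 1. A path decomposition is a tree decomposition indexed by a path; pathwidth $\operatorname{pw}$ is the minimum width of a path decomposition. A class $\mathcal{G}$ has bounded local pathwidth if there is a function $f$ such that for every $G\in\mathcal{G}$, every vertex $v$ of $G$ and every integer $r\ge 0$, the subgraph of $G$ induced by the vertices at distance at most $r$ from $v$ has pathwidth at most $f(r)$; it has linear local pathwidth if such $f$ can be taken linear. A layering of $G$ is a partition $(V_0,\dots,V_t)$ of $V(G)$ such that every edge joins vertices in layers $V_i,V_j$ with $|i-j|\le1$. The layered width of a path decomposition is the minimum $\ell$ such that for some layering each bag has at most $\ell$ vertices in each layer; $\operatorname{lpw}(G)$ is the minimum layered width of a path decomposition of $G$. A tree decomposition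 $(B_x:x\in V(T))$ of $G$ is $(w,p)$-good if its width is at most $w$ and for every $v\in V(G)$ the subtree $T[v]$ has pathwidth at most $p$. -}

module Defs where

open import Data.Nat using (ℕ; zero; suc; _≤_; _+_; _*_; _≡ᵇ_)
open import Data.Bool using (Bool; true; false)
open import Data.Fin using (Fin; toℕ; inject₁; fromℕ) renaming (zero to fzero; suc to fsuc)
open import Data.Fin.Subset using (Subset; _∈_; _∉_; _∩_; ∣_∣)
open import Data.Vec using (tabulate)
open import Data.Product using (Σ; ∃; ∃-syntax; _×_; _,_)
open import Data.Sum using (_⊎_)
open import Data.Unit using (⊤)
open import Relation.Binary.PropositionalEquality using (_≡_; _≢_)
open import Relation.Nullary using (¬_)
open import Function using (_⇔_)
open import Function.Definitions using (Injective)

-- Finite simple graphs.  Vertex set Fin n; the edge relation is derived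
-- from a Bool-valued table E, symmetrised and with loops removed, so
-- every value of this record is a finite simple graph.

record Graph : Set where
  constructor mkGraph
  field
    n : ℕ
    E : Fin n → Fin n → Bool
open Graph public

Adj : (G : Graph) → Fin (n G) → Fin (n G) → Set
Adj G u v = (u ≢ v) × (E G u v ≡ true ⊎ E G v u ≡ true)

VSet : Graph → Set₁
VSet G = Fin (n G) → Set

full : (G : Graph) → VSet G
full G _ = ⊤

data Conn (G : Graph) (S : VSet G) : Fin (n G) → Fin (n G) → Set where
  here : ∀ {u} → S u → Conn G S u u
  step : ∀ {u w v} → S u → Adj G u w → Conn G S w v → Conn G S u v

data Walk (G : Graph) : ℕ → Fin (n G) → Fin (n G) → Set where
  nil  : ∀ {u} → Walk G 0 u u
  cons : ∀ {k u w v} → Adj G u w → Walk G k w v → Walk G (suc k) u v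

Ball : (G : Graph) → Fin (n G) → ℕ → VSet G
Ball G v r u = ∃[ k ] (k ≤ r × Walk G k v u)

record CycleIn (G : Graph) (S : VSet G) : Set where
  field
    k     : ℕ
    c     : Fin (suc (suc (suc k))) → Fin (n G)
    inj   : Injective _≡_ _≡_ c
    inS   : ∀ i → S (c i)
    steps : (i : Fin (suc (suc k))) → Adj G (c (inject₁ i)) (c (fsuc i))
    close : Adj G (c (fromℕ (suc (suc k)))) (c fzero)

ForestOn : (G : Graph) → VSet G → Set
ForestOn G S = ¬ CycleIn G S

IsForest : Graph → Set
IsForest G = ForestOn G (full G)

IsApexForest : Graph → Set
IsApexForest G = ∃[ v ] ForestOn G (λ u → u ≢ v)

IsTree : Graph → Set
IsTree T = Fin (n T) × (∀ x y → Conn T (full T) x y) × IsForest T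

record MinorModel (H G : Graph) : Set where
  field
    φ        : Fin (n H) → Subset (n G)
    nonempty : ∀ x → ∃[ v ] (v ∈ φ x)
    disjoint : ∀ x y → x ≢ y → ∀ v → v ∈ φ x → v ∉ φ y
    connected : ∀ x u v → u ∈ φ x → v ∈ φ x → Conn G (λ w → w ∈ φ x) u v
    edges    : ∀ x y → Adj H x y → ∃[ u ] ∃[ v ] (u ∈ φ x × v ∈ φ y × Adj G u v)

IsMinor : Graph → Graph → Set
IsMinor H G = MinorModel H G

Class : Set₁
Class = Graph → Set

MinorClosed : Class → Set
MinorClosed 𝒢 = ∀ G H → 𝒢 G → IsMinor H G → 𝒢 H

-- Tree decompositions of the induced subgraph G[S], indexed by the nodes
-- of a graph T (which is required to be a tree / path where used)

record TreeDecomp (G : Graph) (S : VSet G) (T : Graph) : Set where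
  field
    bag      : Fin (n T) → Subset (n G)
    bag⊆S    : ∀ x v → v ∈ bag x → S v
    edgeCov  : ∀ u v → S u → S v → Adj G u v → ∃[ x ] (u ∈ bag x × v ∈ bag x)
    vertCov  : ∀ v → S v → ∃[ x ] (v ∈ bag x)
    subtree  : ∀ v x y → v ∈ bag x → v ∈ bag y → Conn T (λ z → v ∈ bag z) x y
open TreeDecomp public

WidthAtMost : ∀ {G S T} → TreeDecomp G S T → ℕ → Set
WidthAtMost {T = T} D w = ∀ (x : Fin (n T)) → ∣ bag D x ∣ ≤ suc w

PathGraph : ℕ → Graph
PathGraph m = mkGraph m (λ i j → toℕ j ≡ᵇ suc (toℕ i))

PathDecomp : (G : Graph) → VSet G → ℕ → Set
PathDecomp G S m = TreeDecomp G S (PathGraph (suc m))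

PathwidthAtMost : (G : Graph) → VSet G → ℕ → Set
PathwidthAtMost G S p = ∃[ m ] Σ (PathDecomp G S m) (λ D → WidthAtMost D p)

IsLayering : (G : Graph) → (Fin (n G) → ℕ) → Set
IsLayering G ℓ = ∀ u v → Adj G u v → ℓ u ≤ suc (ℓ v)

layer : ∀ {k} → (Fin k → ℕ) → ℕ → Subset k
layer ℓ i = tabulate (λ v → ℓ v ≡ᵇ i)

LayeredPathwidthAtMost : Graph → ℕ → Set
LayeredPathwidthAtMost G c =
  ∃[ m ] Σ (PathDecomp G (full G) m) λ D →
    Σ (Fin (n G) → ℕ) λ ℓ → (IsLayering G ℓ × (∀ x i → ∣ bag D x ∩ layer ℓ i ∣ ≤ c))

GoodTD : Graph → ℕ → ℕ → Set
GoodTD G w p =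
  ∃[ T ] (IsTree T × Σ (TreeDecomp G (full G) T) λ D →
    WidthAtMost D w × (∀ v → PathwidthAtMost T (λ x → v ∈ bag D x) p))

ExcludesApexForest : Class → Set
ExcludesApexForest 𝒢 = ∃[ G ] (IsApexForest G × ¬ 𝒢 G)

BoundedLocalPathwidth : Class → Set
BoundedLocalPathwidth 𝒢 =
  Σ (ℕ → ℕ) λ f → (∀ G → 𝒢 G → ∀ v r → PathwidthAtMost G (Ball G v r) (f r))

LinearLocalPathwidth : Class → Set
LinearLocalPathwidth 𝒢 =
  ∃[ a ] ∃[ b ] (∀ G → 𝒢 G → ∀ v r → PathwidthAtMost G (Ball G v r) (a * r + b))

BoundedLayeredPathwidth : Class → Set
BoundedLayeredPathwidth 𝒢 = ∃[ c ] (∀ G → 𝒢 G → LayeredPathwidthAtMost G c)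

HasGoodTDs : Class → Set
HasGoodTDs 𝒢 = ∃[ w ] ∃[ p ] (∀ G → 𝒢 G → GoodTD G w p)

{-# OPTIONS --safe #-}
module Submission where

-- If an apex-forest H is excluded, every graph of the class has a tree decomposition whose nodes are graded by epochs such
-- that every vertex lives in two consecutive epochs, and whose tree has a path decomposition with boundedly many nodes of
-- each epoch in a bag.  Restricted to the subtree of a vertex, the latter yields (5); merging the bags of G along it, with
-- the epochs as layers, yields (4).
--
-- Call a connected set adjacent to u 0-rich for u, and (h + 1)-rich if it contains a tripod: a connected set touching three
-- disjoint h-rich sets.  A very rich set contains H as a minor with {u} as the apex.  If no set is (h + 1)-rich, the h-rich
-- sets lie along a path and are swept by bounded separators from one end to the other, which leaves pieces that are not
-- h-rich.  Sweeping for all vertices of an old boundary, one after the other, detaches them; a balanced separator then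
-- brings the new boundary back to its original size and starts the next epoch.
--
-- Without balanced separators, the majority components of some vertex set Z form a haven.  A set S linked to the haven and
-- carrying the branch sets of a tree is enlarged vertex by vertex, moving S towards the haven with Menger's theorem whenever
-- it ceases to be linked; contracting the component facing the haven to an apex gives H.
--
-- Conversely, tripods force large bags: of three bags filled by the three legs, the middle one also meets the connected set
-- that joins the outer legs.  So an apex over a complete ternary tree violates (2) and, through the subtree of the apex, (5).

open import Defs
open import Data.Nat using (ℕ; nonZero; zero; suc; _+_; _*_; _^_; _∸_; _≤_; _<_; z≤n; s≤s; _≤?_; _<?_; _≡ᵇ_)
open import Data.Nat.Properties
open import Data.Bool using (Bool; true; if_then_else_) renaming (_≟_ to _≟B_)
open import Data.Fin using (Fin; toℕ; fromℕ; inject₁; fromℕ<) renaming (zero to fz; suc to fs)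
open import Data.Fin.Properties using (any?; all?; toℕ-injective; toℕ<n; toℕ-inject₁; toℕ-fromℕ; toℕ-fromℕ<) renaming (_≟_ to _≟F_)
open import Data.Fin.Subset using (Subset; _∈_; _∉_; _⊆_; _∩_; _∪_; _─_; ⁅_⁆; Nonempty; inside; outside) renaming (⊥ to ∅; ⊤ to 𝕍; ∣_∣ to ∣_∣ᵥ)
open import Data.Fin.Subset.Properties using (_∈?_; x∈⁅x⁆; x∈⁅y⁆⇒x≡y; p⊆q⇒∣p∣≤∣q∣; p⊂q⇒∣p∣<∣q∣; x∈p∩q⁺; x∈p∩q⁻; x∈p∪q⁺; x∈p∪q⁻; x∈p∧x∉q⇒x∈p─q; p─q⊆p; anySubset?; ∉⊥; ∈⊤; ⊆-antisym; nonempty?)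
open import Data.Vec using (Vec; []; _∷_; tabulate; lookup) renaming (here to vhere; there to vthere)
open import Data.Vec.Properties using (lookup⇒[]=; []=⇒lookup; lookup∘tabulate)
open import Data.Product using (Σ; ∃-syntax; _×_; _,_; proj₁; proj₂)
open import Data.Sum using (_⊎_; inj₁; inj₂; [_,_]′)
open import Data.Empty using (⊥; ⊥-elim)
open import Data.Unit using (⊤; tt)
open import Relation.Binary.PropositionalEquality using (_≡_; _≢_; refl; sym; trans; cong; cong₂; subst; module ≡-Reasoning)
open import Relation.Nullary using (¬_; Dec; yes; no; does)
open import Relation.Nullary.Decidable using (_×-dec_; _⊎-dec_; ¬?; map′; dec-true; _→-dec_)
open import Function using (_∘_; id; case_of_; _⇔_; mk⇔)
open import Data.List using (List; length; filter; cartesianProduct; allFin) renaming ([] to []ᴸ; _∷_ to _∷ᴸ_)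
open import Data.List.Properties using (length-filter)
open import Data.List.Membership.Propositional using () renaming (_∈_ to _∈ᴸ_)
open import Data.List.Membership.Propositional.Properties using (∈-filter⁺; ∈-filter⁻; ∈-cartesianProduct⁺; ∈-allFin)
open import Data.List.Relation.Unary.Any using (Any) renaming (here to ahere; there to athere; any? to anyᴸ?)
open import Relation.Binary.Definitions using (tri<; tri≈; tri>)
import Data.Fin.Subset.Properties

-- The obstacle is that detaching an old boundary creates new boundary vertices, which must not
-- accumulate from epoch to epoch. Each old vertex `u` carries a bound on the richness of the
-- current component for `u`, at most `K` to begin with. Lowering one such bound by one costs at
-- most `g` new boundary vertices, however long the sweep is, because what lies ahead of a sweep is
-- bounded by the first cut and the latest separator only. An old boundary of size `M` therefore
-- becomes one of size at most `g * K * M`, and this factor does not depend on `M`. A separator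
-- dividing by `2 * (g * K)` has a size `κq` that depends on this ratio and not on the set to be
-- divided, so `M` can be chosen afterwards as `2 * (κq + 1)`.
--
-- The sum of the bounds also yields the levels of the decomposition tree: it limits how many
-- ancestors of one epoch wait for further children at the same time, and hence the width of the
-- path decomposition of the tree within an epoch.

private variable size : ℕ

-- Finite subsets: membership, cardinality, extremal choices.

module _ {P : Fin size → Set} (P? : ∀ x → Dec (P x)) where

  sub : Subset size
  sub = tabulate (λ x → does (P? x))

  sub⁺ : ∀ {x} → P x → x ∈ sub
  sub⁺ {x} px = lookup⇒[]= x sub (trans (lookup∘tabulate _ x) (dec-true (P? x) px))

  sub⁻ : ∀ {x} → x ∈ sub → P x
  sub⁻ {x} x∈ with P? x | trans (sym (lookup∘tabulate (λ x → does (P? x)) x)) ([]=⇒lookup x∈)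
  ... | yes px | _ = px
  ... | no _ | ()

─⁻ : (p q : Subset size) → ∀ {x} → x ∈ p ─ q → x ∈ p × x ∉ q
─⁻ (_ ∷ _) (outside ∷ _) {fz} vhere = vhere , λ ()
─⁻ (_ ∷ _) (inside ∷ _) {fz} ()
─⁻ (_ ∷ p) (_ ∷ q) {fs x} (vthere e) with ─⁻ p q e
... | a , b = vthere a , λ { (vthere c) → b c }

─⁺ : {p q : Subset size} → ∀ {x} → x ∈ p → x ∉ q → x ∈ p ─ q
─⁺ = x∈p∧x∉q⇒x∈p─q

∪⁻ : {p q : Subset size} → ∀ {x} → x ∈ p ∪ q → x ∈ p ⊎ x ∈ q
∪⁻ {p = p} {q} = x∈p∪q⁻ p q

∪ˡ : {p q : Subset size} → p ⊆ p ∪ q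
∪ˡ m = x∈p∪q⁺ (inj₁ m)

∪ʳ : {p q : Subset size} → q ⊆ p ∪ q
∪ʳ m = x∈p∪q⁺ (inj₂ m)

∩⁺ : {p q : Subset size} → ∀ {x} → x ∈ p → x ∈ q → x ∈ p ∩ q
∩⁺ a b = x∈p∩q⁺ (a , b)

∩⁻ : {p q : Subset size} → ∀ {x} → x ∈ p ∩ q → x ∈ p × x ∈ q
∩⁻ {p = p} {q} = x∈p∩q⁻ p q

∪-lub : {p q r : Subset size} → p ⊆ r → q ⊆ r → p ∪ q ⊆ r
∪-lub f g m = [ f , g ]′ (∪⁻ m)

⁅⁆⊆ : {x : Fin size} {p : Subset size} → x ∈ p → ⁅ x ⁆ ⊆ p
⁅⁆⊆ {p = p} x∈ m = subst (_∈ p) (sym (x∈⁅y⁆⇒x≡y _ m)) x∈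

_#_ : Subset size → Subset size → Set
p # q = ∀ {x} → x ∈ p → x ∉ q

#-sym : {p q : Subset size} → p # q → q # p
#-sym d a b = d b a

infix 4 _#_ _⊆?_ _#?_

_⊆?_ : (p q : Subset size) → Dec (p ⊆ q)
p ⊆? q = map′ (λ f {x} → f x) (λ f x → f {x}) (all? (λ x → (x ∈? p) →-dec (x ∈? q)))

_#?_ : (p q : Subset size) → Dec (p # q)
p #? q = map′ (λ f {x} → f x) (λ f x → f {x}) (all? (λ x → (x ∈? p) →-dec ¬? (x ∈? q)))

private
  ∪≤ : (p q : Subset size) → ∣ p ∪ q ∣ᵥ ≤ ∣ p ∣ᵥ + ∣ q ∣ᵥ
  ∪≤ [] [] = z≤n
  ∪≤ (outside ∷ p) (outside ∷ q) = ∪≤ p q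
  ∪≤ (outside ∷ p) (inside ∷ q) = ≤-trans (s≤s (∪≤ p q)) (≤-reflexive (sym (+-suc ∣ p ∣ᵥ ∣ q ∣ᵥ)))
  ∪≤ (inside ∷ p) (outside ∷ q) = s≤s (∪≤ p q)
  ∪≤ (inside ∷ p) (inside ∷ q) = s≤s (≤-trans (∪≤ p q) (+-monoʳ-≤ ∣ p ∣ᵥ (n≤1+n _)))

  ∪≥ : (p q : Subset size) → p # q → ∣ p ∣ᵥ + ∣ q ∣ᵥ ≤ ∣ p ∪ q ∣ᵥ
  ∪≥ [] [] _ = z≤n
  ∪≥ (outside ∷ p) (outside ∷ q) d = ∪≥ p q (λ a b → d (vthere a) (vthere b))
  ∪≥ (outside ∷ p) (inside ∷ q) d = ≤-trans (≤-reflexive (+-suc ∣ p ∣ᵥ ∣ q ∣ᵥ)) (s≤s (∪≥ p q (λ a b → d (vthere a) (vthere b))))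
  ∪≥ (inside ∷ p) (outside ∷ q) d = s≤s (∪≥ p q (λ a b → d (vthere a) (vthere b)))
  ∪≥ (inside ∷ p) (inside ∷ q) d = ⊥-elim (d vhere vhere)

  nonempty-if : (p : Subset size) → 1 ≤ ∣ p ∣ᵥ → Nonempty p
  nonempty-if (inside ∷ p) _ = fz , vhere
  nonempty-if (outside ∷ p) l with nonempty-if p l
  ... | x , m = fs x , vthere m

  ─∅ : (p : Subset size) → p ─ ∅ ≡ p
  ─∅ [] = refl
  ─∅ (x ∷ p) = cong (x ∷_) (─∅ p)

  remove : {p : Subset size} {x : Fin size} → x ∈ p → suc ∣ p ─ ⁅ x ⁆ ∣ᵥ ≡ ∣ p ∣ᵥ
  remove {p = inside ∷ p} {fz} vhere = cong (suc ∘ ∣_∣ᵥ) (─∅ p)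
  remove {p = inside ∷ p} {fs x} (vthere m) = cong suc (remove m)
  remove {p = outside ∷ p} {fs x} (vthere m) = remove m

-- An opaque copy of the library's cardinality, so that a set can be inferred from its cardinality.
opaque
  ∣_∣ : Subset size → ℕ
  ∣ p ∣ = ∣ p ∣ᵥ

  card-is : (p : Subset size) → ∣ p ∣ ≡ ∣ p ∣ᵥ
  card-is p = refl

  ∣∪∣≤ : (p q : Subset size) → ∣ p ∪ q ∣ ≤ ∣ p ∣ + ∣ q ∣
  ∣∪∣≤ = ∪≤

  ∣#∪∣≥ : (p q : Subset size) → p # q → ∣ p ∣ + ∣ q ∣ ≤ ∣ p ∪ q ∣
  ∣#∪∣≥ = ∪≥

  card-mono : {p q : Subset size} → p ⊆ q → ∣ p ∣ ≤ ∣ q ∣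
  card-mono f = p⊆q⇒∣p∣≤∣q∣ f

  card-< : {p q : Subset size} → p ⊆ q → ∀ {x} → x ∈ q → x ∉ p → ∣ p ∣ < ∣ q ∣
  card-< f {x} a b = p⊂q⇒∣p∣<∣q∣ ((λ {y} → f {y}) , x , a , b)

  ∣⁅x⁆∣≡1 : (x : Fin size) → ∣ ⁅ x ⁆ ∣ ≡ 1
  ∣⁅x⁆∣≡1 = Data.Fin.Subset.Properties.∣⁅x⁆∣≡1

  ∣⊥∣≡0 : ∀ size → ∣ ∅ {size} ∣ ≡ 0
  ∣⊥∣≡0 = Data.Fin.Subset.Properties.∣⊥∣≡0

  ∣p∣≤n : (p : Subset size) → ∣ p ∣ ≤ size
  ∣p∣≤n = Data.Fin.Subset.Properties.∣p∣≤n

  card-nonempty : (p : Subset size) → 1 ≤ ∣ p ∣ → Nonempty p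
  card-nonempty = nonempty-if

  card-remove : {p : Subset size} {x : Fin size} → x ∈ p → suc ∣ p ─ ⁅ x ⁆ ∣ ≡ ∣ p ∣
  card-remove = remove

card-∪ : {p q r : Subset size} → p ⊆ q ∪ r → ∣ p ∣ ≤ ∣ q ∣ + ∣ r ∣
card-∪ {q = q} {r} f = ≤-trans (card-mono f) (∣∪∣≤ q r)

card-# : {p q r : Subset size} → p # q → p ⊆ r → q ⊆ r → ∣ p ∣ + ∣ q ∣ ≤ ∣ r ∣
card-# {p = p} {q} d f g = ≤-trans (∣#∪∣≥ p q d) (card-mono (∪-lub f g))

card⇒⊆ : {p q : Subset size} → p ⊆ q → ∣ q ∣ ≤ ∣ p ∣ → q ⊆ p
card⇒⊆ {p = p} f le {x} x∈q with x ∈? p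
... | yes x∈p = x∈p
... | no x∉p = ⊥-elim (<⇒≱ (card-< f x∈q x∉p) le)

card>0 : {p : Subset size} {x : Fin size} → x ∈ p → 1 ≤ ∣ p ∣
card>0 {x = x} x∈ = ≤-trans (≤-reflexive (sym (∣⁅x⁆∣≡1 x))) (card-mono (⁅⁆⊆ x∈))

card-add : (p : Subset size) (x : Fin size) → ∣ p ∪ ⁅ x ⁆ ∣ ≤ suc ∣ p ∣
card-add p x = ≤-trans (∣∪∣≤ p ⁅ x ⁆) (≤-reflexive (trans (cong (∣ p ∣ +_) (∣⁅x⁆∣≡1 x)) (+-comm ∣ p ∣ 1)))

card-split : (p q : Subset size) → ∣ p ∣ ≤ ∣ p ∩ q ∣ + ∣ p ─ q ∣
card-split p q = card-∪ (λ {x} m → split x m)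
  where
  split : ∀ x → x ∈ p → x ∈ (p ∩ q) ∪ (p ─ q)
  split x m with x ∈? q
  ... | yes m' = ∪ˡ (∩⁺ m m')
  ... | no m' = ∪ʳ (─⁺ m m')

injection⇒≤ : ∀ m (f : ℕ → Fin size) (p : Subset size) → (∀ i → i < m → f i ∈ p) →
  (∀ i j → i < m → j < m → f i ≡ f j → i ≡ j) → m ≤ ∣ p ∣
injection⇒≤ zero f p _ _ = z≤n
injection⇒≤ (suc m) f p mem inj = subst (suc m ≤_) (card-remove (mem m ≤-refl))
  (s≤s (injection⇒≤ m f (p ─ ⁅ f m ⁆)
    (λ i l → ─⁺ (mem i (m<n⇒m<1+n l)) (λ e → <⇒≢ l (inj i m (m<n⇒m<1+n l) ≤-refl (x∈⁅y⁆⇒x≡y _ e))))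
    (λ i j a b → inj i j (m<n⇒m<1+n a) (m<n⇒m<1+n b))))

injection⇒onto : ∀ m (f : ℕ → Fin size) (p : Subset size) → ∣ p ∣ ≤ m → (∀ i → i < m → f i ∈ p) →
  (∀ i j → i < m → j < m → f i ≡ f j → i ≡ j) → ∀ {x} → x ∈ p → ∃[ i ] (i < m × f i ≡ x)
injection⇒onto m f p le mem inj {x} x∈p with any? {n = m} (λ i → f (toℕ i) ≟F x)
... | yes (i , e) = toℕ i , toℕ<n i , e
... | no ne = ⊥-elim (<⇒≱ (≤-trans (≤-reflexive (card-remove x∈p)) le)
  (injection⇒≤ m f (p ─ ⁅ x ⁆)
    (λ i l → ─⁺ (mem i l) (λ e → ne (fromℕ< l , trans (cong f (toℕ-fromℕ< l)) (x∈⁅y⁆⇒x≡y _ e)))) inj))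

enumerate : Fin size → ∀ m (p : Subset size) → m ≤ ∣ p ∣ → Σ (ℕ → Fin size) λ f → ((∀ i → i < m → f i ∈ p) ×
  (∀ i j → i < m → j < m → f i ≡ f j → i ≡ j))
enumerate d zero p _ = (λ _ → d) , (λ _ ()) , λ _ _ ()
enumerate {size} d (suc m) p l with card-nonempty p (≤-trans (s≤s z≤n) l)
... | x , x∈ with enumerate d m (p ─ ⁅ x ⁆) (≤-pred (subst (suc m ≤_) (sym (card-remove x∈)) l))
... | f , mem , inj = g , mem' , inj'
  where
  g : ℕ → Fin size
  g zero = x
  g (suc i) = f i
  mem' : ∀ i → i < suc m → g i ∈ p
  mem' zero _ = x∈
  mem' (suc i) (s≤s l) = p─q⊆p _ _ (mem i l)
  new : ∀ i → i < m → f i ≢ x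
  new i l e = proj₂ (─⁻ p _ (mem i l)) (subst (_∈ ⁅ x ⁆) (sym e) (x∈⁅x⁆ _))
  inj' : ∀ i j → i < suc m → j < suc m → g i ≡ g j → i ≡ j
  inj' zero zero _ _ _ = refl
  inj' zero (suc j) _ (s≤s l) e = ⊥-elim (new j l (sym e))
  inj' (suc i) zero (s≤s l) _ e = ⊥-elim (new i l e)
  inj' (suc i) (suc j) (s≤s a) (s≤s b) e = cong suc (inj i j a b e)

module _ {Q : Subset size → Set} (Q? : ∀ S → Dec (Q S)) where

  opaque
    argmin : (f : Subset size → ℕ) → ∀ S → Q S → ∃[ S ] (Q S × (∀ T → Q T → f S ≤ f T))
    argmin f S q = go (f S) S q ≤-refl
      where
      go : ∀ m S → Q S → f S ≤ m → ∃[ S ] (Q S × (∀ T → Q T → f S ≤ f T))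
      go m S q le with anySubset? (λ T → Q? T ×-dec (f T <? f S))
      ... | no ne = S , q , λ T qT → ≮⇒≥ (λ l → ne (T , qT , l))
      go zero S q le | yes (T , qT , l) = ⊥-elim (n≮0 (≤-trans l le))
      go (suc m) S q le | yes (T , qT , l) = go m T qT (≤-pred (≤-trans l le))

  smallest : ∀ S → Q S → ∃[ S ] (Q S × (∀ T → Q T → ∣ S ∣ ≤ ∣ T ∣))
  smallest = argmin ∣_∣

  largest : ∀ S → Q S → ∃[ S ] (Q S × (∀ T → Q T → ∣ T ∣ ≤ ∣ S ∣))
  largest S q with argmin (λ S → size ∸ ∣ S ∣) S q
  ... | S' , q' , m = S' , q' , λ T qT → ≮⇒≥ (λ l → <⇒≱ (∸-monoʳ-< l (∣p∣≤n T)) (m T qT))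

-- Connected sets, components and neighbourhoods.

module Connectivity (G : Graph) where

  V : Set
  V = Fin (n G)

  VS : Set
  VS = Subset (n G)

  Path : VS → V → V → Set
  Path A = Conn G (_∈ A)

  opaque
    adj? : ∀ u v → Dec (Adj G u v)
    adj? u v = ¬? (u ≟F v) ×-dec ((E G u v ≟B true) ⊎-dec (E G v u ≟B true))

  adj-sym : ∀ {u v} → Adj G u v → Adj G v u
  adj-sym (ne , inj₁ e) = (λ q → ne (sym q)) , inj₂ e
  adj-sym (ne , inj₂ e) = (λ q → ne (sym q)) , inj₁ e

  module _ {S : VSet G} where

    conn-source : ∀ {u v} → Conn G S u v → S u
    conn-source (here s) = s
    conn-source (step s _ _) = s

    conn-target : ∀ {u v} → Conn G S u v → S v
    conn-target (here s) = s
    conn-target (step _ _ c) = conn-target c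

    conn-trans : ∀ {u v w} → Conn G S u v → Conn G S v w → Conn G S u w
    conn-trans (here _) d = d
    conn-trans (step s a c) d = step s a (conn-trans c d)

    conn-snoc : ∀ {u v w} → Conn G S u v → Adj G v w → S w → Conn G S u w
    conn-snoc c a s = conn-trans c (step (conn-target c) a (here s))

    conn-sym : ∀ {u v} → Conn G S u v → Conn G S v u
    conn-sym (here s) = here s
    conn-sym (step s a c) = conn-snoc (conn-sym c) (adj-sym a) s

    conn-mono : {S' : VSet G} → (∀ {x} → S x → S' x) → ∀ {u v} → Conn G S u v → Conn G S' u v
    conn-mono f (here s) = here (f s)
    conn-mono f (step s a c) = step (f s) a (conn-mono f c)

  Connected : VS → Set
  Connected D = Nonempty D × (∀ {u v} → u ∈ D → v ∈ D → Path D u v)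

  connected-from : ∀ {D u} → u ∈ D → (∀ {x} → x ∈ D → Path D u x) → Connected D
  connected-from u∈ f = (_ , u∈) , λ a b → conn-trans (conn-sym (f a)) (f b)

  connected-⁅⁆ : ∀ x → Connected ⁅ x ⁆
  connected-⁅⁆ x = connected-from (x∈⁅x⁆ x) (λ m → subst (Path ⁅ x ⁆ x) (sym (x∈⁅y⁆⇒x≡y _ m)) (here (x∈⁅x⁆ x)))

  Touch : VS → VS → Set
  Touch A B = ∃[ a ] ∃[ b ] (a ∈ A × b ∈ B × Adj G a b)

  touch-sym : ∀ {A B} → Touch A B → Touch B A
  touch-sym (a , b , x , y , e) = b , a , y , x , adj-sym e

  touch-mono : ∀ {A B A' B'} → A ⊆ A' → B ⊆ B' → Touch A B → Touch A' B'
  touch-mono f g (a , b , x , y , e) = a , b , f x , g y , e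

  opaque
    touch? : ∀ A B → Dec (Touch A B)
    touch? A B = any? (λ a → any? (λ b → (a ∈? A) ×-dec ((b ∈? B) ×-dec adj? a b)))

  connected-∪-touch : ∀ {A B} → Connected A → Connected B → Touch A B → Connected (A ∪ B)
  connected-∪-touch {A} {B} cA cB (a , b , a∈ , b∈ , e) = connected-from (∪ˡ a∈) from-a
    where
    from-a : ∀ {x} → x ∈ A ∪ B → Path (A ∪ B) a x
    from-a m with ∪⁻ m
    ... | inj₁ x∈ = conn-mono ∪ˡ (proj₂ cA a∈ x∈)
    ... | inj₂ x∈ = step (∪ˡ a∈) e (conn-mono ∪ʳ (proj₂ cB b∈ x∈))

  connected-∪-meet : ∀ {A B x} → Connected A → Connected B → x ∈ A → x ∈ B → Connected (A ∪ B)
  connected-∪-meet {A} {B} {x} cA cB xA xB = connected-from (∪ˡ xA) from-x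
    where
    from-x : ∀ {y} → y ∈ A ∪ B → Path (A ∪ B) x y
    from-x m with ∪⁻ m
    ... | inj₁ y∈ = conn-mono ∪ˡ (proj₂ cA xA y∈)
    ... | inj₂ y∈ = conn-mono ∪ʳ (proj₂ cB xB y∈)

  connected-∪⁅⁆ : ∀ {A x} → Connected A → Touch A ⁅ x ⁆ → Connected (A ∪ ⁅ x ⁆)
  connected-∪⁅⁆ {x = x} cA t = connected-∪-touch cA (connected-⁅⁆ x) t

  touch-⁅⁆ : ∀ {A a x} → a ∈ A → Adj G a x → Touch A ⁅ x ⁆
  touch-⁅⁆ a∈ e = _ , _ , a∈ , x∈⁅x⁆ _ , e

  record Component (W K : VS) : Set where
    field
      inside-region : K ⊆ W
      connected : Connected K
      closed : ∀ {x y} → x ∈ K → Adj G x y → y ∈ W → y ∈ K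
  open Component public

  opaque
    component : ∀ W {u} → u ∈ W → ∃[ K ] (u ∈ K × Component W K)
    component W {u} u∈W = go (n G) ⁅ u ⁆ (≤-trans (∣p∣≤n W) (m≤m+n _ _)) (x∈⁅x⁆ u) (⁅⁆⊆ u∈W)
      (λ m → proj₂ (connected-⁅⁆ u) (x∈⁅x⁆ u) m)
      where
      go : ∀ m R → ∣ W ∣ ≤ m + ∣ R ∣ → u ∈ R → R ⊆ W → (∀ {x} → x ∈ R → Path R u x) →
        ∃[ K ] (u ∈ K × Component W K)
      go m R le u∈R R⊆W reach with any? (λ y → ((y ∈? W) ×-dec ¬? (y ∈? R)) ×-dec any? (λ x → (x ∈? R) ×-dec adj? x y))
      ... | no ne = R , u∈R , record
        { inside-region = R⊆W
        ; connected = connected-from u∈R reach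
        ; closed = λ {x} {y} x∈ e y∈W → case y ∈? R of λ
            { (yes y∈) → y∈
            ; (no y∉) → ⊥-elim (ne (y , (y∈W , y∉) , x , x∈ , e)) } }
      go zero R le u∈R R⊆W reach | yes (y , (y∈W , y∉R) , x , x∈R , e) = ⊥-elim (<⇒≱ (card-< R⊆W y∈W y∉R) le)
      go (suc m) R le u∈R R⊆W reach | yes (y , (y∈W , y∉R) , x , x∈R , e) =
        go m (R ∪ ⁅ y ⁆) (≤-trans le (≤-trans (≤-reflexive (sym (+-suc m ∣ R ∣))) (+-monoʳ-≤ m (card-< ∪ˡ (∪ʳ (x∈⁅x⁆ y)) y∉R))))
          (∪ˡ u∈R) (∪-lub R⊆W (⁅⁆⊆ y∈W)) reach'
        where
        reach' : ∀ {z} → z ∈ R ∪ ⁅ y ⁆ → Path (R ∪ ⁅ y ⁆) u z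
        reach' m with ∪⁻ m
        ... | inj₁ z∈ = conn-mono ∪ˡ (reach z∈)
        ... | inj₂ z∈ rewrite x∈⁅y⁆⇒x≡y _ z∈ = conn-snoc (conn-mono ∪ˡ (reach x∈R)) e (∪ʳ (x∈⁅x⁆ y))

  component-path : ∀ {W K x y} → Component W K → x ∈ K → Path W x y → y ∈ K
  component-path c x∈ (here _) = x∈
  component-path c x∈ (step _ e p) = component-path c (closed c x∈ e (conn-source p)) p

  absorb : ∀ {W K D x} → Component W K → Connected D → D ⊆ W → x ∈ K → x ∈ D → D ⊆ K
  absorb c cD D⊆W x∈K x∈D y∈D = component-path c x∈K (conn-mono D⊆W (proj₂ cD x∈D y∈D))

  absorb-touch : ∀ {W K D} → Component W K → Connected D → D ⊆ W → Touch K D → D ⊆ K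
  absorb-touch c cD D⊆W (a , b , a∈ , b∈ , e) = absorb c cD D⊆W (closed c a∈ e (D⊆W b∈)) b∈

  opaque
    path? : ∀ W x y → Dec (Path W x y)
    path? W x y with x ∈? W
    ... | no x∉ = no (x∉ ∘ conn-source)
    ... | yes x∈ with component W x∈
    ... | K , x∈K , c with y ∈? K
    ...   | yes y∈ = yes (conn-mono (inside-region c) (proj₂ (connected c) x∈K y∈))
    ...   | no y∉ = no (y∉ ∘ component-path c x∈K)

  opaque
    connected? : ∀ D → Dec (Connected D)
    connected? D = nonempty? D ×-dec map′ (λ f {u} {v} → f u v) (λ f u v → f {u} {v})
      (all? (λ u → all? (λ v → (u ∈? D) →-dec ((v ∈? D) →-dec path? D u v))))

  opaque
    component? : ∀ W K → Dec (Component W K)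
    component? W K = map′ to from
      ((K ⊆? W) ×-dec (connected? K ×-dec all? (λ x → all? (λ y → (x ∈? K) →-dec (adj? x y →-dec ((y ∈? W) →-dec (y ∈? K)))))))
      where
      Closed : Set
      Closed = ∀ x y → x ∈ K → Adj G x y → y ∈ W → y ∈ K
      to : K ⊆ W × Connected K × Closed → Component W K
      to (a , b , c) = record { inside-region = a ; connected = b ; closed = λ {x} {y} → c x y }
      from : Component W K → K ⊆ W × Connected K × Closed
      from c = inside-region c , connected c , λ x y → closed c

  opaque
    first-entry : ∀ {W x y} (T : VS) → Path W x y → x ∉ T → y ∈ T →
      ∃[ z ] ∃[ t ] (Path (W ─ T) x z × t ∈ W × t ∈ T × Adj G z t)
    first-entry T (here _) x∉ y∈ = ⊥-elim (x∉ y∈)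
    first-entry T (step {w = w} s e p) x∉ y∈ with w ∈? T
    ... | yes w∈ = _ , w , here (─⁺ s x∉) , conn-source p , w∈ , e
    ... | no w∉ with first-entry T p w∉ y∈
    ... | z , t , q , rest = z , t , step (─⁺ s x∉) e q , rest

  neighbour? : ∀ D v → Dec (v ∉ D × ∃[ d ] (d ∈ D × Adj G d v))
  neighbour? D v = ¬? (v ∈? D) ×-dec any? (λ d → (d ∈? D) ×-dec adj? d v)

  opaque
    N : VS → VS
    N D = sub (neighbour? D)

    N⁺ : ∀ {D v d} → v ∉ D → d ∈ D → Adj G d v → v ∈ N D
    N⁺ {D} v∉ d∈ e = sub⁺ (neighbour? D) (v∉ , _ , d∈ , e)

    N⁻ : ∀ {D v} → v ∈ N D → v ∉ D × ∃[ d ] (d ∈ D × Adj G d v)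
    N⁻ {D} m = sub⁻ (neighbour? D) m

  touch⇒N : ∀ {D v} → v ∈ N D → Touch D ⁅ v ⁆
  touch⇒N m with N⁻ m
  ... | _ , d , d∈ , e = touch-⁅⁆ d∈ e

  opaque
    proper⇒N : ∀ {C D x} → Connected C → D ⊆ C → Nonempty D → x ∈ C → x ∉ D → ∃[ y ] (y ∈ N D × y ∈ C)
    proper⇒N cC D⊆C (d , d∈) x∈ x∉ with first-entry _ (proj₂ cC x∈ (D⊆C d∈)) x∉ d∈
    ... | z , t , p , _ , t∈ , e with ─⁻ _ _ (conn-target p)
    ... | z∈ , z∉ = z , N⁺ z∉ t∈ (adj-sym e) , z∈

  NIn : VS → VS → VS
  NIn C D = N D ∩ C

  Nontouching : VS → VS → Set
  Nontouching A B = A # B × A # N B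

  nontouching-sym : ∀ {A B} → Nontouching A B → Nontouching B A
  nontouching-sym (d , e) = #-sym d , λ b∈B b∈NA → let (_ , a , a∈ , ab) = N⁻ b∈NA in
    e a∈ (N⁺ (d a∈) b∈B (adj-sym ab))

  nontouching⇒¬touch : ∀ {A B} → Nontouching A B → ¬ Touch A B
  nontouching⇒¬touch (d , e) (a , b , a∈ , b∈ , ab) = e a∈ (N⁺ (d a∈) b∈ (adj-sym ab))

  nontouching-mono : ∀ {A B A' B'} → A' ⊆ A → B' ⊆ B → Nontouching A B → Nontouching A' B'
  nontouching-mono f g nt = (λ a b → proj₁ nt (f a) (g b)) , λ a b →
    let (_ , d , d∈ , e) = N⁻ b in nontouching⇒¬touch nt (_ , d , f a , g d∈ , adj-sym e)

-- Menger's theorem.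

module Menger {k : ℕ} where

  private
    Edges : Set
    Edges = List (Fin k × Fin k)

    pair-≟ : (p q : Fin k × Fin k) → Dec (p ≡ q)
    pair-≟ (a , b) (c , d) = map′ (λ { (refl , refl) → refl }) (λ { refl → refl , refl }) ((a ≟F c) ×-dec (b ≟F d))

    listed? : ∀ (es : Edges) p → Dec (p ∈ᴸ es)
    listed? es p = anyᴸ? (pair-≟ p) es

  -- Edge lists present the graph because the theorem is proved by induction on the number of edges.
  graphOf : Edges → Graph
  graphOf es = mkGraph k (λ u v → does (listed? es (u , v)))

  private
    does⁻ : {P : Set} (d : Dec P) → does d ≡ true → P
    does⁻ (yes p) _ = p

  adjOf⁻ : ∀ {es u v} → Adj (graphOf es) u v → (u , v) ∈ᴸ es ⊎ (v , u) ∈ᴸ es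
  adjOf⁻ {es} (_ , inj₁ e) = inj₁ (does⁻ (listed? es _) e)
  adjOf⁻ {es} (_ , inj₂ e) = inj₂ (does⁻ (listed? es _) e)

  adjOf⁺ : ∀ {es u v} → u ≢ v → (u , v) ∈ᴸ es ⊎ (v , u) ∈ᴸ es → Adj (graphOf es) u v
  adjOf⁺ {es} ne (inj₁ m) = ne , inj₁ (dec-true (listed? es _) m)
  adjOf⁺ {es} ne (inj₂ m) = ne , inj₂ (dec-true (listed? es _) m)

  adjOf-mono : ∀ {es es′ u v} → (∀ {p} → p ∈ᴸ es → p ∈ᴸ es′) → Adj (graphOf es) u v → Adj (graphOf es′) u v
  adjOf-mono {es} f a with adjOf⁻ {es} a
  ... | inj₁ m = adjOf⁺ (proj₁ a) (inj₁ (f m))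
  ... | inj₂ m = adjOf⁺ (proj₁ a) (inj₂ (f m))

  open module C {es} = Connectivity (graphOf es) using (Path; adj-sym; conn-mono; connected-from; connected-⁅⁆; connected-∪-meet; connected-∪-touch)

  ConnectedIn : Edges → Subset k → Set
  ConnectedIn es = Connectivity.Connected (graphOf es)

  path-mono : ∀ {es es′ A u v} → (∀ {p} → p ∈ᴸ es → p ∈ᴸ es′) → Path {es} A u v → Path {es′} A u v
  path-mono f (here s) = here s
  path-mono {es} {es′} f (step s a p) = step s (adjOf-mono {es} {es′} f a) (path-mono {es} {es′} f p)

  connectedIn-mono : ∀ {es es′ A} → (∀ {p} → p ∈ᴸ es → p ∈ᴸ es′) → ConnectedIn es A → ConnectedIn es′ A
  connectedIn-mono {es} {es′} f (ne , c) = ne , λ a b → path-mono {es} {es′} f (c a b)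

  record Separation (es : Edges) (A B : Subset k) (m : ℕ) : Set where
    field
      U W : Subset k
      A⊆U : A ⊆ U
      B⊆W : B ⊆ W
      cover : ∀ x → x ∈ U ⊎ x ∈ W
      uncrossed : ∀ {u w} → Adj (graphOf es) u w → u ∉ W → w ∈ U
      small : ∣ U ∩ W ∣ < m

    ∉U⇒∈W : ∀ {x} → x ∉ U → x ∈ W
    ∉U⇒∈W {x} x∉ = [ (λ x∈ → ⊥-elim (x∉ x∈)) , id ]′ (cover x)

    ∉W⇒∈U : ∀ {x} → x ∉ W → x ∈ U
    ∉W⇒∈U {x} x∉ = [ id , (λ x∈ → ⊥-elim (x∉ x∈)) ]′ (cover x)

    uncrossed′ : ∀ {u w} → Adj (graphOf es) u w → w ∉ U → u ∈ W
    uncrossed′ {u} a w∉ with u ∈? W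
    ... | yes u∈ = u∈
    ... | no u∉ = ⊥-elim (w∉ (uncrossed a u∉))

  -- Disjoint connected sets stand in for disjoint paths: they can be glued by taking unions, and
  -- connectedness is all that is needed to extend branch sets along them.
  record Linkage (es : Edges) (A B : Subset k) (m : ℕ) : Set where
    field
      part : ℕ → Subset k
      part-conn : ∀ i → i < m → ConnectedIn es (part i)
      part-disj : ∀ i j → i < m → j < m → i ≢ j → part i # part j
      start end : ℕ → Fin k
      start∈A : ∀ i → i < m → start i ∈ A
      start∈ : ∀ i → i < m → start i ∈ part i
      end∈B : ∀ i → i < m → end i ∈ B
      end∈ : ∀ i → i < m → end i ∈ part i

    representative-inj : (f : ℕ → Fin k) → (∀ i → i < m → f i ∈ part i) → ∀ i j → i < m → j < m → f i ≡ f j → i ≡ j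
    representative-inj f f∈ i j li lj e with i ≟ j
    ... | yes eq = eq
    ... | no ne = ⊥-elim (part-disj i j li lj ne (f∈ i li) (subst (_∈ part j) (sym e) (f∈ j lj)))

    -- Each part claims an element of `T`, and `T` has at most `m` elements, so none is left to be a
    -- second element of some part. With `T` a separator, this makes parts meet it only in their
    -- ends.
    representative-unique : (f : ℕ → Fin k) → (∀ i → i < m → f i ∈ part i) → ∀ T → ∣ T ∣ ≤ m → (∀ i → i < m → f i ∈ T) →
      ∀ i → i < m → ∀ {z} → z ∈ T → z ∈ part i → z ≡ f i
    representative-unique f f∈ T le f∈T i li z∈T z∈ with injection⇒onto m f T le f∈T (representative-inj f f∈) z∈T
    ... | j , lj , refl with i ≟ j
    ... | yes refl = refl
    ... | no ne = ⊥-elim (part-disj i j li lj ne z∈ (f∈ j lj))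

  private
    both? : (R : Subset k) (p : Fin k × Fin k) → Dec (proj₁ p ∈ R × proj₂ p ∈ R)
    both? R (a , b) = (a ∈? R) ×-dec (b ∈? R)

    within : Subset k → Edges → Edges
    within R = filter (both? R)

    within⊆ : ∀ {R es p} → p ∈ᴸ within R es → p ∈ᴸ es
    within⊆ {R} {es} m = proj₁ (∈-filter⁻ (both? R) {xs = es} m)

    within-adj : ∀ {R es u v} → Adj (graphOf es) u v → u ∈ R → v ∈ R → Adj (graphOf (within R es)) u v
    within-adj {R} {es} a u∈ v∈ with adjOf⁻ {es} a
    ... | inj₁ m = adjOf⁺ (proj₁ a) (inj₁ (∈-filter⁺ (both? R) m (u∈ , v∈)))
    ... | inj₂ m = adjOf⁺ (proj₁ a) (inj₂ (∈-filter⁺ (both? R) m (v∈ , u∈)))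

    stays-within : ∀ {R es D x} → ConnectedIn (within R es) D → x ∈ D → x ∈ R → D ⊆ R
    stays-within {R} {es} {D} (_ , c) x∈D x∈R y∈D = go (c x∈D y∈D) x∈R
      where
      go : ∀ {x y} → Path {within R es} D x y → x ∈ R → y ∈ R
      go (here _) r = r
      go (step _ a p) r with adjOf⁻ {within R es} a
      ... | inj₁ m = go p (proj₂ (proj₂ (∈-filter⁻ (both? R) {xs = es} m)))
      ... | inj₂ m = go p (proj₁ (proj₂ (∈-filter⁻ (both? R) {xs = es} m)))

  MengerFor : Edges → Set
  MengerFor es = ∀ A B m → Separation es A B m ⊎ Linkage es A B m

  -- Göring's step: es is separated by (U , W) but the edge x-y, present in es′, crosses the separation.
  -- Linkages from A to (U ∩ W) ∪ {x} and from (U ∩ W) ∪ {y} to B are glued along U ∩ W and x-y.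
  private
    module Cross {es es′ : Edges} (es⊆es′ : ∀ {p} → p ∈ᴸ es → p ∈ᴸ es′) {A B m} (s : Separation es A B m)
      (x y : Fin k) (xy : Adj (graphOf es′) x y)
      (adj-new : ∀ {u v} → Adj (graphOf es′) u v → Adj (graphOf es) u v ⊎ ((u ≡ x × v ≡ y) ⊎ (u ≡ y × v ≡ x)))
      (x∉W : x ∉ Separation.W s) (y∉U : y ∉ Separation.U s) where
      open Separation s

      S A' B' : Subset k
      S = U ∩ W
      A' = S ∪ ⁅ x ⁆
      B' = S ∪ ⁅ y ⁆

      x∈U : x ∈ U
      x∈U = ∉W⇒∈U x∉W
      y∈W : y ∈ W
      y∈W = ∉U⇒∈W y∉U

      ∣A'∣≤ : ∣ A' ∣ ≤ m
      ∣A'∣≤ = ≤-trans (card-add S x) small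
      ∣B'∣≤ : ∣ B' ∣ ≤ m
      ∣B'∣≤ = ≤-trans (card-add S y) small

      -- All of `W` is put on the far side. The edge from `x` to `y` does not cross, because `x`
      -- lies in `A'` and hence in `T.W`; the boundary does not grow, because `S` lies in `A'` as
      -- well. `right` is the mirror image.
      left : Separation (within U es) A A' m → Separation es′ A B m
      left t = record
        { U = T.U ∩ U
        ; W = T.W ∪ W
        ; A⊆U = λ a → ∩⁺ (T.A⊆U a) (A⊆U a)
        ; B⊆W = λ b → ∪ʳ (B⊆W b)
        ; cover = cover'
        ; uncrossed = λ a u∉ → uncrossed' (adj-new a) u∉
        ; small = ≤-trans (s≤s (card-mono inter)) T.small }
        where
        module T = Separation t
        cover' : ∀ z → z ∈ T.U ∩ U ⊎ z ∈ T.W ∪ W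
        cover' z with cover z | T.cover z
        ... | inj₂ z∈ | _ = inj₂ (∪ʳ z∈)
        ... | inj₁ z∈ | inj₁ z∈' = inj₁ (∩⁺ z∈' z∈)
        ... | inj₁ z∈ | inj₂ z∈' = inj₂ (∪ˡ z∈')
        uncrossed' : ∀ {u w} → Adj (graphOf es) u w ⊎ ((u ≡ x × w ≡ y) ⊎ (u ≡ y × w ≡ x)) → u ∉ T.W ∪ W → w ∈ T.U ∩ U
        uncrossed' (inj₁ a) u∉ = ∩⁺ (T.uncrossed (within-adj {U} {es} a (∉W⇒∈U (u∉ ∘ ∪ʳ)) w∈U) (u∉ ∘ ∪ˡ)) w∈U
          where w∈U = uncrossed a (u∉ ∘ ∪ʳ)
        uncrossed' (inj₂ (inj₁ (refl , _))) u∉ = ⊥-elim (u∉ (∪ˡ (T.B⊆W (∪ʳ (x∈⁅x⁆ x)))))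
        uncrossed' (inj₂ (inj₂ (refl , _))) u∉ = ⊥-elim (u∉ (∪ʳ y∈W))
        inter : (T.U ∩ U) ∩ (T.W ∪ W) ⊆ T.U ∩ T.W
        inter i with ∩⁻ i
        ... | a , b with ∩⁻ a | ∪⁻ b
        ... | zU1 , zU | inj₁ zW1 = ∩⁺ zU1 zW1
        ... | zU1 , zU | inj₂ zW = ∩⁺ zU1 (T.B⊆W (∪ˡ (∩⁺ zU zW)))

      right : Separation (within W es) B' B m → Separation es′ A B m
      right t = record
        { U = U ∪ T.U
        ; W = W ∩ T.W
        ; A⊆U = λ a → ∪ˡ (A⊆U a)
        ; B⊆W = λ b → ∩⁺ (B⊆W b) (T.B⊆W b)
        ; cover = cover'
        ; uncrossed = λ {u} {w} a u∉ → uncrossed' (adj-new a) u∉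
        ; small = ≤-trans (s≤s (card-mono inter)) T.small }
        where
        module T = Separation t
        cover' : ∀ z → z ∈ U ∪ T.U ⊎ z ∈ W ∩ T.W
        cover' z with cover z | T.cover z
        ... | inj₁ z∈ | _ = inj₁ (∪ˡ z∈)
        ... | inj₂ z∈ | inj₁ z∈' = inj₁ (∪ʳ z∈')
        ... | inj₂ z∈ | inj₂ z∈' = inj₂ (∩⁺ z∈ z∈')
        uncrossed' : ∀ {u w} → Adj (graphOf es) u w ⊎ ((u ≡ x × w ≡ y) ⊎ (u ≡ y × w ≡ x)) → u ∉ W ∩ T.W → w ∈ U ∪ T.U
        uncrossed' {u} {w} (inj₁ a) u∉ with w ∈? U
        ... | yes w∈ = ∪ˡ w∈
        ... | no w∉ = ∪ʳ (T.uncrossed (within-adj {W} {es} a u∈W (∉U⇒∈W w∉)) (λ c → u∉ (∩⁺ u∈W c)))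
          where u∈W = uncrossed′ a w∉
        uncrossed' (inj₂ (inj₁ (_ , refl))) u∉ = ∪ʳ (T.A⊆U (∪ʳ (x∈⁅x⁆ y)))
        uncrossed' (inj₂ (inj₂ (_ , refl))) u∉ = ∪ˡ x∈U
        inter : (U ∪ T.U) ∩ (W ∩ T.W) ⊆ T.U ∩ T.W
        inter i with ∩⁻ i
        ... | a , b with ∪⁻ a | ∩⁻ b
        ... | inj₁ zU | zW , zW1 = ∩⁺ (T.A⊆U (∪ˡ (∩⁺ zU zW))) zW1
        ... | inj₂ zU1 | zW , zW1 = ∩⁺ zU1 zW1

      module Glue (P : Linkage (within U es) A A' m) (Q : Linkage (within W es) B' B m) where
        module P = Linkage P
        module Q = Linkage Q

        P⊆U : ∀ i → i < m → P.part i ⊆ U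
        P⊆U i l = stays-within {U} {es} (P.part-conn i l) (P.start∈ i l) (A⊆U (P.start∈A i l))

        Q⊆W : ∀ i → i < m → Q.part i ⊆ W
        Q⊆W i l = stays-within {W} {es} (Q.part-conn i l) (Q.end∈ i l) (B⊆W (Q.end∈B i l))

        Matched : ℕ → ℕ → Set
        Matched i j = (P.end i ≡ Q.start j × P.end i ∈ S) ⊎ (P.end i ≡ x × Q.start j ≡ y)

        onto : ∀ {t} → t ∈ B' → ∃[ j ] (j < m × Q.start j ≡ t)
        onto = injection⇒onto m Q.start B' ∣B'∣≤ Q.start∈A (Q.representative-inj Q.start Q.start∈)

        match : ∀ i → i < m → ∃[ j ] (j < m × Matched i j)
        match i l with ∪⁻ (P.end∈B i l)
        ... | inj₁ e∈S with onto (∪ˡ e∈S)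
        ...   | j , lj , e = j , lj , inj₁ (sym e , e∈S)
        match i l | inj₂ e∈x with onto (∪ʳ (x∈⁅x⁆ y))
        ...   | j , lj , e = j , lj , inj₂ (x∈⁅y⁆⇒x≡y _ e∈x , e)

        partner : ℕ → ℕ
        partner i with i <? m
        ... | yes l = proj₁ (match i l)
        ... | no _ = 0

        partner-spec : ∀ i → i < m → partner i < m × Matched i (partner i)
        partner-spec i l with i <? m
        ... | yes l' = proj₂ (match i l')
        ... | no ¬l = ⊥-elim (¬l l)

        y∉S : y ∉ S
        y∉S y∈ = y∉U (proj₁ (∩⁻ y∈))

        unmatch : ∀ {i i' j} → i < m → i' < m → Matched i j → Matched i' j → i ≡ i'
        unmatch {i} {i'} l l' (inj₁ (a , _)) (inj₁ (b , _)) = P.representative-inj P.end P.end∈ i i' l l' (trans a (sym b))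
        unmatch {i} {i'} l l' (inj₂ (a , _)) (inj₂ (b , _)) = P.representative-inj P.end P.end∈ i i' l l' (trans a (sym b))
        unmatch l l' (inj₁ (a , s)) (inj₂ (_ , b)) = ⊥-elim (y∉S (subst (_∈ S) (trans a b) s))
        unmatch l l' (inj₂ (_ , b)) (inj₁ (a , s)) = ⊥-elim (y∉S (subst (_∈ S) (trans a b) s))

        -- The parts of `P` live in `U` and those of `Q` in `W`, so a common vertex is in `S`. There
        -- it can only be the end of the one and the start of the other, and the matching is
        -- injective.
        apart : ∀ i i' → i < m → i' < m → i ≢ i' → P.part i # Q.part (partner i')
        apart i i' l l' ne {z} z∈P z∈Q with partner-spec i' l'
        ... | lj , mt = clash mt
          where
          z∈S : z ∈ S
          z∈S = ∩⁺ (P⊆U i l z∈P) (Q⊆W _ lj z∈Q)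
          zP : z ≡ P.end i
          zP = P.representative-unique P.end P.end∈ A' ∣A'∣≤ P.end∈B i l (∪ˡ z∈S) z∈P
          zQ : z ≡ Q.start (partner i')
          zQ = Q.representative-unique Q.start Q.start∈ B' ∣B'∣≤ Q.start∈A _ lj (∪ˡ z∈S) z∈Q
          clash : Matched i' (partner i') → ⊥
          clash (inj₁ (a , _)) = ne (P.representative-inj P.end P.end∈ i i' l l' (trans (trans (sym zP) zQ) (sym a)))
          clash (inj₂ (_ , b)) = y∉S (subst (_∈ S) (trans zQ b) z∈S)

        result : Linkage es′ A B m
        result = record
          { part = λ i → P.part i ∪ Q.part (partner i)
          ; part-conn = conn
          ; part-disj = disj
          ; start = P.start
          ; end = λ i → Q.end (partner i)
          ; start∈A = P.start∈A
          ; start∈ = λ i l → ∪ˡ (P.start∈ i l)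
          ; end∈B = λ i l → Q.end∈B _ (proj₁ (partner-spec i l))
          ; end∈ = λ i l → ∪ʳ (Q.end∈ _ (proj₁ (partner-spec i l))) }
          where
          conn : ∀ i → i < m → ConnectedIn es′ (P.part i ∪ Q.part (partner i))
          conn i l with partner-spec i l
          ... | lj , mt = join mt
            where
            cP : ConnectedIn es′ (P.part i)
            cP = connectedIn-mono {within U es} {es′} (λ {p} q → es⊆es′ (within⊆ {U} {es} q)) (P.part-conn i l)
            cQ : ConnectedIn es′ (Q.part (partner i))
            cQ = connectedIn-mono {within W es} {es′} (λ {p} q → es⊆es′ (within⊆ {W} {es} q)) (Q.part-conn _ lj)
            join : Matched i (partner i) → ConnectedIn es′ (P.part i ∪ Q.part (partner i))
            join (inj₁ (e , _)) = connected-∪-meet {es′} cP cQ (P.end∈ i l) (subst (_∈ Q.part (partner i)) (sym e) (Q.start∈ _ lj))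
            join (inj₂ (e , e')) = connected-∪-touch {es′} cP cQ
              (x , y , subst (_∈ P.part i) e (P.end∈ i l) , subst (_∈ Q.part (partner i)) e' (Q.start∈ _ lj) , xy)
          disj : ∀ i j → i < m → j < m → i ≢ j → P.part i ∪ Q.part (partner i) # P.part j ∪ Q.part (partner j)
          disj i j l l' ne a b with ∪⁻ a | ∪⁻ b
          ... | inj₁ p | inj₁ q = P.part-disj i j l l' ne p q
          ... | inj₁ p | inj₂ q = apart i j l l' ne p q
          ... | inj₂ p | inj₁ q = apart j i l' l (ne ∘ sym) q p
          ... | inj₂ p | inj₂ q with partner-spec i l | partner-spec j l'
          ...   | li , mi | lj , mj = Q.part-disj _ _ li lj (λ e → ne (unmatch l l' mi (subst (Matched j) (sym e) mj))) p q

      cross : MengerFor (within U es) → MengerFor (within W es) → Separation es′ A B m ⊎ Linkage es′ A B m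
      cross ihU ihW with ihU A A' m | ihW B' B m
      ... | inj₁ t | _ = inj₁ (left t)
      ... | inj₂ _ | inj₁ t = inj₁ (right t)
      ... | inj₂ P | inj₂ Q = inj₂ (Glue.result P Q)

  -- Without the first edge there is a linkage, which is kept, or a separation. Work remains only if
  -- the edge crosses the separation; the recursive calls then concern filtered sublists of `es`,
  -- which is why fuel is used.
  menger-fuel : Fin k → ∀ f es → length es ≤ f → MengerFor es
  menger-fuel d f []ᴸ _ A B m with m ≤? ∣ A ∩ B ∣
  ... | yes le with enumerate d m (A ∩ B) le
  ...   | g , mem , inj = inj₂ record
      { part = λ i → ⁅ g i ⁆
      ; part-conn = λ i _ → connected-⁅⁆ {[]ᴸ} (g i)
      ; part-disj = λ i j l l' ne a b → ne (inj i j l l' (trans (sym (x∈⁅y⁆⇒x≡y _ a)) (x∈⁅y⁆⇒x≡y _ b)))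
      ; start = g
      ; end = g
      ; start∈A = λ i l → proj₁ (∩⁻ (mem i l))
      ; start∈ = λ i _ → x∈⁅x⁆ (g i)
      ; end∈B = λ i l → proj₂ (∩⁻ (mem i l))
      ; end∈ = λ i _ → x∈⁅x⁆ (g i) }
  menger-fuel d f []ᴸ _ A B m | no nle = inj₁ record
      { U = A
      ; W = rest
      ; A⊆U = id
      ; B⊆W = λ b → sub⁺ rest? (inj₂ b)
      ; cover = λ x → case x ∈? A of λ { (yes a) → inj₁ a ; (no a) → inj₂ (sub⁺ rest? (inj₁ a)) }
      ; uncrossed = λ a _ → case adjOf⁻ {[]ᴸ} a of λ { (inj₁ ()) ; (inj₂ ()) }
      ; small = ≤-trans (s≤s (card-mono (λ i → inter (proj₁ (∩⁻ i)) (sub⁻ rest? (proj₂ (∩⁻ i)))))) (≰⇒> nle) }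
    where
    rest? : ∀ x → Dec (x ∉ A ⊎ x ∈ B)
    rest? x = ¬? (x ∈? A) ⊎-dec (x ∈? B)
    rest : Subset k
    rest = sub rest?
    inter : ∀ {x} → x ∈ A → x ∉ A ⊎ x ∈ B → x ∈ A ∩ B
    inter a (inj₁ na) = ⊥-elim (na a)
    inter a (inj₂ b) = ∩⁺ a b
  menger-fuel d (suc f) (e@(x , y) ∷ᴸ es) (s≤s le) A B m with menger-fuel d f es le A B m
  ... | inj₂ P = inj₂ record
      { part = part
      ; part-conn = λ i l → connectedIn-mono {es} {e ∷ᴸ es} athere (part-conn i l)
      ; part-disj = part-disj ; start = start ; end = end
      ; start∈A = start∈A ; start∈ = start∈ ; end∈B = end∈B ; end∈ = end∈ }
    where open Linkage P
  ... | inj₁ s = go (¬? (x ∈? W) ×-dec ¬? (y ∈? U)) (¬? (y ∈? W) ×-dec ¬? (x ∈? U))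
    where
    open Separation s
    adj-new : ∀ {u v} → Adj (graphOf (e ∷ᴸ es)) u v → Adj (graphOf es) u v ⊎ ((u ≡ x × v ≡ y) ⊎ (u ≡ y × v ≡ x))
    adj-new a with adjOf⁻ {e ∷ᴸ es} a
    ... | inj₁ (ahere refl) = inj₂ (inj₁ (refl , refl))
    ... | inj₁ (athere m) = inj₁ (adjOf⁺ (proj₁ a) (inj₁ m))
    ... | inj₂ (ahere refl) = inj₂ (inj₂ (refl , refl))
    ... | inj₂ (athere m) = inj₁ (adjOf⁺ (proj₁ a) (inj₂ m))
    swap : ∀ {P Q R : Set} → P ⊎ (Q ⊎ R) → P ⊎ (R ⊎ Q)
    swap (inj₁ p) = inj₁ p
    swap (inj₂ (inj₁ q)) = inj₂ (inj₂ q)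
    swap (inj₂ (inj₂ q)) = inj₂ (inj₁ q)
    distinct : x ∉ W → y ∉ U → x ≢ y
    distinct a b refl = b (∉W⇒∈U a)
    shorter : ∀ R → MengerFor (within R es)
    shorter R = menger-fuel d f (within R es) (≤-trans (length-filter (both? R) es) le)
    go : Dec (x ∉ W × y ∉ U) → Dec (y ∉ W × x ∉ U) → Separation (e ∷ᴸ es) A B m ⊎ Linkage (e ∷ᴸ es) A B m
    go (yes (a , b)) _ = Cross.cross {es} {e ∷ᴸ es} athere s x y (adjOf⁺ {e ∷ᴸ es} (distinct a b) (inj₁ (ahere refl))) adj-new a b (shorter U) (shorter W)
    go _ (yes (a , b)) = Cross.cross {es} {e ∷ᴸ es} athere s y x (adjOf⁺ {e ∷ᴸ es} (λ q → b (subst (_∈ U) q (∉W⇒∈U a))) (inj₂ (ahere refl))) (swap ∘ adj-new) a b (shorter U) (shorter W)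
    go (no na) (no nb) = inj₁ record
      { U = U ; W = W ; A⊆U = A⊆U ; B⊆W = B⊆W ; cover = cover ; small = small
      ; uncrossed = λ a u∉ → un (adj-new a) u∉ }
      where
      un : ∀ {u w} → Adj (graphOf es) u w ⊎ ((u ≡ x × w ≡ y) ⊎ (u ≡ y × w ≡ x)) → u ∉ W → w ∈ U
      un (inj₁ a) u∉ = uncrossed a u∉
      un {u} {w} (inj₂ c) u∉ with w ∈? U
      ... | yes w∈ = w∈
      un (inj₂ (inj₁ (refl , refl))) u∉ | no w∉ = ⊥-elim (na (u∉ , w∉))
      un (inj₂ (inj₂ (refl , refl))) u∉ | no w∉ = ⊥-elim (nb (u∉ , w∉))

  menger : Fin k → ∀ es → MengerFor es
  menger d es = menger-fuel d (length es) es ≤-refl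

-- Apex models and havens.

conn-map : ∀ {k E E'} {S : Fin k → Set} → (∀ {u v} → Adj (mkGraph k E) u v → Adj (mkGraph k E') u v) →
  ∀ {u v} → Conn (mkGraph k E) S u v → Conn (mkGraph k E') S u v
conn-map f (here s) = here s
conn-map {E = E} f (step s a p) = step s (f a) (conn-map {E = E} f p)

_[_↦_] : {A : Set} → (ℕ → A) → ℕ → A → ℕ → A
(f [ i ↦ x ]) j with j ≟ i
... | yes _ = x
... | no _ = f j

-- The branch sets of a tree on 0, ..., T - 1, in which par i is the parent of i ≥ 1, together with an apex branch set O.
record ApexModel (G : Graph) (T : ℕ) (par : ℕ → ℕ) : Set where
  open Connectivity G
  field
    M : ℕ → VS
    O : VS
    M-conn : ∀ i → i < T → Connected (M i)
    M-disj : ∀ i j → i < T → j < T → i ≢ j → M i # M j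
    M-touch : ∀ i → 1 ≤ i → i < T → Touch (M (par i)) (M i)
    O-conn : Connected O
    O-disj : ∀ i → i < T → O # M i
    O-touch : ∀ i → i < T → Touch O (M i)

module Haven (G : Graph) (Z : Subset (n G)) (T : ℕ) (par : ℕ → ℕ) (par< : ∀ i → 1 ≤ i → par i < i) where
  open Connectivity G

  Big : VS → Set
  Big D = ∣ Z ∣ < ∣ D ∩ Z ∣ + ∣ D ∩ Z ∣

  big-meet : ∀ {D E} → Big D → Big E → ∃[ x ] (x ∈ D × x ∈ E)
  big-meet {D} {E} bD bE with nonempty? (D ∩ E)
  ... | yes (x , m) = x , ∩⁻ m
  ... | no ne = ⊥-elim (<⇒≱ (+-mono-< bD bE) (≤-trans (≤-reflexive (+-interchange (∣ D ∩ Z ∣) (∣ D ∩ Z ∣) (∣ E ∩ Z ∣) (∣ E ∩ Z ∣))) (+-mono-≤ le le)))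
    where
    le : ∣ D ∩ Z ∣ + ∣ E ∩ Z ∣ ≤ ∣ Z ∣
    le = card-# (λ a b → ne (_ , ∩⁺ (proj₁ (∩⁻ a)) (proj₁ (∩⁻ b)))) (λ a → proj₂ (∩⁻ a)) (λ a → proj₂ (∩⁻ a))
    +-interchange : ∀ a b c d → (a + b) + (c + d) ≡ (a + c) + (b + d)
    +-interchange a b c d = begin
      (a + b) + (c + d) ≡⟨ +-assoc a b (c + d) ⟩
      a + (b + (c + d)) ≡⟨ cong (a +_) (trans (sym (+-assoc b c d)) (trans (cong (_+ d) (+-comm b c)) (+-assoc c b d))) ⟩
      a + (c + (b + d)) ≡⟨ sym (+-assoc a c (b + d)) ⟩
      (a + c) + (b + d) ∎
      where open ≡-Reasoning

  BigComp : VS → VS → Set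
  BigComp X E = Component (𝕍 ─ X) E × Big E

  bigcomp? : ∀ X E → Dec (BigComp X E)
  bigcomp? X E = component? (𝕍 ─ X) E ×-dec (∣ Z ∣ <? _)

  bigcomp-# : ∀ {X E} → BigComp X E → E # X
  bigcomp-# (c , _) x∈E = proj₂ (─⁻ _ _ (inside-region c x∈E))

  bigcomp-closed : ∀ {X E x y} → BigComp X E → x ∈ E → Adj G x y → y ∉ X → y ∈ E
  bigcomp-closed (c , _) x∈ a y∉ = closed c x∈ a (─⁺ ∈⊤ y∉)

  bigcomp-⊆ : ∀ {X Y D E} → BigComp X D → BigComp Y E → E # X → E ⊆ D
  bigcomp-⊆ D@(c , b) (c' , b') d with big-meet b b'
  ... | _ , x∈D , x∈E = absorb c (connected c') (λ e → ─⁺ ∈⊤ (d e)) x∈D x∈E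

  -- `linked` says that fewer than `i` vertices never cut `S` off from the haven, which is what
  -- Menger's theorem needs when `S` has to move. Each branch set meets `S` exactly in `s j`, and
  -- none meets `D`, which supplies the next vertex and finally the apex.
  record Stage (i : ℕ) : Set where
    field
      S D : VS
      s : ℕ → V
      S-card : ∣ S ∣ ≤ i
      s∈S : ∀ j → j < i → s j ∈ S
      s-onto : ∀ {x} → x ∈ S → ∃[ j ] (j < i × s j ≡ x)
      D-big : BigComp S D
      linked : ∀ X E → ∣ X ∣ < i → BigComp X E → Nonempty (E ∩ S)
      M : ℕ → VS
      s∈M : ∀ j → j < i → s j ∈ M j
      M-conn : ∀ j → j < i → Connected (M j)
      M-disj : ∀ j l → j < i → l < i → j ≢ l → M j # M l
      M-touch : ∀ j → 1 ≤ j → j < i → Touch (M (par j)) (M j)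
      M#D : ∀ j → j < i → M j # D

    s∈M⇒≡ : ∀ {j l} → j < i → l < i → s l ∈ M j → l ≡ j
    s∈M⇒≡ {j} {l} lj ll m with l ≟ j
    ... | yes e = e
    ... | no ne = ⊥-elim (M-disj l j ll lj ne (s∈M l ll) m)

    -- If `s p` had no neighbour in `D`, then `D` would remain a component when `s p` is taken out
    -- of `S`. Fewer than `i` vertices would then have a big component that misses `S`, against
    -- `linked`.
    exit : ∀ p → p < i → ∃[ t ] (t ∈ D × Adj G (s p) t)
    exit p l with any? (λ t → (t ∈? D) ×-dec adj? (s p) t)
    ... | yes r = r
    ... | no ne with linked (S ─ ⁅ s p ⁆) D (≤-trans (≤-reflexive (card-remove (s∈S p l))) S-card)
          (record { inside-region = λ m → ─⁺ ∈⊤ (λ m' → bigcomp-# D-big m (p─q⊆p _ _ m'))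
                  ; connected = connected (proj₁ D-big)
                  ; closed = λ {x} {y} x∈ a y∈ → bigcomp-closed D-big x∈ a (λ y∈S → proj₂ (─⁻ _ _ y∈)
                      (─⁺ y∈S (λ y∈s → ne (x , x∈ , adj-sym (subst (Adj G x) (x∈⁅y⁆⇒x≡y _ y∈s) a))))) }
          , proj₂ D-big)
    ...   | x , x∈ = ⊥-elim (bigcomp-# D-big (proj₁ (∩⁻ x∈)) (proj₂ (∩⁻ x∈)))

  module _ (haven : ∀ X → ∣ X ∣ ≤ T → ∃[ D ] (Connected D × D # X × Big D)) where

    big-component : ∀ X → ∣ X ∣ ≤ T → ∃[ K ] BigComp X K
    big-component X le with haven X le
    ... | D , cD@((x , x∈) , _) , d , b with component (𝕍 ─ X) (─⁺ ∈⊤ (d x∈))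
    ... | K , x∈K , c = K , c , ≤-trans b (+-mono-≤ D≤K D≤K)
      where
      D≤K : ∣ D ∩ Z ∣ ≤ ∣ K ∩ Z ∣
      D≤K = card-mono (λ m → ∩⁺ (absorb c cD (λ y → ─⁺ ∈⊤ (d y)) x∈K x∈ (proj₁ (∩⁻ m))) (proj₂ (∩⁻ m)))

    stage-0 : V → Stage 0
    stage-0 v with big-component ∅ (≤-trans (≤-reflexive (∣⊥∣≡0 (n G))) z≤n)
    ... | D , b = record
      { S = ∅ ; D = D ; s = λ _ → v ; S-card = ≤-reflexive (∣⊥∣≡0 (n G)) ; s∈S = λ _ ()
      ; s-onto = λ m → ⊥-elim (∉⊥ m) ; D-big = b ; linked = λ _ _ () ; M = λ _ → ∅
      ; s∈M = λ _ () ; M-conn = λ _ () ; M-disj = λ _ _ () ; M-touch = λ _ _ () ; M#D = λ _ () }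

    extend : ∀ {i} (st : Stage i) t → t ∈ Stage.D st → (1 ≤ i → Adj G (Stage.s st (par i)) t) → suc i ≤ T →
      (∀ X E → ∣ X ∣ < suc i → BigComp X E → Nonempty (E ∩ (Stage.S st ∪ ⁅ t ⁆))) → Stage (suc i)
    extend {i} st t t∈D adj le lk with big-component (Stage.S st ∪ ⁅ t ⁆) (≤-trans (card-add (Stage.S st) t) (≤-trans (s≤s (Stage.S-card st)) le))
    ... | D⁺ , b = record
      { S = S ∪ ⁅ t ⁆ ; D = D⁺ ; s = s' ; S-card = ≤-trans (card-add S t) (s≤s S-card)
      ; s∈S = s∈S' ; s-onto = s-onto' ; D-big = b ; linked = lk ; M = M'
      ; s∈M = s∈M' ; M-conn = M-conn' ; M-disj = M-disj' ; M-touch = M-touch' ; M#D = M#D' }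
      where
      open Stage st
      s' : ℕ → V
      s' = s [ i ↦ t ]
      M' : ℕ → VS
      M' = M [ i ↦ ⁅ t ⁆ ]
      old : ∀ {j} → j < suc i → j ≢ i → j < i
      old l ne = ≤∧≢⇒< (≤-pred l) ne
      D⁺⊆D : D⁺ ⊆ D
      D⁺⊆D = bigcomp-⊆ D-big b (λ x m → bigcomp-# b x (∪ˡ m))
      s∈S' : ∀ j → j < suc i → s' j ∈ S ∪ ⁅ t ⁆
      s∈S' j l with j ≟ i
      ... | yes _ = ∪ʳ (x∈⁅x⁆ t)
      ... | no ne = ∪ˡ (s∈S j (old l ne))
      s'-i : s' i ≡ t
      s'-i with i ≟ i
      ... | yes _ = refl
      ... | no ne = ⊥-elim (ne refl)
      s'-old : ∀ j → j < i → s' j ≡ s j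
      s'-old j l with j ≟ i
      ... | yes refl = ⊥-elim (<-irrefl refl l)
      ... | no _ = refl
      M'-old : ∀ j → j < i → M' j ≡ M j
      M'-old j l with j ≟ i
      ... | yes refl = ⊥-elim (<-irrefl refl l)
      ... | no _ = refl
      s-onto' : ∀ {x} → x ∈ S ∪ ⁅ t ⁆ → ∃[ j ] (j < suc i × s' j ≡ x)
      s-onto' m with ∪⁻ m
      ... | inj₂ x∈ = i , ≤-refl , trans s'-i (sym (x∈⁅y⁆⇒x≡y _ x∈))
      ... | inj₁ x∈ with s-onto x∈
      ...   | j , l , e = j , m<n⇒m<1+n l , trans (s'-old j l) e
      s∈M' : ∀ j → j < suc i → s' j ∈ M' j
      s∈M' j l with j ≟ i
      ... | yes _ = x∈⁅x⁆ t
      ... | no ne = s∈M j (old l ne)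
      M-conn' : ∀ j → j < suc i → Connected (M' j)
      M-conn' j l with j ≟ i
      ... | yes _ = connected-⁅⁆ t
      ... | no ne = M-conn j (old l ne)
      t-new : ∀ j → j < i → M j # ⁅ t ⁆
      t-new j l a b = M#D j l a (subst (_∈ D) (sym (x∈⁅y⁆⇒x≡y _ b)) t∈D)
      M-disj' : ∀ j l → j < suc i → l < suc i → j ≢ l → M' j # M' l
      M-disj' j l lj ll ne with j ≟ i | l ≟ i
      ... | yes refl | yes refl = ⊥-elim (ne refl)
      ... | yes _ | no b = #-sym (t-new l (old ll b))
      ... | no a | yes _ = t-new j (old lj a)
      ... | no a | no b = M-disj j l (old lj a) (old ll b) ne
      M-touch' : ∀ j → 1 ≤ j → j < suc i → Touch (M' (par j)) (M' j)
      M-touch' j l1 l with j ≟ i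
      ... | yes refl = subst (λ Y → Touch Y ⁅ t ⁆) (sym (M'-old (par j) (par< j l1))) (touch-⁅⁆ (s∈M _ (par< j l1)) (adj l1))
      ... | no ne = subst (λ Y → Touch Y (M j)) (sym (M'-old (par j) (<-trans (par< j l1) (old l ne)))) (M-touch j l1 (old l ne))
      M#D' : ∀ j → j < suc i → M' j # D⁺
      M#D' j l with j ≟ i
      ... | yes _ = λ a b' → bigcomp-# b b' (∪ʳ a)
      ... | no ne = λ a b' → M#D j (old l ne) a (D⁺⊆D b')

    -- Moving S along a linkage to a separator X of the same size that is closer to the haven.
    module Move {i : ℕ} (st : Stage i) (le : suc i ≤ T) (t : V) (t∈D : t ∈ Stage.D st) (X E : VS)
      (∣X∣≤i : ∣ X ∣ ≤ i) (E-big : BigComp X E) (E#S⁺ : E # Stage.S st ∪ ⁅ t ⁆) where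
      open Stage st

      E#S : E # S
      E#S x m = E#S⁺ x (∪ˡ m)

      E⊆D : E ⊆ D
      E⊆D = bigcomp-⊆ D-big E-big E#S

      E<D : ∣ E ∣ < ∣ D ∣
      E<D = card-< E⊆D t∈D (λ m → E#S⁺ m (∪ʳ (x∈⁅x⁆ t)))

      R : VS
      R = (D ∪ S) ─ E

      edge? : (p : V × V) → Dec (Adj G (proj₁ p) (proj₂ p) × (proj₁ p ∈ R × proj₂ p ∈ R))
      edge? (u , v) = adj? u v ×-dec ((u ∈? R) ×-dec (v ∈? R))

      es : List (V × V)
      es = filter edge? (cartesianProduct (allFin (n G)) (allFin (n G)))

      open Menger {n G}

      es⁺ : ∀ {u v} → Adj G u v → u ∈ R → v ∈ R → Adj (graphOf es) u v
      es⁺ {u} {v} a u∈ v∈ = adjOf⁺ (proj₁ a) (inj₁ (∈-filter⁺ edge? (∈-cartesianProduct⁺ (∈-allFin u) (∈-allFin v)) (a , u∈ , v∈)))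

      es⁻ : ∀ {u v} → Adj (graphOf es) u v → Adj G u v × v ∈ R
      es⁻ a with adjOf⁻ {es} a
      ... | inj₁ m = let (b , _ , v∈) = proj₂ (∈-filter⁻ edge? {xs = cartesianProduct (allFin (n G)) (allFin (n G))} m) in b , v∈
      ... | inj₂ m = let (b , v∈ , _) = proj₂ (∈-filter⁻ edge? {xs = cartesianProduct (allFin (n G)) (allFin (n G))} m) in adj-sym b , v∈

      near : ∀ {u u'} → u' ∈ D → Adj G u u' → u ∈ D ∪ S
      near {u} u'∈ a with u ∈? S
      ... | yes u∈ = ∪ʳ u∈
      ... | no u∉ = ∪ˡ (bigcomp-closed D-big u'∈ (adj-sym a) u∉)

      -- The big component `F` of `U ∩ W` meets both `S` and `E`. On a path in `F` from `S` to `E`,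
      -- the vertices in `D ∪ S` stay outside `W`: a step into `D` comes from `D ∪ S`, and `S` lies
      -- in `U`. But the last vertex before `E` lies in `X`, hence in `W`.
      unseparated : Separation es S X i → ⊥
      unseparated sep with big-component (U ∩ W) (≤-trans (<⇒≤ small) (<⇒≤ le))
        where open Separation sep
      ... | F , bF with linked (Separation.U sep ∩ Separation.W sep) F (Separation.small sep) bF | big-meet (proj₂ bF) (proj₂ E-big)
      ... | x , x∈ | e , e∈F , e∈E = go (proj₂ (connected (proj₁ bF)) (proj₁ (∩⁻ x∈)) e∈F)
              (λ m → E#S m (proj₂ (∩⁻ x∈))) (λ _ → S∉W (proj₁ (∩⁻ x∈)) (proj₂ (∩⁻ x∈))) e∈E
        where
        open Separation sep
        S∉W : ∀ {x} → x ∈ F → x ∈ S → x ∉ W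
        S∉W x∈F x∈S x∈W = bigcomp-# bF x∈F (∩⁺ (A⊆U x∈S) x∈W)
        go : ∀ {u e} → Path F u e → u ∉ E → (u ∈ D ∪ S → u ∉ W) → e ∉ E
        go (here _) u∉ _ = u∉
        go {u} (step {w = u'} _ a p) u∉E inv = go p u'∉E inv'
          where
          u'∉E : u' ∉ E
          u'∉E m = inv (near (E⊆D m) a) (B⊆W (case u ∈? X of λ
            { (yes x) → x ; (no x) → ⊥-elim (u∉E (bigcomp-closed E-big m (adj-sym a) x)) }))
          inv' : u' ∈ D ∪ S → u' ∉ W
          inv' m u'∈W with u' ∈? S | ∪⁻ m
          ... | yes s | _ = S∉W (conn-source p) s u'∈W
          ... | no s | inj₂ s' = s s'
          ... | no s | inj₁ d = bigcomp-# bF (conn-source p) (∩⁺ (uncrossed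
                  (es⁺ a (─⁺ (near d a) u∉E) (─⁺ m u'∉E)) (inv (near d a))) u'∈W)

      module Along (L : Linkage es S X i) where
        open Linkage L

        index : ∀ j → j < i → ∃[ l ] (l < i × start l ≡ s j)
        index j lj = injection⇒onto i start S S-card start∈A (representative-inj start start∈) (s∈S j lj)

        π : ℕ → ℕ
        π j with j <? i
        ... | yes l = proj₁ (index j l)
        ... | no _ = 0

        π-spec : ∀ j → j < i → π j < i × start (π j) ≡ s j
        π-spec j l with j <? i
        ... | yes l' = proj₂ (index j l')
        ... | no nl = ⊥-elim (nl l)

        Q M' : ℕ → VS
        Q j = part (π j)
        M' j = M j ∪ Q j

        s∈Q : ∀ j → j < i → s j ∈ Q j
        s∈Q j l with π-spec j l
        ... | lp , e = subst (_∈ part (π j)) e (start∈ _ lp)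

        Q-conn : ∀ j → j < i → Connected (Q j)
        Q-conn j l with part-conn (π j) (proj₁ (π-spec j l))
        ... | ne , c = ne , λ a b → conn-map {E = Graph.E (graphOf es)} {E' = Graph.E G} (λ e → proj₁ (es⁻ e)) (c a b)

        Q⊆R : ∀ j → j < i → Q j ⊆ R
        Q⊆R j l y∈ with part-conn (π j) (proj₁ (π-spec j l))
        ... | _ , c = go (c (s∈Q j l) y∈) (─⁺ (∪ʳ (s∈S j l)) (λ m → E#S m (s∈S j l)))
          where
          go : ∀ {x y} → Conn (graphOf es) (_∈ Q j) x y → x ∈ R → y ∈ R
          go (here _) r = r
          go (step _ a p) _ = go p (proj₂ (es⁻ a))

        s-inj : ∀ j l → j < i → l < i → s j ≡ s l → j ≡ l
        s-inj j l lj ll e = s∈M⇒≡ ll lj (subst (_∈ M l) (sym e) (s∈M l ll))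

        π-inj : ∀ j l → j < i → l < i → π j ≡ π l → j ≡ l
        π-inj j l lj ll e = s-inj j l lj ll (trans (sym (proj₂ (π-spec j lj))) (trans (cong start e) (proj₂ (π-spec l ll))))

        Q-disj : ∀ j l → j < i → l < i → j ≢ l → Q j # Q l
        Q-disj j l lj ll ne = part-disj _ _ (proj₁ (π-spec j lj)) (proj₁ (π-spec l ll)) (ne ∘ π-inj j l lj ll)

        -- `Q l` lies in `D ∪ S`. The branch set `M j` avoids `D`, and its only vertex in `S` is
        -- `s j`, which belongs to `Q j`.
        M#Q : ∀ j l → j < i → l < i → j ≢ l → M j # Q l
        M#Q j l lj ll ne z∈M z∈Q with ∪⁻ (proj₁ (─⁻ _ _ (Q⊆R l ll z∈Q)))
        ... | inj₁ z∈D = M#D j lj z∈M z∈D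
        ... | inj₂ z∈S with s-onto z∈S
        ...   | j' , lj' , refl with s∈M⇒≡ lj lj' z∈M
        ...     | refl = Q-disj j l lj ll ne (s∈Q j lj) z∈Q

        s' : ℕ → V
        s' j = end (π j)

        s'∈Q : ∀ j → j < i → s' j ∈ Q j
        s'∈Q j l = end∈ _ (proj₁ (π-spec j l))

        s'-inj : ∀ j l → j < i → l < i → s' j ≡ s' l → j ≡ l
        s'-inj j l lj ll e with j ≟ l
        ... | yes r = r
        ... | no ne = ⊥-elim (Q-disj j l lj ll ne (s'∈Q j lj) (subst (_∈ Q l) (sym e) (s'∈Q l ll)))

        moved : Stage i
        moved = record
          { S = X ; D = E ; s = s' ; S-card = ∣X∣≤i ; s∈S = s'∈X
          ; s-onto = injection⇒onto i s' X ∣X∣≤i s'∈X s'-inj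
          ; D-big = E-big ; linked = linked' ; M = M' ; s∈M = λ j l → ∪ʳ (s'∈Q j l)
          ; M-conn = λ j l → connected-∪-meet (M-conn j l) (Q-conn j l) (s∈M j l) (s∈Q j l)
          ; M-disj = M-disj'
          ; M-touch = λ j l1 l → touch-mono ∪ˡ ∪ˡ (M-touch j l1 l)
          ; M#D = λ j l m e → [ (λ a → M#D j l a (E⊆D e)) , (λ a → proj₂ (─⁻ _ _ (Q⊆R j l a)) e) ]′ (∪⁻ m) }
          where
          s'∈X : ∀ j → j < i → s' j ∈ X
          s'∈X j l = end∈B _ (proj₁ (π-spec j l))
          M-disj' : ∀ j l → j < i → l < i → j ≢ l → M' j # M' l
          M-disj' j l lj ll ne a b with ∪⁻ a | ∪⁻ b
          ... | inj₁ p | inj₁ q = M-disj j l lj ll ne p q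
          ... | inj₁ p | inj₂ q = M#Q j l lj ll ne p q
          ... | inj₂ p | inj₁ q = M#Q l j ll lj (ne ∘ sym) q p
          ... | inj₂ p | inj₂ q = Q-disj j l lj ll ne p q
          -- If `F` missed `X`, it would lie inside `E`, which avoids the old `S`; but `F` meets the
          -- old `S`.
          linked' : ∀ Y F → ∣ Y ∣ < i → BigComp Y F → Nonempty (F ∩ X)
          linked' Y F lt bF with nonempty? (F ∩ X)
          ... | yes ne = ne
          ... | no ne with linked Y F lt bF
          ...   | x , m = ⊥-elim (E#S (bigcomp-⊆ E-big bF (λ a b → ne (_ , ∩⁺ a b)) (proj₁ (∩⁻ m))) (proj₂ (∩⁻ m)))

      move : Σ (Stage i) λ st' → ∣ Stage.D st' ∣ < ∣ D ∣
      move with menger t es S X i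
      ... | inj₁ sep = ⊥-elim (unseparated sep)
      ... | inj₂ L = Along.moved L , E<D

    -- Adding `t` can fail only because some `X` of at most `i` vertices has a big component that
    -- avoids `S` and `t`; then `S` moves to `X`. The big component loses `t` in the move, so only
    -- finitely many moves precede an extension.
    next : ∀ {i} → suc i ≤ T → (st : Stage i) → Stage (suc i) ⊎ Σ (Stage i) λ st' → ∣ Stage.D st' ∣ < ∣ Stage.D st ∣
    next {i} le st = go (candidate i refl)
      where
      open Stage st
      candidate : ∀ j → j ≡ i → ∃[ t ] (t ∈ D × (1 ≤ i → Adj G (s (par i)) t))
      candidate zero refl with proj₁ (connected (proj₁ D-big))
      ... | t , t∈ = t , t∈ , λ ()
      candidate (suc j) refl with exit (par i) (par< i (s≤s z≤n))
      ... | t , t∈ , a = t , t∈ , λ _ → a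
      go : ∃[ t ] (t ∈ D × (1 ≤ i → Adj G (s (par i)) t)) → _
      go (t , t∈ , a) with anySubset? (λ X → anySubset? (λ E → (∣ X ∣ ≤? i) ×-dec (bigcomp? X E ×-dec (E #? (S ∪ ⁅ t ⁆)))))
      ... | yes (X , E , leX , b , d) = inj₂ (Move.move st le t t∈ X E leX b d)
      ... | no ne = inj₁ (extend st t t∈ a le (λ X E lt b → case nonempty? (E ∩ (S ∪ ⁅ t ⁆)) of λ
          { (yes y) → y ; (no y) → ⊥-elim (ne (X , E , ≤-pred lt , b , λ p q → y (_ , ∩⁺ p q))) }))

    advance : ∀ {i} → suc i ≤ T → ∀ m (st : Stage i) → ∣ Stage.D st ∣ ≤ m → Stage (suc i)
    advance le m st b with next le st
    ... | inj₁ st' = st'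
    advance le zero st b | inj₂ (st' , lt) = ⊥-elim (n≮0 (≤-trans lt b))
    advance le (suc m) st b | inj₂ (st' , lt) = advance le m st' (≤-pred (≤-trans lt b))

    stage : V → ∀ i → i ≤ T → Stage i
    stage v zero _ = stage-0 v
    stage v (suc i) le = advance le (n G) (stage v i (<⇒≤ le)) (∣p∣≤n (Stage.D (stage v i (<⇒≤ le))))

    haven⇒model : ApexModel G T par
    haven⇒model = record
      { M = M ; O = D ; M-conn = M-conn ; M-disj = M-disj ; M-touch = M-touch ; O-conn = connected (proj₁ D-big)
      ; O-disj = λ i l a b → M#D i l b a
      ; O-touch = λ i l → let (t , t∈ , a) = exit i l in t , s i , t∈ , s∈M i l , adj-sym a }
      where
      v : V
      v with haven ∅ (≤-trans (≤-reflexive (∣⊥∣≡0 (n G))) z≤n)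
      ... | _ , ((x , _) , _) , _ = x
      open Stage (stage v T ≤-refl)

-- Balanced separators.

-- The separator size `κ` does not depend on `s`: sets of any size are divided by `q` at constant
-- cost. This is what allows boundary sizes to be fixed after `κ`.
Balanced : Graph → ℕ → ℕ → Set
Balanced G κ q = ∀ Z s → ∣ Z ∣ ≤ q * s → ∃[ X ] (∣ X ∣ ≤ κ × (∀ D → Connectivity.Connected G D → D # X → ∣ D ∩ Z ∣ ≤ s))

-- Opaque: the value triples with every step, so that unfolding it is infeasible.
opaque
  separator-bound : ℕ → ℕ → ℕ
  separator-bound T zero = 0
  separator-bound T (suc j) = T + (separator-bound T j + (separator-bound T j + separator-bound T j))

  separator-bound-suc : ∀ T j → separator-bound T (suc j) ≡ T + (separator-bound T j + (separator-bound T j + separator-bound T j))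
  separator-bound-suc T j = refl

module Balance (G : Graph) (T : ℕ) (par : ℕ → ℕ) (par< : ∀ i → 1 ≤ i → par i < i) (free : ¬ ApexModel G T par) where
  open Connectivity G

  Halved : VS → Set
  Halved Z = ∃[ X ] (∣ X ∣ ≤ T × (∀ D → Connected D → D # X → ∣ D ∩ Z ∣ + ∣ D ∩ Z ∣ ≤ ∣ Z ∣))

  opaque
    halve : ∀ Z → Halved Z
    halve Z = go (anySubset? (λ X → (∣ X ∣ ≤? T) ×-dec ¬? (heavy? X)))
      where
      open Haven G Z T par par< using (Big; haven⇒model)
      heavy? : ∀ X → Dec (∃[ D ] (Connected D × D # X × Big D))
      heavy? X = anySubset? (λ D → connected? D ×-dec ((D #? X) ×-dec (∣ Z ∣ <? _)))
      go : Dec (∃[ X ] (∣ X ∣ ≤ T × ¬ (∃[ D ] (Connected D × D # X × Big D)))) → Halved Z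
      go (yes (X , le , light)) = X , le , λ D c d → ≮⇒≥ (λ b → light (D , c , d , b))
      go (no none) = ⊥-elim (free (haven⇒model (λ X le → case heavy? X of λ
        { (yes h) → h ; (no h) → ⊥-elim (none (X , le , h)) })))

  record Trisection (X Z : VS) : Set where
    field
      Z₁ Z₂ Z₃ : VS
      half₁ : ∣ Z₁ ∣ + ∣ Z₁ ∣ ≤ ∣ Z ∣
      half₂ : ∣ Z₂ ∣ + ∣ Z₂ ∣ ≤ ∣ Z ∣
      half₃ : ∣ Z₃ ∣ + ∣ Z₃ ∣ ≤ ∣ Z ∣
      sorted : ∀ D → Connected D → D # X → D ∩ Z ⊆ Z₁ ⊎ (D ∩ Z ⊆ Z₂ ⊎ D ∩ Z ⊆ Z₃)

  -- The three groups are a largest closed set with at most half of `Z`, one further component,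
  -- which tips the balance, and the rest, which then has less than half. Two groups would not do:
  -- three components with a third of `Z` each cannot be sorted into two halves.
  trisect : ∀ X Z → (∀ D → Connected D → D # X → ∣ D ∩ Z ∣ + ∣ D ∩ Z ∣ ≤ ∣ Z ∣) → Trisection X Z
  trisect X Z light = choose (largest Q? ∅ q∅)
    where
    Closed : VS → Set
    Closed U = ∀ x y → x ∈ U → Adj G x y → y ∉ X → y ∈ U
    Q : VS → Set
    Q U = Closed U × ∣ U ∩ Z ∣ + ∣ U ∩ Z ∣ ≤ ∣ Z ∣
    Q? : ∀ U → Dec (Q U)
    Q? U = all? (λ x → all? (λ y → (x ∈? U) →-dec (adj? x y →-dec (¬? (y ∈? X) →-dec (y ∈? U))))) ×-dec (_ ≤? ∣ Z ∣)
    empty-small : ∀ {m} → ∣ ∅ ∩ Z ∣ ≤ m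
    empty-small = ≤-trans (card-mono (λ m → proj₁ (∩⁻ m))) (≤-trans (≤-reflexive (∣⊥∣≡0 (n G))) z≤n)
    q∅ : Q ∅
    q∅ = (λ x y x∈ → ⊥-elim (∉⊥ x∈)) , ≤-trans (+-mono-≤ (empty-small {0}) (empty-small {0})) z≤n
    stays : ∀ {U} → Closed U → ∀ D → Connected D → D # X → ∀ {x} → x ∈ D → x ∈ U → D ⊆ U
    stays {U} cl D (_ , c) d x∈D x∈U y∈D = go (c x∈D y∈D) x∈U
      where
      go : ∀ {x y} → Path D x y → x ∈ U → y ∈ U
      go (here _) u = u
      go (step _ a p) u = go p (cl _ _ u a (d (conn-source p)))
    choose : ∃[ U ] (Q U × (∀ W → Q W → ∣ W ∣ ≤ ∣ U ∣)) → Trisection X Z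
    choose (U , (cl , half) , max) with any? (λ v → ¬? (v ∈? X) ×-dec ¬? (v ∈? U))
    ... | no none = record
      { Z₁ = U ∩ Z ; Z₂ = U ∩ Z ; Z₃ = U ∩ Z ; half₁ = half ; half₂ = half ; half₃ = half
      ; sorted = λ D c d → inj₁ (λ m → ∩⁺ (case _ ∈? U of λ { (yes u) → u ; (no u) → ⊥-elim (none (_ , d (proj₁ (∩⁻ m)) , u)) }) (proj₂ (∩⁻ m))) }
    ... | yes (v , v∉X , v∉U) with component (𝕍 ─ X) (─⁺ ∈⊤ v∉X)
    ... | K , v∈K , cK = record
      { Z₁ = U ∩ Z ; Z₂ = K ∩ Z ; Z₃ = Z ─ (U ∪ K) ; half₁ = half ; half₂ = light K (connected cK) K#X ; half₃ = rest
      ; sorted = sorted }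
      where
      K#X : K # X
      K#X m = proj₂ (─⁻ _ _ (inside-region cK m))
      clK : Closed K
      clK x y x∈ a y∉ = closed cK x∈ a (─⁺ ∈⊤ y∉)
      big : ∣ Z ∣ < ∣ (U ∪ K) ∩ Z ∣ + ∣ (U ∪ K) ∩ Z ∣
      big = ≰⇒> (λ le → <⇒≱ (card-< ∪ˡ (∪ʳ v∈K) v∉U)
        (max (U ∪ K) ((λ x y x∈ a y∉ → [ (λ u → ∪ˡ (cl x y u a y∉)) , (λ u → ∪ʳ (clK x y u a y∉)) ]′ (∪⁻ x∈)) , le)))
      rest : ∣ Z ─ (U ∪ K) ∣ + ∣ Z ─ (U ∪ K) ∣ ≤ ∣ Z ∣
      rest with ≤-total (∣ Z ─ (U ∪ K) ∣) (∣ (U ∪ K) ∩ Z ∣)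
      ... | inj₁ le = ≤-trans (+-monoʳ-≤ (∣ Z ─ (U ∪ K) ∣) le)
              (card-# (λ a b → proj₂ (─⁻ _ _ a) (proj₁ (∩⁻ b))) (p─q⊆p _ _) (λ m → proj₂ (∩⁻ m)))
      ... | inj₂ le = ⊥-elim (<⇒≱ big (≤-trans (+-monoˡ-≤ (∣ (U ∪ K) ∩ Z ∣) le)
              (card-# (λ a b → proj₂ (─⁻ _ _ a) (proj₁ (∩⁻ b))) (p─q⊆p _ _) (λ m → proj₂ (∩⁻ m)))))
      sorted : ∀ D → Connected D → D # X → D ∩ Z ⊆ U ∩ Z ⊎ (D ∩ Z ⊆ K ∩ Z ⊎ D ∩ Z ⊆ Z ─ (U ∪ K))
      sorted D c d with nonempty? (D ∩ U) | nonempty? (D ∩ K)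
      ... | yes (x , m) | _ = inj₁ (λ e → ∩⁺ (stays cl D c d (proj₁ (∩⁻ m)) (proj₂ (∩⁻ m)) (proj₁ (∩⁻ e))) (proj₂ (∩⁻ e)))
      ... | no _ | yes (x , m) = inj₂ (inj₁ (λ e → ∩⁺ (stays clK D c d (proj₁ (∩⁻ m)) (proj₂ (∩⁻ m)) (proj₁ (∩⁻ e))) (proj₂ (∩⁻ e))))
      ... | no nU | no nK = inj₂ (inj₂ (λ e → ─⁺ (proj₂ (∩⁻ e))
              (λ m → [ (λ u → nU (_ , ∩⁺ (proj₁ (∩⁻ e)) u)) , (λ u → nK (_ , ∩⁺ (proj₁ (∩⁻ e)) u)) ]′ (∪⁻ m))))

  double-cancel : ∀ a b c → a + a ≤ c → c ≤ b + b → a ≤ b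
  double-cancel a b c l l' = ≮⇒≥ (λ lt → <⇒≱ (+-mono-< lt lt) (≤-trans l l'))

  Cut : ℕ → ℕ → VS → Set
  Cut j s Z = ∃[ X ] (∣ X ∣ ≤ separator-bound T j × (∀ D → Connected D → D # X → ∣ D ∩ Z ∣ ≤ s))

  -- Each round halves at cost `T` and continues with three sets, so `j` rounds divide by `2 ^ j`.
  -- Recursing on groups of components rather than on single components keeps the number of
  -- subproblems bounded.
  balanced-power : ∀ j Z s → ∣ Z ∣ ≤ 2 ^ j * s → Cut j s Z
  balanced-power zero Z s le = ∅ , ≤-trans (≤-reflexive (∣⊥∣≡0 (n G))) z≤n , λ D _ _ →
    ≤-trans (card-mono (λ m → proj₂ (∩⁻ m))) (≤-trans le (≤-reflexive (*-identityˡ s)))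
  balanced-power (suc j) Z s le with halve Z
  ... | X , leX , light with trisect X Z light
  ... | tri = glue (balanced-power j Z₁ s (shrink Z₁ half₁)) (balanced-power j Z₂ s (shrink Z₂ half₂)) (balanced-power j Z₃ s (shrink Z₃ half₃))
    where
    open Trisection tri
    shrink : ∀ Y → ∣ Y ∣ + ∣ Y ∣ ≤ ∣ Z ∣ → ∣ Y ∣ ≤ 2 ^ j * s
    shrink Y h = double-cancel _ _ _ h (≤-trans le (≤-reflexive (trans (*-assoc 2 (2 ^ j) s) (cong (2 ^ j * s +_) (+-identityʳ _)))))
    glue : Cut j s Z₁ → Cut j s Z₂ → Cut j s Z₃ → Cut (suc j) s Z
    glue (X₁ , l₁ , f₁) (X₂ , l₂ , f₂) (X₃ , l₃ , f₃) = X ∪ (X₁ ∪ (X₂ ∪ X₃)) ,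
      ≤-trans (≤-trans (∣∪∣≤ X _) (+-mono-≤ leX (≤-trans (∣∪∣≤ X₁ _) (+-mono-≤ l₁ (≤-trans (∣∪∣≤ X₂ _) (+-mono-≤ l₂ l₃))))))
        (≤-reflexive (sym (separator-bound-suc T j))) , few
      where
      few : ∀ D → Connected D → D # X ∪ (X₁ ∪ (X₂ ∪ X₃)) → ∣ D ∩ Z ∣ ≤ s
      few D c d with sorted D c (λ a b → d a (∪ˡ b))
      ... | inj₁ f = ≤-trans (card-mono (λ m → ∩⁺ (proj₁ (∩⁻ m)) (f m))) (f₁ D c (λ a b → d a (∪ʳ (∪ˡ b))))
      ... | inj₂ (inj₁ f) = ≤-trans (card-mono (λ m → ∩⁺ (proj₁ (∩⁻ m)) (f m))) (f₂ D c (λ a b → d a (∪ʳ (∪ʳ (∪ˡ b)))))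
      ... | inj₂ (inj₂ f) = ≤-trans (card-mono (λ m → ∩⁺ (proj₁ (∩⁻ m)) (f m))) (f₃ D c (λ a b → d a (∪ʳ (∪ʳ (∪ʳ b)))))

  n≤2^n : ∀ q → q ≤ 2 ^ q
  n≤2^n zero = z≤n
  n≤2^n (suc q) = ≤-trans (+-mono-≤ (m^n>0 2 q) (n≤2^n q)) (+-monoʳ-≤ (2 ^ q) (≤-reflexive (sym (+-identityʳ _))))

  opaque
    balanced : ∀ q → Balanced G (separator-bound T q) q
    balanced q Z s le = balanced-power q Z s (≤-trans le (*-monoˡ-≤ s (n≤2^n q)))

-- Tripods, rich sets, and the minors they contain.

opaque
  -- The richness kept in a leg while `r` tree vertices are still to be placed: growing one branch
  -- set by `sprout T`, with a leg for every vertex of the tree, spends `T + 1` levels.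
  legHeight : ℕ → ℕ → ℕ
  legHeight T zero = 0
  legHeight T (suc r) = suc T + legHeight T r

  legHeight-suc : ∀ T r → legHeight T (suc r) ≡ suc T + legHeight T r
  legHeight-suc T r = refl

module Tripods (G : Graph) where
  open Connectivity G

  IsTripod : (VS → Set) → VS → VS → VS → VS → VS → Set
  IsTripod P D A E₁ E₂ E₃ = (A ⊆ D × E₁ ⊆ D × E₂ ⊆ D × E₃ ⊆ D) × Connected A × (P E₁ × P E₂ × P E₃) ×
    (A # E₁ × A # E₂ × A # E₃) × (E₁ # E₂ × E₁ # E₃ × E₂ # E₃) × (Touch A E₁ × Touch A E₂ × Touch A E₃)

  Tripod : (VS → Set) → VS → Set
  Tripod P D = ∃[ A ] ∃[ E₁ ] ∃[ E₂ ] ∃[ E₃ ] IsTripod P D A E₁ E₂ E₃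

  Leads : VS → V → VS → VS → VS → Set
  Leads D y X Y Z = ∃[ t ] (t ∈ X × Path (D ─ (Y ∪ Z)) y t)

  -- From y, the first visit to X₁ ∪ X₂ ∪ X₃ reaches one of the three sets without meeting the other two.
  opaque
    reach-one : ∀ {D y X₁ X₂ X₃} → Connected D → y ∈ D → Nonempty X₁ → X₁ ⊆ D → X₁ # X₂ → X₁ # X₃ → X₂ # X₃ →
      Leads D y X₁ X₂ X₃ ⊎ (Leads D y X₂ X₁ X₃ ⊎ Leads D y X₃ X₁ X₂)
    reach-one {D} {y} {X₁} {X₂} {X₃} (_ , c) y∈D (a , a∈) X₁⊆D d12 d13 d23 = go (y ∈? T₀)
      where
      T₀ : VS
      T₀ = X₁ ∪ (X₂ ∪ X₃)
      classify : ∀ {t} → t ∈ T₀ → (∀ Y → Y ⊆ T₀ → t ∉ Y → Path (D ─ Y) y t) →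
        Leads D y X₁ X₂ X₃ ⊎ (Leads D y X₂ X₁ X₃ ⊎ Leads D y X₃ X₁ X₂)
      classify t∈ p with ∪⁻ t∈
      ... | inj₁ t1 = inj₁ (_ , t1 , p (X₂ ∪ X₃) ∪ʳ (λ m → [ d12 t1 , d13 t1 ]′ (∪⁻ m)))
      ... | inj₂ r with ∪⁻ r
      ...   | inj₁ t2 = inj₂ (inj₁ (_ , t2 , p (X₁ ∪ X₃) (∪-lub ∪ˡ (λ m → ∪ʳ (∪ʳ m))) (λ m → [ (λ a → d12 a t2) , d23 t2 ]′ (∪⁻ m))))
      ...   | inj₂ t3 = inj₂ (inj₂ (_ , t3 , p (X₁ ∪ X₂) (∪-lub ∪ˡ (λ m → ∪ʳ (∪ˡ m))) (λ m → [ (λ a → d13 a t3) , (λ a → d23 a t3) ]′ (∪⁻ m))))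
      go : Dec (y ∈ T₀) → Leads D y X₁ X₂ X₃ ⊎ (Leads D y X₂ X₁ X₃ ⊎ Leads D y X₃ X₁ X₂)
      go (yes y∈) = classify y∈ (λ Y _ y∉ → here (─⁺ y∈D y∉))
      go (no y∉) with first-entry T₀ (c y∈D (X₁⊆D a∈)) y∉ (∪ˡ a∈)
      ... | z , t , q , t∈D , t∈ , e = classify t∈ (λ Y Y⊆ t∉ →
              conn-snoc (conn-mono (λ m → ─⁺ (proj₁ (─⁻ _ _ m)) (λ k → proj₂ (─⁻ _ _ m) (Y⊆ k))) q) e (─⁺ t∈D t∉))

  module Rich (u : V) where

    Rich : ℕ → VS → Set
    Rich zero D = Connected D × Touch D ⁅ u ⁆
    Rich (suc h) D = Connected D × Tripod (Rich h) D

    rich-conn : ∀ h {D} → Rich h D → Connected D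
    rich-conn zero = proj₁
    rich-conn (suc h) = proj₁

    tripod-mono : ∀ {P D D'} → D ⊆ D' → Tripod P D → Tripod P D'
    tripod-mono f (A , E₁ , E₂ , E₃ , (a , b , c , d) , rest) = A , E₁ , E₂ , E₃ , ((λ m → f (a m)) , (λ m → f (b m)) , (λ m → f (c m)) , (λ m → f (d m))) , rest

    rich-mono : ∀ h {D D'} → D ⊆ D' → Connected D' → Rich h D → Rich h D'
    rich-mono zero f c (_ , t) = c , touch-mono f id t
    rich-mono (suc h) f c (_ , t) = c , tripod-mono {Rich h} f t

    rich-down : ∀ h {D} → Rich (suc h) D → Rich h D
    rich-down h (c , A , E₁ , E₂ , E₃ , (_ , f , _) , _ , (r , _) , _) = rich-mono h f c r

    rich-drop : ∀ t h {D} → Rich (t + h) D → Rich h D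
    rich-drop zero h r = r
    rich-drop (suc t) h r = rich-drop t h (rich-down (t + h) r)

    rich-touch : ∀ h {D} → Rich h D → Touch D ⁅ u ⁆
    rich-touch zero (_ , t) = t
    rich-touch (suc h) r = rich-touch h (rich-down h r)

    opaque
      rich? : ∀ h D → Dec (Rich h D)
      rich? zero D = connected? D ×-dec touch? D ⁅ u ⁆
      rich? (suc h) D = connected? D ×-dec anySubset? (λ A → anySubset? (λ E₁ → anySubset? (λ E₂ → anySubset? (λ E₃ →
        ((A ⊆? D) ×-dec ((E₁ ⊆? D) ×-dec ((E₂ ⊆? D) ×-dec (E₃ ⊆? D)))) ×-dec (connected? A ×-dec
        ((rich? h E₁ ×-dec (rich? h E₂ ×-dec rich? h E₃)) ×-dec
        (((A #? E₁) ×-dec ((A #? E₂) ×-dec (A #? E₃))) ×-dec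
        (((E₁ #? E₂) ×-dec ((E₁ #? E₃) ×-dec (E₂ #? E₃))) ×-dec
        (touch? A E₁ ×-dec (touch? A E₂ ×-dec touch? A E₃))))))))))

    record Legs (h m : ℕ) (E : VS) (x : V) : Set where
      field
        hub : VS
        hub⊆ : hub ⊆ E
        hub-conn : Connected hub
        x∈hub : x ∈ hub
        leg : ℕ → VS
        leg⊆ : ∀ i → i < m → leg i ⊆ E
        leg-rich : ∀ i → i < m → Rich h (leg i)
        hub#leg : ∀ i → i < m → hub # leg i
        hub-touch : ∀ i → i < m → Touch hub (leg i)
        leg-disj : ∀ i j → i < m → j < m → i ≢ j → leg i # leg j

    -- The hub is the component of `E` without `Y` and `Z` around `x`. It runs into `X`, and through
    -- `X` it absorbs `A`, which touches `Y` and `Z`.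
    legs-through : ∀ h {E x A X Y Z} → A ⊆ E → Connected A → X ⊆ E → Rich h X → Leads E x X Y Z → Y ⊆ E → Z ⊆ E →
      Rich h Y → Rich h Z → A # Y → A # Z → X # Y → X # Z → Y # Z → Touch A X → Touch A Y → Touch A Z → Legs h 2 E x
    legs-through h {E} {x} {A} {X} {Y} {Z} A⊆ cA X⊆ rX (t , t∈X , p) Y⊆ Z⊆ rY rZ aY aZ xy xz yz tX tY tZ
      with component (E ─ (Y ∪ Z)) (conn-source p)
    ... | K , x∈K , cK = record
      { hub = K ; hub⊆ = λ m → proj₁ (─⁻ _ _ (inside-region cK m)) ; hub-conn = connected cK ; x∈hub = x∈K
      ; leg = λ { zero → Y ; (suc _) → Z }
      ; leg⊆ = λ { zero _ → Y⊆ ; (suc _) _ → Z⊆ }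
      ; leg-rich = λ { zero _ → rY ; (suc _) _ → rZ }
      ; hub#leg = λ { zero _ → λ a b → proj₂ (─⁻ _ _ (inside-region cK a)) (∪ˡ b) ; (suc _) _ → λ a b → proj₂ (─⁻ _ _ (inside-region cK a)) (∪ʳ b) }
      ; hub-touch = λ { zero _ → touch-mono A⊆K id tY ; (suc _) _ → touch-mono A⊆K id tZ }
      ; leg-disj = λ { zero zero _ _ ne → ⊥-elim (ne refl) ; zero (suc _) _ _ _ → yz ; (suc _) zero _ _ _ → #-sym yz
                     ; (suc zero) (suc zero) _ _ ne → ⊥-elim (ne refl) ; (suc (suc _)) _ (s≤s (s≤s ())) _ _ ; (suc zero) (suc (suc _)) _ (s≤s (s≤s ())) _ } }
      where
      X⊆K : X ⊆ K
      X⊆K = absorb cK (rich-conn h rX) (λ m → ─⁺ (X⊆ m) (λ k → [ xy m , xz m ]′ (∪⁻ k))) (component-path cK x∈K p) t∈X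
      A⊆K : A ⊆ K
      A⊆K = absorb-touch cK cA (λ m → ─⁺ (A⊆ m) (λ k → [ aY m , aZ m ]′ (∪⁻ k))) (touch-mono X⊆K id (touch-sym tX))

    -- This is why tripods have three legs: one is used up in joining the prescribed vertex `x`,
    -- wherever it lies, to the centre, and two remain.
    two-legs : ∀ h {E x} → Rich (suc h) E → x ∈ E → Legs h 2 E x
    two-legs h {E} {x} (cE , A , E₁ , E₂ , E₃ , (A⊆ , f₁ , f₂ , f₃) , cA , (r₁ , r₂ , r₃) , (a₁ , a₂ , a₃) , (d12 , d13 , d23) , (t₁ , t₂ , t₃)) x∈
      with reach-one cE x∈ (proj₁ (rich-conn h r₁)) f₁ d12 d13 d23
    ... | inj₁ l = legs-through h A⊆ cA f₁ r₁ l f₂ f₃ r₂ r₃ a₂ a₃ d12 d13 d23 t₁ t₂ t₃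
    ... | inj₂ (inj₁ l) = legs-through h A⊆ cA f₂ r₂ l f₁ f₃ r₁ r₃ a₁ a₃ (#-sym d12) d23 d13 t₂ t₁ t₃
    ... | inj₂ (inj₂ l) = legs-through h A⊆ cA f₃ r₃ l f₁ f₂ r₁ r₂ a₁ a₂ (#-sym d13) (#-sym d23) d12 t₃ t₁ t₂

    opaque
      -- Each level yields one more leg: leg 0 is kept, and leg 1 is opened at the vertex where the
      -- hub touches it, so that the hub found inside can be merged with the outer one.
      many-legs : ∀ t h {E x} → Rich (suc t + h) E → x ∈ E → Legs h (suc (suc t)) E x
      many-legs zero h r x∈ = two-legs h r x∈
      many-legs (suc t) h {E} {x} r x∈ with two-legs (suc t + h) r x∈
      ... | l = grow (L.hub-touch 1 (s≤s (s≤s z≤n)))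
        where
        module L = Legs l
        1<2 : 1 < 2
        1<2 = s≤s (s≤s z≤n)
        0<2 : 0 < 2
        0<2 = s≤s z≤n
        grow : Touch L.hub (L.leg 1) → Legs h (suc (suc (suc t))) E x
        grow (a , x' , a∈ , x'∈ , e) = record
          { hub = L.hub ∪ L'.hub ; hub⊆ = ∪-lub L.hub⊆ (λ m → L.leg⊆ 1 1<2 (L'.hub⊆ m))
          ; hub-conn = connected-∪-touch L.hub-conn L'.hub-conn (a , x' , a∈ , L'.x∈hub , e) ; x∈hub = ∪ˡ L.x∈hub
          ; leg = leg
          ; leg⊆ = λ { zero _ → L.leg⊆ 0 0<2 ; (suc i) (s≤s p) → λ m → L.leg⊆ 1 1<2 (L'.leg⊆ i p m) }
          ; leg-rich = λ { zero _ → rich-drop (suc t) h (L.leg-rich 0 0<2) ; (suc i) (s≤s p) → L'.leg-rich i p }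
          ; hub#leg = λ { zero _ → λ m k → [ (λ b → L.hub#leg 0 0<2 b k) , (λ b → L.leg-disj 1 0 1<2 0<2 (λ ()) (L'.hub⊆ b) k) ]′ (∪⁻ m)
                        ; (suc i) (s≤s p) → λ m k → [ (λ b → L.hub#leg 1 1<2 b (L'.leg⊆ i p k)) , (λ b → L'.hub#leg i p b k) ]′ (∪⁻ m) }
          ; hub-touch = λ { zero _ → touch-mono ∪ˡ id (L.hub-touch 0 0<2) ; (suc i) (s≤s p) → touch-mono ∪ʳ id (L'.hub-touch i p) }
          ; leg-disj = λ { zero zero _ _ ne → ⊥-elim (ne refl)
                         ; zero (suc j) _ (s≤s p) _ → λ m k → L.leg-disj 0 1 0<2 1<2 (λ ()) m (L'.leg⊆ j p k)
                         ; (suc i) zero (s≤s p) _ _ → λ m k → L.leg-disj 0 1 0<2 1<2 (λ ()) k (L'.leg⊆ i p m)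
                         ; (suc i) (suc j) (s≤s p) (s≤s q) ne → L'.leg-disj i j p q (λ e → ne (cong suc e)) } }
          where
          module L' = Legs (many-legs t h (L.leg-rich 1 1<2) x'∈)
          leg : ℕ → VS
          leg zero = L.leg 0
          leg (suc i) = L'.leg i

    -- One leg is merged into the hub, so that the hub touches u as well.
    opaque
      sprout : ∀ t h {E x} → Rich (suc t + h) E → x ∈ E → Σ (Legs h (suc t) E x) λ l → Touch (Legs.hub l) ⁅ u ⁆
      sprout t h {E} {x} r x∈ = record
        { hub = hub ∪ leg 0 ; hub⊆ = ∪-lub hub⊆ (leg⊆ 0 (s≤s z≤n))
        ; hub-conn = connected-∪-touch hub-conn (rich-conn h (leg-rich 0 (s≤s z≤n))) (hub-touch 0 (s≤s z≤n))
        ; x∈hub = ∪ˡ x∈hub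
        ; leg = λ i → leg (suc i)
        ; leg⊆ = λ i p → leg⊆ (suc i) (s≤s p)
        ; leg-rich = λ i p → leg-rich (suc i) (s≤s p)
        ; hub#leg = λ i p m k → [ (λ b → hub#leg (suc i) (s≤s p) b k) , (λ b → leg-disj 0 (suc i) (s≤s z≤n) (s≤s p) (λ ()) b k) ]′ (∪⁻ m)
        ; hub-touch = λ i p → touch-mono ∪ˡ id (hub-touch (suc i) (s≤s p))
        ; leg-disj = λ i j p q ne → leg-disj (suc i) (suc j) (s≤s p) (s≤s q) (λ e → ne (suc-injective e)) }
        , touch-mono ∪ʳ id (rich-touch h (leg-rich 0 (s≤s z≤n)))
        where open Legs (many-legs t h r x∈)

    module Embed (T : ℕ) (par : ℕ → ℕ) (par< : ∀ i → 1 ≤ i → par i < i) (D : VS) where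

      -- Leg l of the branch set of j is reserved for vertex l of the tree.
      record Partial (i : ℕ) : Set where
        field
          M : ℕ → VS
          L : ℕ → ℕ → VS
          M⊆ : ∀ j → j < i → M j ⊆ D
          M-conn : ∀ j → j < i → Connected (M j)
          M-disj : ∀ j k → j < i → k < i → j ≢ k → M j # M k
          M-par : ∀ j → 1 ≤ j → j < i → Touch (M (par j)) (M j)
          M-apex : ∀ j → j < i → Touch (M j) ⁅ u ⁆
          L⊆ : ∀ j l → j < i → i ≤ l → l < T → L j l ⊆ D
          L-rich : ∀ j l → j < i → i ≤ l → l < T → Rich (legHeight T (T ∸ i)) (L j l)
          L-touch : ∀ j l → j < i → i ≤ l → l < T → Touch (M j) (L j l)
          M#L : ∀ k j l → k < i → j < i → i ≤ l → l < T → M k # L j l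
          L-disj : ∀ j l j' l' → j < i → i ≤ l → l < T → j' < i → i ≤ l' → l' < T → j ≢ j' ⊎ l ≢ l' → L j l # L j' l'

      initial : 1 ≤ T → Rich (legHeight T T) D → Partial 1
      initial (s≤s {n = T'} _) r with proj₁ (rich-conn (legHeight T T) r)
      ... | x , x∈ with sprout T (legHeight T T') (subst (λ h → Rich h D) (legHeight-suc T T') r) x∈
      ... | l , t = record
        { M = λ _ → hub ; L = λ _ → leg ; M⊆ = λ _ _ → hub⊆ ; M-conn = λ _ _ → hub-conn
        ; M-disj = λ { zero zero _ _ ne → ⊥-elim (ne refl) ; (suc _) _ (s≤s ()) _ _ ; zero (suc _) _ (s≤s ()) _ }
        ; M-par = λ { (suc _) _ (s≤s ()) }
        ; M-apex = λ _ _ → t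
        ; L⊆ = λ _ l _ _ p → leg⊆ l (m<n⇒m<1+n p)
        ; L-rich = λ _ l _ _ p → leg-rich l (m<n⇒m<1+n p)
        ; L-touch = λ _ l _ _ p → hub-touch l (m<n⇒m<1+n p)
        ; M#L = λ _ _ l _ _ _ p → hub#leg l (m<n⇒m<1+n p)
        ; L-disj = λ { zero l zero l' _ _ p _ _ p' (inj₁ ne) → ⊥-elim (ne refl)
                     ; zero l zero l' _ _ p _ _ p' (inj₂ ne) → leg-disj l l' (m<n⇒m<1+n p) (m<n⇒m<1+n p') ne
                     ; (suc _) l _ l' (s≤s ()) _ _ _ _ _ _ ; zero l (suc _) l' _ _ _ (s≤s ()) _ _ _ } }
        where open Legs l

      -- The branch set of `i` grows inside the leg that its parent has reserved for `i`. Starting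
      -- `sprout` at the vertex where the parent touches this leg makes the two branch sets
      -- adjacent.
      grow : ∀ i → 1 ≤ i → i < T → Partial i → Partial (suc i)
      grow i i≥1 i<T st = place (L-touch p i p<i ≤-refl i<T)
        where
        open Partial st
        p = par i
        p<i = par< i i≥1
        Y₀ : VS
        Y₀ = L p i
        ht-eq : legHeight T (T ∸ i) ≡ suc T + legHeight T (T ∸ suc i)
        ht-eq = trans (cong (legHeight T) (+-∸-assoc 1 i<T)) (legHeight-suc T (T ∸ suc i))
        place : Touch (M p) Y₀ → Partial (suc i)
        place (a , x , a∈ , x∈ , e) with sprout T (legHeight T (T ∸ suc i)) (subst (λ h → Rich h Y₀) ht-eq (L-rich p i p<i ≤-refl i<T)) x∈
        ... | l , t = record
          { M = M' ; L = L' ; M⊆ = M⊆' ; M-conn = M-conn' ; M-disj = M-disj' ; M-par = M-par' ; M-apex = M-apex'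
          ; L⊆ = L⊆' ; L-rich = L-rich' ; L-touch = L-touch' ; M#L = M#L' ; L-disj = L-disj' }
          where
          module N = Legs l
          M' : ℕ → VS
          M' = M [ i ↦ N.hub ]
          L' : ℕ → ℕ → VS
          L' = L [ i ↦ N.leg ]
          E⊆D : Y₀ ⊆ D
          E⊆D = L⊆ p i p<i ≤-refl i<T
          old : ∀ {j} → j < suc i → j ≢ i → j < i
          old l ne = ≤∧≢⇒< (≤-pred l) ne
          up : ∀ {l} → l < T → l < suc T
          up = m<n⇒m<1+n
          M'-old : ∀ j → j < i → M' j ≡ M j
          M'-old j l with j ≟ i
          ... | yes refl = ⊥-elim (<-irrefl refl l)
          ... | no _ = refl
          M⊆' : ∀ j → j < suc i → M' j ⊆ D
          M⊆' j lj with j ≟ i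
          ... | yes _ = λ m → E⊆D (N.hub⊆ m)
          ... | no ne = M⊆ j (old lj ne)
          M-conn' : ∀ j → j < suc i → Connected (M' j)
          M-conn' j lj with j ≟ i
          ... | yes _ = N.hub-conn
          ... | no ne = M-conn j (old lj ne)
          M#E : ∀ j → j < i → M j # Y₀
          M#E j lj = M#L j p i lj p<i ≤-refl i<T
          M-disj' : ∀ j k → j < suc i → k < suc i → j ≢ k → M' j # M' k
          M-disj' j k lj lk ne with j ≟ i | k ≟ i
          ... | yes refl | yes refl = ⊥-elim (ne refl)
          ... | yes _ | no b = λ m m' → M#E k (old lk b) m' (N.hub⊆ m)
          ... | no a' | yes _ = λ m m' → M#E j (old lj a') m (N.hub⊆ m')
          ... | no a' | no b = M-disj j k (old lj a') (old lk b) ne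
          M-par' : ∀ j → 1 ≤ j → j < suc i → Touch (M' (par j)) (M' j)
          M-par' j j1 lj with j ≟ i
          ... | yes refl = subst (λ Y → Touch Y N.hub) (sym (M'-old p p<i)) (a , x , a∈ , N.x∈hub , e)
          ... | no ne = subst (λ Y → Touch Y (M j)) (sym (M'-old (par j) (<-trans (par< j j1) (old lj ne)))) (M-par j j1 (old lj ne))
          M-apex' : ∀ j → j < suc i → Touch (M' j) ⁅ u ⁆
          M-apex' j lj with j ≟ i
          ... | yes _ = t
          ... | no ne = M-apex j (old lj ne)
          L⊆' : ∀ j l → j < suc i → suc i ≤ l → l < T → L' j l ⊆ D
          L⊆' j l lj il lT with j ≟ i
          ... | yes _ = λ m → E⊆D (N.leg⊆ l (up lT) m)
          ... | no ne = L⊆ j l (old lj ne) (<⇒≤ il) lT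
          L-rich' : ∀ j l → j < suc i → suc i ≤ l → l < T → Rich (legHeight T (T ∸ suc i)) (L' j l)
          L-rich' j l lj il lT with j ≟ i
          ... | yes _ = N.leg-rich l (up lT)
          -- Older legs are richer than is required from now on; they forget `T + 1` levels so that
          -- all legs share one height.
          ... | no ne = rich-drop (suc T) _ (subst (λ h → Rich h (L j l)) ht-eq (L-rich j l (old lj ne) (<⇒≤ il) lT))
          L-touch' : ∀ j l → j < suc i → suc i ≤ l → l < T → Touch (M' j) (L' j l)
          L-touch' j l lj il lT with j ≟ i
          ... | yes _ = N.hub-touch l (up lT)
          ... | no ne = L-touch j l (old lj ne) (<⇒≤ il) lT
          M#L' : ∀ k j l → k < suc i → j < suc i → suc i ≤ l → l < T → M' k # L' j l
          M#L' k j l lk lj il lT with k ≟ i | j ≟ i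
          ... | yes _ | yes _ = N.hub#leg l (up lT)
          ... | yes _ | no b = λ m m' → L-disj j l p i (old lj b) (<⇒≤ il) lT p<i ≤-refl i<T (inj₂ (λ e → <⇒≢ il (sym e))) m' (N.hub⊆ m)
          ... | no a' | yes _ = λ m m' → M#E k (old lk a') m (N.leg⊆ l (up lT) m')
          ... | no a' | no b = M#L k j l (old lk a') (old lj b) (<⇒≤ il) lT
          new#old : ∀ j l l' → j < i → suc i ≤ l → l < T → l' < T → L j l # N.leg l'
          new#old j l l' lj il lT lT' m m' = L-disj j l p i lj (<⇒≤ il) lT p<i ≤-refl i<T (inj₂ (λ e → <⇒≢ il (sym e))) m (N.leg⊆ l' (up lT') m')
          L-disj' : ∀ j l j' l' → j < suc i → suc i ≤ l → l < T → j' < suc i → suc i ≤ l' → l' < T → j ≢ j' ⊎ l ≢ l' → L' j l # L' j' l'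
          L-disj' j l j' l' lj il lT lj' il' lT' ne with j ≟ i | j' ≟ i
          ... | yes refl | yes refl = [ (λ q → ⊥-elim (q refl)) , (λ q → N.leg-disj l l' (up lT) (up lT') q) ]′ ne
          ... | yes _ | no b = #-sym (new#old j' l' l (old lj' b) il' lT' lT)
          ... | no a' | yes _ = new#old j l l' (old lj a') il lT lT'
          ... | no a' | no b = L-disj j l j' l' (old lj a') (<⇒≤ il) lT (old lj' b) (<⇒≤ il') lT' ne

      partial : 1 ≤ T → Rich (legHeight T T) D → ∀ i → 1 ≤ i → i ≤ T → Partial i
      partial T≥1 r (suc zero) _ le = initial T≥1 r
      partial T≥1 r (suc (suc i)) _ le = grow (suc i) (s≤s z≤n) le (partial T≥1 r (suc i) (s≤s z≤n) (<⇒≤ le))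

      rich⇒model : 1 ≤ T → u ∉ D → Rich (legHeight T T) D → ApexModel G T par
      rich⇒model T≥1 u∉ r = record
        { M = M ; O = ⁅ u ⁆ ; M-conn = M-conn ; M-disj = M-disj ; M-touch = M-par ; O-conn = connected-⁅⁆ u
        ; O-disj = λ i l a b → u∉ (subst (_∈ D) (x∈⁅y⁆⇒x≡y _ a) (M⊆ i l b))
        ; O-touch = λ i l → touch-sym (M-apex i l) }
        where open Partial (partial T≥1 r T T≥1 ≤-refl)

-- Forests as orders with at most one lower neighbour.

module Forests (G : Graph) where
  open Connectivity G

  -- Position 0 is left free for an additional root, which joins the trees of the forest.
  record Order (U : VS) : Set where
    field
      pos : V → ℕ
      pos≥1 : ∀ {u} → u ∈ U → 1 ≤ pos u
      pos≤ : ∀ {u} → u ∈ U → pos u ≤ ∣ U ∣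
      pos-inj : ∀ {u w} → u ∈ U → w ∈ U → pos u ≡ pos w → u ≡ w
      lower-unique : ∀ {w x y} → w ∈ U → x ∈ U → y ∈ U → Adj G w x → Adj G w y → pos x < pos w → pos y < pos w → x ≡ y

  Branching : VS → V → Set
  Branching U x = ∃[ y ] ∃[ z ] (y ≢ z × (y ∈ U × Adj G x y) × (z ∈ U × Adj G x z))

  branching? : ∀ U x → Dec (Branching U x)
  branching? U x = any? (λ y → any? (λ z → ¬? (y ≟F z) ×-dec (((y ∈? U) ×-dec adj? x y) ×-dec ((z ∈? U) ×-dec adj? x z))))

  record SimplePath (U : VS) (m : ℕ) : Set where
    field
      c : ℕ → V
      c∈ : ∀ i → i ≤ suc m → c i ∈ U
      c-inj : ∀ i j → i < suc (suc m) → j < suc (suc m) → c i ≡ c j → i ≡ j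
      c-adj : ∀ i → i < suc m → Adj G (c i) (c (suc i))

  close-cycle : ∀ {U m} (p : SimplePath U m) → let open SimplePath p in ∀ j → j ≤ suc m → Adj G (c j) (c 0) → c j ≢ c 1 → CycleIn G (_∈ U)
  close-cycle p zero _ a _ = ⊥-elim (proj₁ a refl)
  close-cycle p (suc zero) _ _ ne = ⊥-elim (ne refl)
  close-cycle p (suc (suc k)) le a ne = record
    { k = k
    ; c = λ i → c (toℕ i)
    ; inj = λ {x} {y} e → toℕ-injective (c-inj _ _ (bound x) (bound y) e)
    ; inS = λ i → c∈ _ (≤-pred (bound i))
    ; steps = λ i → subst (λ z → Adj G (c z) (c (suc (toℕ i)))) (sym (toℕ-inject₁ i)) (c-adj _ (≤-trans (toℕ<n i) le))
    ; close = subst (λ z → Adj G (c z) (c 0)) (sym (toℕ-fromℕ (suc (suc k)))) a }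
    where
    open SimplePath p
    bound : ∀ (x : Fin (suc (suc (suc k)))) → toℕ x < _
    bound x = ≤-trans (toℕ<n x) (s≤s le)

  lengthen : ∀ {U m} (p : SimplePath U m) → let open SimplePath p in ∀ y → y ∈ U → Adj G (c 0) y → (∀ j → j ≤ suc m → c j ≢ y) → SimplePath U (suc m)
  lengthen {U} {m} p y y∈ a new = record { c = c' ; c∈ = c'∈ ; c-inj = c'-inj ; c-adj = c'-adj }
    where
    open SimplePath p
    c' : ℕ → V
    c' zero = y
    c' (suc i) = c i
    c'∈ : ∀ i → i ≤ suc (suc m) → c' i ∈ U
    c'∈ zero _ = y∈
    c'∈ (suc i) (s≤s l) = c∈ i l
    c'-inj : ∀ i j → i < suc (suc (suc m)) → j < suc (suc (suc m)) → c' i ≡ c' j → i ≡ j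
    c'-inj zero zero _ _ _ = refl
    c'-inj zero (suc j) _ (s≤s l) e = ⊥-elim (new j (≤-pred l) (sym e))
    c'-inj (suc i) zero (s≤s l) _ e = ⊥-elim (new i (≤-pred l) e)
    c'-inj (suc i) (suc j) (s≤s l) (s≤s l') e = cong suc (c-inj i j l l' e)
    c'-adj : ∀ i → i < suc (suc m) → Adj G (c' i) (c' (suc i))
    c'-adj zero _ = adj-sym a
    c'-adj (suc i) (s≤s l) = c-adj i l

  -- The front `c 0` of a path has a neighbour other than `c 1`. Either it lies on the path and
  -- closes a cycle, or it prolongs the path, which the size of `U` permits only finitely often.
  branching⇒cycle : ∀ {U} → (∀ x → x ∈ U → Branching U x) → Nonempty U → CycleIn G (_∈ U)
  branching⇒cycle {U} br (x , x∈) = start (br x x∈)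
    where
    go : ∀ d m → SimplePath U m → ∣ U ∣ ≤ d + suc m → CycleIn G (_∈ U)
    go d m p le with br _ (SimplePath.c∈ p 0 z≤n)
    ... | y , z , y≢z , (y∈ , ay) , (z∈ , az) = case y ≟F c 1 of λ
        { (no ne) → step-to y y∈ ay ne
        ; (yes e) → step-to z z∈ az (λ e' → y≢z (trans e (sym e'))) }
      where
      open SimplePath p
      step-to : ∀ w → w ∈ U → Adj G (c 0) w → w ≢ c 1 → CycleIn G (_∈ U)
      step-to w w∈ aw ne with any? {n = suc (suc m)} (λ j → c (toℕ j) ≟F w)
      ... | yes (j , refl) = close-cycle p (toℕ j) (≤-pred (toℕ<n j)) (adj-sym aw) ne
      ... | no none = again d le
        where
        fresh : ∀ j → j ≤ suc m → c j ≢ w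
        fresh j l e = none (fromℕ< (s≤s l) , trans (cong c (toℕ-fromℕ< (s≤s l))) e)
        again : ∀ d → ∣ U ∣ ≤ d + suc m → CycleIn G (_∈ U)
        again zero le = ⊥-elim (<⇒≱ (injection⇒≤ (suc (suc m)) c U (λ i l → c∈ i (≤-pred l)) c-inj) le)
        again (suc d) le = go d (suc m) (lengthen p w w∈ aw fresh) (≤-trans le (≤-reflexive (sym (+-suc d (suc m)))))
    start : Branching U x → CycleIn G (_∈ U)
    start (y , _ , _ , (y∈ , a) , _) = go ∣ U ∣ 0 (record
      { c = c ; c∈ = λ { zero _ → y∈ ; (suc _) _ → x∈ } ; c-inj = c-inj ; c-adj = λ { zero _ → adj-sym a ; (suc _) (s≤s ()) } }) (m≤m+n _ _)
      where
      c : ℕ → V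
      c zero = y
      c (suc _) = x
      c-inj : ∀ i j → i < 2 → j < 2 → c i ≡ c j → i ≡ j
      c-inj zero zero _ _ _ = refl
      c-inj zero (suc _) _ _ e = ⊥-elim (proj₁ a (sym e))
      c-inj (suc _) zero _ _ e = ⊥-elim (proj₁ a e)
      c-inj (suc zero) (suc zero) _ _ _ = refl
      c-inj (suc (suc _)) _ (s≤s (s≤s ())) _ _
      c-inj (suc zero) (suc (suc _)) _ (s≤s (s≤s ())) _

  cycle-mono : ∀ {S S' : VSet G} → (∀ {x} → S x → S' x) → CycleIn G S → CycleIn G S'
  cycle-mono f C = record { k = k ; c = c ; inj = inj ; inS = λ i → f (inS i) ; steps = steps ; close = close }
    where open CycleIn C

  opaque
    -- By `branching⇒cycle` a nonempty forest has a vertex with at most one neighbour. It is placed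
    -- last, at position `∣ U ∣`, above that neighbour.
    forest⇒order : ∀ m U → ∣ U ∣ ≤ m → ForestOn G (_∈ U) → Order U
    forest⇒order m U le forest with any? (λ x → (x ∈? U) ×-dec ¬? (branching? U x))
    ... | no none = record { pos = λ _ → 0 ; pos≥1 = void ; pos≤ = void ; pos-inj = λ a → void a ; lower-unique = λ a → void a }
      where
      void : ∀ {u} {P : Set} → u ∈ U → P
      void {u} u∈ = ⊥-elim (forest (branching⇒cycle (λ x x∈ → case branching? U x of λ { (yes b) → b ; (no b) → ⊥-elim (none (x , x∈ , b)) }) (u , u∈)))
    forest⇒order zero U le forest | yes (x , x∈ , _) = ⊥-elim (<⇒≱ (card>0 x∈) le)
    forest⇒order (suc m) U le forest | yes (x , x∈ , leaf) = record
      { pos = pos' ; pos≥1 = pos'≥1 ; pos≤ = pos'≤ ; pos-inj = pos'-inj ; lower-unique = unique' }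
      where
      U' : VS
      U' = U ─ ⁅ x ⁆
      open Order (forest⇒order m U' (≤-pred (≤-trans (≤-reflexive (card-remove x∈)) le)) (λ C → forest (cycle-mono (p─q⊆p _ _) C)))
      ∈U' : ∀ {v} → v ∈ U → v ≢ x → v ∈ U'
      ∈U' v∈ ne = ─⁺ v∈ (λ m → ne (x∈⁅y⁆⇒x≡y _ m))
      pos' : V → ℕ
      pos' v with v ≟F x
      ... | yes _ = ∣ U ∣
      ... | no _ = pos v
      below : ∀ {v} → v ∈ U → v ≢ x → pos v < ∣ U ∣
      below v∈ ne = ≤-trans (s≤s (pos≤ (∈U' v∈ ne))) (≤-reflexive (card-remove x∈))
      pos'≥1 : ∀ {u} → u ∈ U → 1 ≤ pos' u
      pos'≥1 {u} u∈ with u ≟F x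
      ... | yes _ = card>0 x∈
      ... | no ne = pos≥1 (∈U' u∈ ne)
      pos'≤ : ∀ {u} → u ∈ U → pos' u ≤ ∣ U ∣
      pos'≤ {u} u∈ with u ≟F x
      ... | yes _ = ≤-refl
      ... | no ne = <⇒≤ (below u∈ ne)
      pos'-inj : ∀ {u w} → u ∈ U → w ∈ U → pos' u ≡ pos' w → u ≡ w
      pos'-inj {u} {w} u∈ w∈ e with u ≟F x | w ≟F x
      ... | yes a | yes b = trans a (sym b)
      ... | yes _ | no b = ⊥-elim (<⇒≢ (below w∈ b) (sym e))
      ... | no a | yes _ = ⊥-elim (<⇒≢ (below u∈ a) e)
      ... | no a | no b = pos-inj (∈U' u∈ a) (∈U' w∈ b) e
      unique' : ∀ {w y z} → w ∈ U → y ∈ U → z ∈ U → Adj G w y → Adj G w z → pos' y < pos' w → pos' z < pos' w → y ≡ z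
      unique' {w} {y} {z} w∈ y∈ z∈ ay az ly lz with w ≟F x
      ... | yes refl = case y ≟F z of λ { (yes e) → e ; (no ne) → ⊥-elim (leaf (y , z , ne , (y∈ , ay) , (z∈ , az))) }
      ... | no w≢x with y ≟F x | z ≟F x
      ...   | yes _ | _ = ⊥-elim (<-asym ly (below w∈ w≢x))
      ...   | no _ | yes _ = ⊥-elim (<-asym lz (below w∈ w≢x))
      ...   | no y≢x | no z≢x = lower-unique (∈U' w∈ w≢x) (∈U' y∈ y≢x) (∈U' z∈ z≢x) ay az ly lz

  argmax : ∀ {k} (f : Fin (suc k) → ℕ) → ∃[ i ] (∀ j → f j ≤ f i)
  argmax {zero} f = fz , λ { fz → ≤-refl }
  argmax {suc k} f with argmax (λ i → f (fs i))
  ... | i , m with ≤-total (f fz) (f (fs i))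
  ...   | inj₁ le = fs i , λ { fz → le ; (fs j) → m j }
  ...   | inj₂ le = fz , λ { fz → ≤-refl ; (fs j) → ≤-trans (m j) le }

  last-or-inject : ∀ {k} (i : Fin (suc k)) → i ≡ fromℕ k ⊎ ∃[ j ] (i ≡ inject₁ j)
  last-or-inject {zero} fz = inj₁ refl
  last-or-inject {suc k} fz = inj₂ (fz , refl)
  last-or-inject {suc k} (fs i) with last-or-inject i
  ... | inj₁ e = inj₁ (cong fs e)
  ... | inj₂ (j , e) = inj₂ (fs j , cong fs e)

  cycle-neighbours : ∀ {S} (C : CycleIn G S) → let open CycleIn C in ∀ i → ∃[ j ] ∃[ j' ] (j ≢ j' × Adj G (c i) (c j) × Adj G (c i) (c j'))
  cycle-neighbours C fz = fs fz , fromℕ (suc (suc k)) , (λ ()) , steps fz , adj-sym close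
    where open CycleIn C
  cycle-neighbours C (fs i) with last-or-inject (fs i)
  ... | inj₁ refl = inject₁ i , fz , (λ ()) , adj-sym (steps i) , close
    where open CycleIn C
  ... | inj₂ (j , e) = inject₁ i , fs j , apart , adj-sym (steps i) , subst (λ z → Adj G (c z) (c (fs j))) (sym e) (steps j)
    where
    open CycleIn C
    apart : inject₁ i ≢ fs j
    apart q = <⇒≢ (≤-trans (n<1+n (toℕ i)) (≤-trans (≤-reflexive (trans (cong toℕ e) (toℕ-inject₁ j))) (n≤1+n _)))
      (trans (sym (toℕ-inject₁ i)) (cong toℕ q))

  -- The vertex of largest rank on a cycle would have two distinct lower neighbours, namely those on
  -- the cycle.
  lower-unique⇒forest : (S : VSet G) (r : V → ℕ) → (∀ {x y} → S x → S y → Adj G x y → r x ≢ r y) →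
    (∀ {w x y} → S w → S x → S y → Adj G w x → Adj G w y → r x < r w → r y < r w → x ≡ y) → ForestOn G S
  lower-unique⇒forest S r distinct unique C with argmax (λ i → r (CycleIn.c C i))
  ... | i , max with cycle-neighbours C i
  ... | j , j' , ne , a , a' = ne (inj (unique (inS i) (inS j) (inS j') a a'
      (≤∧≢⇒< (max j) (λ e → distinct (inS i) (inS j) a (sym e))) (≤∧≢⇒< (max j') (λ e → distinct (inS i) (inS j') a' (sym e)))))
    where open CycleIn C

-- Apex-forests as minors of apex models.

module ApexForest (H : Graph) (a : Fin (n H)) (forest : ForestOn H (_≢ a)) where
  open Connectivity H
  open Forests H

  U : VS
  U = 𝕍 ─ ⁅ a ⁆

  ∈U : ∀ {x} → x ≢ a → x ∈ U
  ∈U ne = ─⁺ ∈⊤ (λ m → ne (x∈⁅y⁆⇒x≡y _ m))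

  open Order (forest⇒order ∣ U ∣ U ≤-refl (λ C → forest (cycle-mono (λ m e → proj₂ (─⁻ _ _ m) (subst (_∈ ⁅ a ⁆) (sym e) (x∈⁅x⁆ a))) C)))

  T : ℕ
  T = suc ∣ U ∣

  parent? : ∀ i → Dec (∃[ u ] ∃[ w ] ((u ∈ U × w ∈ U) × Adj H w u × (pos w ≡ i × pos u < i)))
  parent? i = any? (λ u → any? (λ w → ((u ∈? U) ×-dec (w ∈? U)) ×-dec (adj? w u ×-dec ((pos w ≟ i) ×-dec (pos u <? i)))))

  -- A vertex without lower neighbour becomes a child of position 0, which turns the forest into a
  -- single tree. The added edges do no harm, since a minor model of `H` has to realise only the
  -- edges of `H`.
  par : ℕ → ℕ
  par i with parent? i
  ... | yes (u , _) = pos u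
  ... | no _ = 0

  par< : ∀ i → 1 ≤ i → par i < i
  par< i l with parent? i
  ... | yes (u , w , _ , _ , _ , lt) = lt
  ... | no _ = l

  par-edge : ∀ {u w} → u ∈ U → w ∈ U → Adj H w u → pos u < pos w → par (pos w) ≡ pos u
  par-edge {u} {w} u∈ w∈ e lt with parent? (pos w)
  ... | no none = ⊥-elim (none (u , w , (u∈ , w∈) , e , refl , lt))
  ... | yes (u' , w' , (u'∈ , w'∈) , e' , q , lt') with pos-inj w'∈ w∈ q
  ...   | refl = cong pos (lower-unique w∈ u'∈ u∈ e' e lt' lt)

  model⇒minor : ∀ {G} → ApexModel G T par → IsMinor H G
  model⇒minor {G} m = record { φ = φ ; nonempty = nonempty ; disjoint = λ x y ne v → disjoint x y ne ; connected = λ x u v → proj₂ (φ-conn x) ; edges = edges }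
    where
    open ApexModel m
    module G = Connectivity G
    pos<T : ∀ {x} → x ≢ a → pos x < T
    pos<T ne = s≤s (pos≤ (∈U ne))
    φ : V → Subset (n G)
    φ x with x ≟F a
    ... | yes _ = O
    ... | no _ = M (pos x)
    φ-conn : ∀ x → G.Connected (φ x)
    φ-conn x with x ≟F a
    ... | yes _ = O-conn
    ... | no ne = M-conn _ (pos<T ne)
    nonempty : ∀ x → ∃[ v ] (v ∈ φ x)
    nonempty x = proj₁ (φ-conn x)
    disjoint : ∀ x y → x ≢ y → φ x # φ y
    disjoint x y ne with x ≟F a | y ≟F a
    ... | yes p | yes q = ⊥-elim (ne (trans p (sym q)))
    ... | yes _ | no q = O-disj _ (pos<T q)
    ... | no p | yes _ = #-sym (O-disj _ (pos<T p))
    ... | no p | no q = M-disj _ _ (pos<T p) (pos<T q) (λ e → ne (pos-inj (∈U p) (∈U q) e))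
    child : ∀ {x y} → x ≢ a → y ≢ a → Adj H y x → pos x < pos y → G.Touch (M (pos x)) (M (pos y))
    child {x} {y} p q e lt = subst (λ i → G.Touch (M i) (M (pos y))) (par-edge (∈U p) (∈U q) e lt) (M-touch (pos y) (pos≥1 (∈U q)) (pos<T q))
    touch : ∀ x y → Adj H x y → G.Touch (φ x) (φ y)
    touch x y e with x ≟F a | y ≟F a
    ... | yes p | yes q = ⊥-elim (proj₁ e (trans p (sym q)))
    ... | yes _ | no q = O-touch _ (pos<T q)
    ... | no p | yes _ = G.touch-sym (O-touch _ (pos<T p))
    ... | no p | no q with <-cmp (pos x) (pos y)
    ...   | tri< lt _ _ = child p q (adj-sym e) lt
    ...   | tri≈ _ eq _ = ⊥-elim (proj₁ e (pos-inj (∈U p) (∈U q) eq))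
    ...   | tri> _ _ gt = G.touch-sym (child q p e gt)
    edges : ∀ x y → Adj H x y → ∃[ u ] ∃[ v ] (u ∈ φ x × v ∈ φ y × Adj G u v)
    edges x y e with touch x y e
    ... | u , v , u∈ , v∈ , uv = u , v , u∈ , v∈ , uv

-- Sweeping the rich sets of a component.

module Pieces (G : Graph) where
  open Connectivity G

  connected-∪-neighbours : ∀ {A B} → Connected A → (∀ {b} → b ∈ B → ∃[ a ] (a ∈ A × Adj G a b)) → Connected (A ∪ B)
  connected-∪-neighbours {A} {B} ((x , x∈) , c) nb = connected-from (∪ˡ x∈) from
    where
    from : ∀ {y} → y ∈ A ∪ B → Path (A ∪ B) x y
    from m with ∪⁻ m
    ... | inj₁ y∈ = conn-mono ∪ˡ (c x∈ y∈)
    ... | inj₂ y∈ with nb y∈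
    ...   | a , a∈ , e = conn-snoc (conn-mono ∪ˡ (c x∈ a∈)) e (∪ʳ y∈)

  Cut : ℕ → ℕ → VS → VS → Set
  Cut κ s Z X = ∣ X ∣ ≤ κ × (∀ D → Connected D → D # X → ∣ D ∩ Z ∣ ≤ s)

  opaque
    -- The separator limits connected sets, so the boundary vertices outside `X` are first added to
    -- `K`. The enlarged set is connected and avoids `X`, hence has at most `s` vertices of `Z`; the
    -- rest of the boundary lies in `X` or is `p`.
    piece-boundary : ∀ {κ s R Z X p K} → Cut κ s Z X → Connected K → K # X → NIn R K ⊆ Z ∪ (X ∪ ⁅ p ⁆) → ∣ NIn R K ∣ ≤ s + suc κ
    piece-boundary {R = R} {Z} {X} {p} {K} (leX , few) cK d f = ≤-trans (card-∪ {q = L ∩ Z} {r = X ∪ ⁅ p ⁆} cover)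
      (+-mono-≤ (few L L-conn L#X) (≤-trans (card-add X p) (s≤s leX)))
      where
      L : VS
      L = K ∪ (NIn R K ─ X)
      L-conn : Connected L
      L-conn = connected-∪-neighbours cK (λ m → let (_ , a , a∈ , e) = N⁻ (proj₁ (∩⁻ (proj₁ (─⁻ _ _ m)))) in a , a∈ , e)
      L#X : L # X
      L#X m x = [ (λ a → d a x) , (λ a → proj₂ (─⁻ _ _ a) x) ]′ (∪⁻ m)
      cover : NIn R K ⊆ (L ∩ Z) ∪ (X ∪ ⁅ p ⁆)
      cover {y} m with y ∈? X
      ... | yes x = ∪ʳ (∪ˡ x)
      ... | no nx with ∪⁻ (f m)
      ...   | inj₁ z = ∪ˡ (∩⁺ (∪ʳ (─⁺ m nx)) z)
      ...   | inj₂ r = ∪ʳ r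

module Spine (G : Graph) (κ : ℕ) (bal : Balanced G κ 4) (P : Subset (n G) → Set) (P? : ∀ D → Dec (P D))
  (P-conn : ∀ {D} → P D → Connectivity.Connected G D)
  (P-mono : ∀ {D D'} → D ⊆ D' → Connectivity.Connected G D' → P D → P D') where
  open Connectivity G
  open Pieces G
  open Tripods G using (Tripod; Leads; reach-one)

  -- A value that reproduces itself: two boundaries of size `w` have at most `4 * (κ + 1)` vertices
  -- together, a cut of ratio 4 leaves at most `κ + 1` of them to each piece, and the cut with one
  -- extra vertex adds at most `κ + 1`.
  w : ℕ
  w = suc κ + suc κ

  opaque
    cut : ∀ Z → ∣ Z ∣ ≤ w + w → ∃[ X ] Cut κ (suc κ) Z X
    cut Z le = bal Z (suc κ) (≤-trans le (≤-reflexive eq))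
      where
      eq : w + w ≡ 4 * suc κ
      eq = trans (+-assoc (suc κ) (suc κ) _) (cong (λ z → suc κ + (suc κ + (suc κ + z))) (sym (+-identityʳ (suc κ))))

  Small : VS → VS → Set
  Small R E = E ⊆ R × (P E × ∣ NIn R E ∣ ≤ w)

  small? : ∀ R E → Dec (Small R E)
  small? R E = (E ⊆? R) ×-dec (P? E ×-dec (_ ≤? w))

  Minimal : VS → VS → Set
  Minimal R E = Small R E × ¬ (∃[ E' ] (Small R E' × (E' ⊆ E × ∣ E' ∣ < ∣ E ∣)))

  minimal? : ∀ R E → Dec (Minimal R E)
  minimal? R E = small? R E ×-dec ¬? (anySubset? (λ E' → small? R E' ×-dec ((E' ⊆? E) ×-dec (_ <? _))))

  opaque
    minimal-in : ∀ {R K} → Small R K → ∃[ E ] (Minimal R E × E ⊆ K)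
    minimal-in {R} {K} s with smallest (λ E → small? R E ×-dec (E ⊆? K)) K (s , id)
    ... | E , (sE , E⊆K) , least = E , (sE , λ (E' , s' , f , lt) → <⇒≱ lt (least E' (s' , λ m → E⊆K (f m)))) , E⊆K

  stays-inside : ∀ {E K x} → Connected K → K # N E → x ∈ K → x ∈ E → K ⊆ E
  stays-inside {E} {K} (_ , c) d x∈K x∈E y∈ = go (c x∈K y∈) x∈E
    where
    go : ∀ {x y} → Path K x y → x ∈ E → y ∈ E
    go (here _) e = e
    go (step {w = z} _ a p) e with z ∈? E
    ... | yes z∈ = go p z∈
    ... | no z∉ = ⊥-elim (d (conn-source p) (N⁺ z∉ e a))

  Off : VS → VS → VS
  Off D E = D ─ (E ∪ N E)

  off⁺ : ∀ {D E F} → F ⊆ D → Nontouching F E → F ⊆ Off D E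
  off⁺ F⊆D nt m = ─⁺ (F⊆D m) (λ k → [ proj₁ nt m , proj₂ nt m ]′ (∪⁻ k))

  off-nontouching : ∀ {D E F} → F ⊆ Off D E → Nontouching F E
  off-nontouching f = (λ a b → proj₂ (─⁻ _ _ (f a)) (∪ˡ b)) , (λ a b → proj₂ (─⁻ _ _ (f a)) (∪ʳ b))

  off-boundary : ∀ {D E F z t} → Component (Off D E) F → z ∈ D → z ∉ F → t ∈ F → Adj G t z → z ∈ N E
  off-boundary {D} {E} {F} {z} {t} c z∈ z∉ t∈ a with z ∈? (E ∪ N E)
  ... | no ∉N = ⊥-elim (z∉ (closed c t∈ a (─⁺ z∈ ∉N)))
  ... | yes m with ∪⁻ m
  ...   | inj₂ r = r
  ...   | inj₁ e = ⊥-elim (nontouching⇒¬touch (off-nontouching (inside-region c)) (t , z , t∈ , e , a))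

  -- Cutting around a minimal set provides every remaining `P`-piece with a disjoint `P`-set that
  -- touches it. In `triple` this set is the third leg.
  module FirstCut (C E : VS) (cC : Connected C) (min : Minimal C E) where
    E⊆C : E ⊆ C
    E⊆C = proj₁ (proj₁ min)
    PE : P E
    PE = proj₁ (proj₂ (proj₁ min))
    cE : Connected E
    cE = P-conn PE
    p : V
    p = proj₁ (proj₁ cE)
    p∈E : p ∈ E
    p∈E = proj₂ (proj₁ cE)
    Z : VS
    Z = NIn C E
    X : VS
    X = proj₁ (cut Z (≤-trans (proj₂ (proj₂ (proj₁ min))) (m≤m+n w w)))
    cutX : Cut κ (suc κ) Z X
    cutX = proj₂ (cut Z (≤-trans (proj₂ (proj₂ (proj₁ min))) (m≤m+n w w)))
    B : VS
    -- The vertex `p` makes every piece inside `E` a proper subset of `E`, even if `X` misses `E`,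
    -- so that minimality can be applied.
    B = Z ∪ ((X ∪ ⁅ p ⁆) ∩ E)
    p∈B : p ∈ B
    p∈B = ∪ʳ (∩⁺ (∪ʳ (x∈⁅x⁆ p)) p∈E)
    B⊆C : B ⊆ C
    B⊆C = ∪-lub (λ m → proj₂ (∩⁻ m)) (λ m → E⊆C (proj₂ (∩⁻ m)))
    ∣B∣≤ : ∣ B ∣ ≤ w + suc κ
    ∣B∣≤ = ≤-trans (∣∪∣≤ Z _) (+-mono-≤ (proj₂ (proj₂ (proj₁ min)))
      (≤-trans (card-mono (λ m → proj₁ (∩⁻ m))) (≤-trans (card-add X p) (s≤s (proj₁ cutX)))))

    module Piece (K : VS) (cK : Component (C ─ B) K) (PK : P K) where
      K⊆C : K ⊆ C
      K⊆C m = proj₁ (─⁻ _ _ (inside-region cK m))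
      K#B : K # B
      K#B m = proj₂ (─⁻ _ _ (inside-region cK m))
      K#NE : K # N E
      K#NE m e = K#B m (∪ˡ (∩⁺ e (K⊆C m)))
      -- `K` avoids `N E`, so it would lie inside `E` if it met `E`. It would then avoid `X`, and
      -- its boundary would be at most `w`: a smaller set than the minimal `E`.
      K#E : K # E
      K#E m e = proj₂ min (K , (K⊆C , PK , piece-boundary cutX (connected cK) K#X boundary) , K⊆E , card-< K⊆E p∈E (λ q → K#B q p∈B))
        where
        K⊆E : K ⊆ E
        K⊆E = stays-inside (connected cK) K#NE m e
        K#X : K # X
        K#X a x = K#B a (∪ʳ (∩⁺ (∪ˡ x) (K⊆E a)))
        opaque
          boundary : NIn C K ⊆ Z ∪ (X ∪ ⁅ p ⁆)
          boundary {y} a with y ∈? B | N⁻ (proj₁ (∩⁻ a))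
          ... | no ∉B | y∉ , d , d∈ , e = ⊥-elim (y∉ (closed cK d∈ e (─⁺ (proj₂ (∩⁻ a)) ∉B)))
          ... | yes b | _ with ∪⁻ b
          ...   | inj₁ z = ∪ˡ z
          ...   | inj₂ r = ∪ʳ (proj₁ (∩⁻ r))

      opaque
        -- A neighbour `y` of `K` in `C` belongs to `B`. It cannot be in `E`, since `K` avoids
        -- `N E`; so it is next to `E` and links `E` to `K`.
        outer : ∃[ O ] (O ⊆ C × P O × O # K × Touch O K)
        outer with proper⇒N cC K⊆C (proj₁ (connected cK)) (E⊆C p∈E) (λ m → K#E m p∈E)
        ... | y , y∈NK , y∈C = E ∪ ⁅ y ⁆ , ∪-lub E⊆C (⁅⁆⊆ y∈C) , P-mono ∪ˡ (connected-∪⁅⁆ cE (touch⇒N y∈NE)) PE ,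
              (λ m k → [ (λ e → K#E k e) , (λ e → proj₁ (N⁻ y∈NK) (subst (_∈ K) (x∈⁅y⁆⇒x≡y _ e) k)) ]′ (∪⁻ m)) ,
              touch-mono ∪ʳ id (touch-sym (touch⇒N y∈NK))
          where
          y∈B : y ∈ B
          y∈B with y ∈? B
          ... | yes b = b
          ... | no b = let (y∉ , d , d∈ , e) = N⁻ y∈NK in ⊥-elim (y∉ (closed cK d∈ e (─⁺ y∈C b)))
          y∈NE : y ∈ N E
          y∈NE with ∪⁻ y∈B
          ... | inj₁ z = proj₁ (∩⁻ z)
          ... | inj₂ r = let (_ , d , d∈ , e) = N⁻ y∈NK in ⊥-elim (K#NE d∈ (N⁺ (K#E d∈) (proj₂ (∩⁻ r)) (adj-sym e)))

  -- D is a piece left over by the first cut; O consists of the cut set and a vertex joining it to D.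
  module Sweep (C D O : VS) (no-tripod : ¬ Tripod P C) (cD : Connected D) (D⊆C : D ⊆ C)
    (O⊆C : O ⊆ C) (PO : P O) (O#D : O # D) (OD : Touch O D) where

    tripod-of : ∀ {A X Y Z'} → A ⊆ C → Connected A → X ⊆ C → Y ⊆ C → Z' ⊆ C → P X → P Y → P Z' → A # X → A # Y → A # Z' →
      X # Y → X # Z' → Y # Z' → Touch A X → Touch A Y → Touch A Z' → ⊥
    tripod-of a cA x y z px py pz ax ay az xy xz yz tx ty tz = no-tripod (_ , _ , _ , _ ,
      (a , x , y , z) , cA , (px , py , pz) , (ax , ay , az) , (xy , xz , yz) , (tx , ty , tz))

    -- F is what remains of D behind the last set E passed by the sweep; before the first step, E is empty and F is D.
    record Tail (E F : VS) : Set where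
      field
        E⊆D : E ⊆ D
        E-small : ∣ NIn D E ∣ ≤ w
        component-F : Component (Off D E) F
        PF : P F
        origin : P E ⊎ D ⊆ F

      F⊆D : F ⊆ D
      F⊆D m = proj₁ (─⁻ _ _ (inside-region component-F m))
      nontouching : Nontouching F E
      nontouching = off-nontouching (inside-region component-F)
      cF : Connected F
      cF = connected component-F
      F-small : ∣ NIn D F ∣ ≤ w
      F-small = ≤-trans (card-mono (λ m → let (y∉ , d , d∈ , e) = N⁻ (proj₁ (∩⁻ m)) in
        ∩⁺ (off-boundary component-F (proj₂ (∩⁻ m)) y∉ d∈ e) (proj₂ (∩⁻ m)))) E-small

    whole : P D → Tail ∅ D
    whole PD = record
      { E⊆D = λ m → ⊥-elim (∉⊥ m)
      ; E-small = ≤-trans (card-mono (λ m → ⊥-elim (N∅ (proj₁ (∩⁻ m))))) (≤-trans (≤-reflexive (∣⊥∣≡0 (n G))) z≤n)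
      ; component-F = record { inside-region = λ m → ─⁺ m (λ k → [ ∉⊥ , N∅ ]′ (∪⁻ k)) ; connected = cD ; closed = λ _ _ m → proj₁ (─⁻ _ _ m) }
      ; PF = PD
      ; origin = inj₂ id }
      where
      N∅ : ∀ {y} → y ∉ N ∅
      N∅ m = let (_ , _ , d∈ , _) = N⁻ m in ∉⊥ d∈

    module Step {E₀ D₀ : VS} (tail : Tail E₀ D₀) where
      open Tail tail using () renaming (E⊆D to E₀⊆D; E-small to E₀-small; component-F to comp₀; PF to PD₀; origin to origin₀; F⊆D to D₀⊆D; nontouching to nt₀; cF to cD₀; F-small to D₀-small)

      -- `E` is a set that the sweep may pass next and `F` is what would then lie ahead; `F ⊆ D₀`
      -- keeps the sweep from turning back. Choosing the largest `F` means passing as little as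
      -- possible.
      Candidate : VS → VS → Set
      Candidate F E = Minimal D E × (E ⊆ D₀ × (Component (Off D E) F × (P F × F ⊆ D₀)))

      candidate? : ∀ F → Dec (∃[ E ] Candidate F E)
      candidate? F = anySubset? (λ E → minimal? D E ×-dec ((E ⊆? D₀) ×-dec (component? (Off D E) F ×-dec (P? F ×-dec (F ⊆? D₀)))))

      opaque
        -- `D₀` is a component of `Off D E₀`, so `F` can leave it only at a neighbour of `E₀`. As
        -- `E₀` does not touch `E₂`, it is absorbed by `F`. At the start of the sweep `D₀` is all of
        -- `D`, and nothing can leave it.
        swallow : ∀ {E₂ F} → E₂ ⊆ D₀ → Component (Off D E₂) F → ∀ {f} → f ∈ F → f ∈ D₀ → ¬ F ⊆ D₀ → P E₀ × E₀ ⊆ F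
        swallow {E₂} {F} E₂⊆ cF {f} f∈F f∈D₀ out = pe origin₀ , absorb-touch cF (P-conn (pe origin₀)) E₀⊆Off touches
          where
          F⊆D : F ⊆ D
          F⊆D m = proj₁ (─⁻ _ _ (inside-region cF m))
          pe : P E₀ ⊎ D ⊆ D₀ → P E₀
          pe (inj₁ q) = q
          pe (inj₂ q) = ⊥-elim (out (λ m → q (F⊆D m)))
          E₀⊆Off : E₀ ⊆ Off D E₂
          E₀⊆Off = off⁺ E₀⊆D (nontouching-mono id E₂⊆ (nontouching-sym nt₀))
          escape : ∃[ q ] (q ∈ F × q ∉ D₀)
          escape with any? (λ q → (q ∈? F) ×-dec ¬? (q ∈? D₀))
          ... | yes r = r
          ... | no none = ⊥-elim (out (λ {q} m → case q ∈? D₀ of λ { (yes r) → r ; (no r) → ⊥-elim (none (q , m , r)) }))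
          touches : Touch F E₀
          touches with escape
          ... | q , q∈F , q∉ with first-entry D₀ (proj₂ (connected cF) q∈F f∈F) q∉ f∈D₀
          ... | z , t , path , _ , t∈ , e with ─⁻ _ _ (conn-target path)
          ... | z∈F , z∉ with N⁻ (off-boundary comp₀ (F⊆D z∈F) z∉ t∈ (adj-sym e))
          ... | _ , d , d∈ , a = z , d , z∈F , d∈ , adj-sym a

      module Around (E : VS) (min : Minimal D E) (E⊆D₀ : E ⊆ D₀) where
        PE : P E
        PE = proj₁ (proj₂ (proj₁ min))
        p : V
        p = proj₁ (proj₁ (P-conn PE))
        p∈E : p ∈ E
        p∈E = proj₂ (proj₁ (P-conn PE))
        E⊆D : E ⊆ D
        E⊆D = proj₁ (proj₁ min)
        Z : VS
        Z = NIn D E₀ ∪ NIn D E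
        ∣Z∣≤ : ∣ Z ∣ ≤ w + w
        ∣Z∣≤ = ≤-trans (∣∪∣≤ _ _) (+-mono-≤ E₀-small (proj₂ (proj₂ (proj₁ min))))
        X : VS
        X = proj₁ (cut Z ∣Z∣≤)
        cutX : Cut κ (suc κ) Z X
        cutX = proj₂ (cut Z ∣Z∣≤)
        B : VS → VS
        -- `F` is exempted, so that it survives as a component of `D₀ ─ B F`.
        B F = ((Z ∪ (X ∪ ⁅ p ⁆)) ∩ D₀) ─ F
        B⊆D₀ : ∀ {F} → B F ⊆ D₀
        B⊆D₀ m = proj₂ (∩⁻ (proj₁ (─⁻ _ _ m)))
        B⁺ : ∀ {F y} → y ∈ Z ∪ (X ∪ ⁅ p ⁆) → y ∈ D₀ → y ∉ F → y ∈ B F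
        B⁺ a b c = ─⁺ (∩⁺ a b) c
        ∣B∣≤ : ∀ {F} → ∣ B F ∣ ≤ w + w + suc κ
        ∣B∣≤ = ≤-trans (card-mono (λ m → proj₁ (∩⁻ (proj₁ (─⁻ _ _ m))))) (≤-trans (∣∪∣≤ Z _) (+-mono-≤ ∣Z∣≤
          (≤-trans (card-add X p) (s≤s (proj₁ cutX)))))
        p∈B : ∀ {F} → F # E → p ∈ B F
        p∈B d = B⁺ (∪ʳ (∪ʳ (x∈⁅x⁆ p))) (E⊆D₀ p∈E) (λ m → d m p∈E)

        opaque
          -- The boundary of `K` in `D` lies in `Z`, `X` and `p`, so it is at most `w` and `K`
          -- contains a minimal set. Since `K` avoids `N E` and `p`, it would be a proper subset of
          -- `E` if it met `E`, against the minimality of `E`. It does not touch `F`, because `F` is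
          -- closed outside `B F`.
          away : ∀ {F K} → F # E → (∀ {x y} → x ∈ F → Adj G x y → y ∈ D₀ → y ∉ B F → y ∈ F) →
            Component (D₀ ─ B F) K → K # F → P K →
            ∃[ E₂ ] (Minimal D E₂ × E₂ ⊆ D₀ × Nontouching E₂ E × Nontouching E₂ F)
          away {F} {K} F#E F-closed cK K#F PK with minimal-in {D} {K} ((λ m → D₀⊆D (K⊆D₀ m)) , PK , K-small)
            where
            K⊆D₀ : K ⊆ D₀
            K⊆D₀ m = proj₁ (─⁻ _ _ (inside-region cK m))
            K#B : K # B F
            K#B m = proj₂ (─⁻ _ _ (inside-region cK m))
            K#X : K # X
            K#X m x = K#B m (B⁺ (∪ʳ (∪ˡ x)) (K⊆D₀ m) (K#F m))
            opaque
              boundary : NIn D K ⊆ Z ∪ (X ∪ ⁅ p ⁆)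
              boundary {y} a with N⁻ (proj₁ (∩⁻ a)) | y ∈? D₀ | y ∈? B F
              ... | y∉ , d , d∈ , e | no ∉D₀ | _ = ∪ˡ (∪ˡ (∩⁺ (off-boundary comp₀ (proj₂ (∩⁻ a)) ∉D₀ (K⊆D₀ d∈) e) (proj₂ (∩⁻ a))))
              ... | _ | yes ∈D₀ | yes b = proj₁ (∩⁻ (proj₁ (─⁻ _ _ b)))
              ... | y∉ , d , d∈ , e | yes ∈D₀ | no b = ⊥-elim (y∉ (closed cK d∈ e (─⁺ ∈D₀ b)))
            K-small : ∣ NIn D K ∣ ≤ w
            K-small = piece-boundary cutX (connected cK) K#X boundary
          ... | E₂ , min₂ , E₂⊆K = E₂ , min₂ , (λ m → K⊆D₀ (E₂⊆K m)) , nontouching-mono E₂⊆K id (K#E , K#NE) , nontouching-mono E₂⊆K id ntF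
            where
            K⊆D₀ : K ⊆ D₀
            K⊆D₀ m = proj₁ (─⁻ _ _ (inside-region cK m))
            K#B : K # B F
            K#B m = proj₂ (─⁻ _ _ (inside-region cK m))
            K#NE : K # N E
            K#NE m e = K#B m (B⁺ (∪ˡ (∪ʳ (∩⁺ e (D₀⊆D (K⊆D₀ m))))) (K⊆D₀ m) (K#F m))
            K#E : K # E
            K#E m e = proj₂ min (E₂ , proj₁ min₂ , (λ a → K⊆E (E₂⊆K a)) ,
                ≤-trans (s≤s (card-mono E₂⊆K)) (card-< K⊆E p∈E (λ q → K#B q (p∈B F#E))))
              where
              K⊆E : K ⊆ E
              K⊆E = stays-inside (connected cK) K#NE m e
            ntF : Nontouching K F
            ntF = K#F , λ m b → let (_ , d , d∈ , e) = N⁻ b in K#F m (F-closed d∈ e (K⊆D₀ m) (K#B m))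

      -- The tripod is centred at a common neighbour of F, E and E₂, or else at a set containing E.
      module Contradict (E F : VS) (min : Minimal D E) (E⊆D₀ : E ⊆ D₀) (cF : Component (Off D E) F) (PF : P F) (F⊆D₀ : F ⊆ D₀)
        (max : ∀ F' → ∃[ E' ] Candidate F' E' → ∣ F' ∣ ≤ ∣ F ∣)
        (E₂ : VS) (min₂ : Minimal D E₂) (E₂⊆D₀ : E₂ ⊆ D₀) (ntE : Nontouching E₂ E) (ntF : Nontouching E₂ F) where
        PE : P E
        PE = proj₁ (proj₂ (proj₁ min))
        PE₂ : P E₂
        PE₂ = proj₁ (proj₂ (proj₁ min₂))
        E⊆D : E ⊆ D
        E⊆D = proj₁ (proj₁ min)
        E₂⊆D : E₂ ⊆ D
        E₂⊆D = proj₁ (proj₁ min₂)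
        F⊆D : F ⊆ D
        F⊆D m = D₀⊆D (F⊆D₀ m)
        FE : Nontouching F E
        FE = off-nontouching (inside-region cF)
        f : V
        f = proj₁ (proj₁ (P-conn PF))
        f∈F : f ∈ F
        f∈F = proj₂ (proj₁ (P-conn PF))
        opaque
          boundary : ∃[ b ] (b ∈ N F × b ∈ D)
          boundary with proj₁ (P-conn PE)
          ... | x , x∈E = proper⇒N cD F⊆D (f , f∈F) (E⊆D x∈E) (λ m → proj₁ FE m x∈E)
        b : V
        b = proj₁ boundary
        b∈NF : b ∈ N F
        b∈NF = proj₁ (proj₂ boundary)
        b∈D : b ∈ D
        b∈D = proj₂ (proj₂ boundary)
        b∉F : b ∉ F
        b∉F = proj₁ (N⁻ b∈NF)
        exit-E : ∀ {z} → z ∈ D → z ∈ N F → z ∈ N E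
        exit-E z∈D z∈NF = let (z∉ , d , d∈ , e) = N⁻ z∈NF in off-boundary cF z∈D z∉ d∈ e
        b∈NE : b ∈ N E
        b∈NE = exit-E b∈D b∈NF
        F⊆Off₂ : F ⊆ Off D E₂
        F⊆Off₂ = off⁺ F⊆D (nontouching-sym ntF)
        ∉-of-nt : ∀ {Y} → Nontouching Y F → b ∉ Y
        ∉-of-nt nt m = proj₂ nt m b∈NF

        ⁅b⁆# : ∀ {Y} → b ∉ Y → ⁅ b ⁆ # Y
        ⁅b⁆# b∉ m y = b∉ (subst (_∈ _) (x∈⁅y⁆⇒x≡y _ m) y)

        meeting : b ∈ N E₂ → ⊥
        meeting b∈NE₂ = tripod-of {⁅ b ⁆} {F} {E} {E₂} (⁅⁆⊆ (D⊆C b∈D)) (connected-⁅⁆ b) (λ m → D⊆C (F⊆D m)) (λ m → D⊆C (E⊆D m)) (λ m → D⊆C (E₂⊆D m))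
          PF PE PE₂ (⁅b⁆# b∉F) (⁅b⁆# (proj₁ (N⁻ b∈NE))) (⁅b⁆# (proj₁ (N⁻ b∈NE₂))) (proj₁ FE) (#-sym (proj₁ ntF)) (#-sym (proj₁ ntE))
          (touch-sym (touch⇒N b∈NF)) (touch-sym (touch⇒N b∈NE)) (touch-sym (touch⇒N b∈NE₂))

        module Hub (PE₀ : P E₀) (F₂ : VS) (cF₂ : Component (Off D E₂) F₂) (F⊆F₂ : F ⊆ F₂) (E₀⊆F₂ : E₀ ⊆ F₂) where
          W : VS
          W = D ─ (F ∪ (E₂ ∪ E₀))
          E₀E : Nontouching E₀ E
          E₀E = nontouching-sym (nontouching-mono E⊆D₀ id nt₀)
          E₀F : Nontouching E₀ F
          E₀F = nontouching-sym (nontouching-mono F⊆D₀ id nt₀)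
          E₂E₀ : Nontouching E₂ E₀
          E₂E₀ = nontouching-mono E₂⊆D₀ id nt₀
          E⊆W : E ⊆ W
          E⊆W m = ─⁺ (E⊆D m) (λ k → case ∪⁻ k of λ
            { (inj₁ q) → proj₁ FE q m ; (inj₂ r) → [ (λ q → proj₁ ntE q m) , (λ q → proj₁ E₀E q m) ]′ (∪⁻ r) })
          hub : ∃[ A ] (proj₁ (proj₁ (P-conn PE)) ∈ A × Component W A)
          hub = component W (E⊆W (proj₂ (proj₁ (P-conn PE))))
          A : VS
          A = proj₁ hub
          cA : Component W A
          cA = proj₂ (proj₂ hub)
          E⊆A : E ⊆ A
          E⊆A = absorb cA (P-conn PE) E⊆W (proj₁ (proj₂ hub)) (proj₂ (proj₁ (P-conn PE)))
          A#W : ∀ {y} → y ∈ A → y ∉ F ∪ (E₂ ∪ E₀)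
          A#W m = proj₂ (─⁻ _ _ (inside-region cA m))
          AF : Touch A F
          AF with N⁻ b∈NF | N⁻ b∈NE
          ... | _ , d , d∈ , e | _ , d' , d'∈ , e' = b , d , closed cA (E⊆A d'∈) e'
                (─⁺ b∈D (λ k → case ∪⁻ k of λ { (inj₁ q) → b∉F q ; (inj₂ r) → [ ∉-of-nt ntF , ∉-of-nt E₀F ]′ (∪⁻ r) }))
                , d∈ , adj-sym e
          -- Follow a path from Y to F backwards from the place where it first comes next to E.
          reach-leg : ∀ {Y K} → Connected K → K ⊆ D → Nonempty Y → Y ⊆ K → F ⊆ K → Nontouching Y E → Y # F →
            (∀ {y} → y ∈ K → y ∉ Y → y ∉ E₂ ∪ E₀) → Touch A Y
          reach-leg {Y} {K} (_ , cK) K⊆D (y₀ , y₀∈) Y⊆K F⊆K YE Y#F avoid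
            with first-entry (E ∪ F) (cK (Y⊆K y₀∈) (F⊆K f∈F)) (λ m → [ proj₁ YE y₀∈ , Y#F y₀∈ ]′ (∪⁻ m)) (∪ʳ f∈F)
          ... | z , t , path , _ , t∈ , e = finish (N⁻ z∈NE)
            where
            z∈ : z ∈ K ─ (E ∪ F)
            z∈ = conn-target path
            z∈K : z ∈ K
            z∈K = proj₁ (─⁻ _ _ z∈)
            z∉ : z ∉ E ∪ F
            z∉ = proj₂ (─⁻ _ _ z∈)
            z∈NE : z ∈ N E
            z∈NE with ∪⁻ t∈
            ... | inj₁ tE = N⁺ (λ m → z∉ (∪ˡ m)) tE (adj-sym e)
            ... | inj₂ tF = exit-E (K⊆D z∈K) (N⁺ (λ m → z∉ (∪ʳ m)) tF (adj-sym e))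
            in-W : ∀ {y} → y ∈ (K ─ (E ∪ F)) ─ Y → y ∈ W
            in-W m with ─⁻ _ _ m
            ... | y∈ , y∉Y with ─⁻ _ _ y∈
            ... | y∈K , y∉EF = ─⁺ (K⊆D y∈K) (λ k → [ (λ q → y∉EF (∪ʳ q)) , avoid y∈K y∉Y ]′ (∪⁻ k))
            finish : z ∉ E × ∃[ d ] (d ∈ E × Adj G d z) → Touch A Y
            finish (_ , d , d∈ , a) with first-entry Y (conn-sym path) (λ m → proj₂ YE m z∈NE) y₀∈
            ... | z' , t' , path' , _ , t'∈ , e' = z' , t' ,
                  component-path cA (closed cA (E⊆A d∈) a (in-W (conn-source path'))) (conn-mono in-W path') , t'∈ , e'
          AE₀ : Touch A E₀
          AE₀ = reach-leg (connected cF₂) (λ m → proj₁ (─⁻ _ _ (inside-region cF₂ m))) (proj₁ (P-conn PE₀)) E₀⊆F₂ F⊆F₂ E₀E (proj₁ E₀F)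
            (λ m ∉E₀ k → [ proj₁ (off-nontouching (inside-region cF₂)) m , ∉E₀ ]′ (∪⁻ k))
          AE₂ : Touch A E₂
          AE₂ = reach-leg cD₀ D₀⊆D (proj₁ (P-conn PE₂)) E₂⊆D₀ F⊆D₀ ntE (proj₁ ntF)
            (λ m ∉E₂ k → [ ∉E₂ , proj₁ nt₀ m ]′ (∪⁻ k))
          absurd : ⊥
          absurd = tripod-of {A} {F} {E₂} {E₀} (λ m → D⊆C (proj₁ (─⁻ _ _ (inside-region cA m)))) (connected cA)
            (λ m → D⊆C (F⊆D m)) (λ m → D⊆C (E₂⊆D m)) (λ m → D⊆C (E₀⊆D m)) PF PE₂ PE₀
            (λ m k → A#W m (∪ˡ k)) (λ m k → A#W m (∪ʳ (∪ˡ k))) (λ m k → A#W m (∪ʳ (∪ʳ k)))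
            (#-sym (proj₁ ntF)) (#-sym (proj₁ E₀F)) (proj₁ E₂E₀) AF AE₂ AE₀

        opaque
          -- Let `F₂` be the component of `Off D E₂` around `F`. If it stays in `D₀`, it competes
          -- with `F`, so it equals `F` by maximality, and `b` is next to `E₂` as well as to `F` and
          -- `E`. If it leaves `D₀`, it swallows `E₀`, and the legs are `F`, `E₂` and `E₀`: within
          -- `D₀` the set `E₂` is joined to `F` away from `E₀`, and within `F₂` the set `E₀` is
          -- joined to `F` away from `E₂`.
          contradict : ⊥
          contradict with component (Off D E₂) (F⊆Off₂ f∈F)
          ... | F₂ , f∈F₂ , cF₂ with F₂ ⊆? D₀
          ...   | yes within₀ = meeting (off-boundary cF₂ b∈D (λ m → b∉F (F₂⊆F m)) (F⊆F₂ (proj₁ (proj₂ d))) (proj₂ (proj₂ d)))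
            where
            d : ∃[ d ] (d ∈ F × Adj G d b)
            d = proj₂ (N⁻ b∈NF)
            F⊆F₂ : F ⊆ F₂
            F⊆F₂ = absorb cF₂ (P-conn PF) F⊆Off₂ f∈F₂ f∈F
            F₂⊆F : F₂ ⊆ F
            F₂⊆F = card⇒⊆ F⊆F₂ (max F₂ (E₂ , min₂ , E₂⊆D₀ , cF₂ , P-mono F⊆F₂ (connected cF₂) PF , within₀))
          ...   | no out with swallow E₂⊆D₀ cF₂ f∈F₂ (F⊆D₀ f∈F) out
          ...     | PE₀ , E₀⊆F₂ = Hub.absurd PE₀ F₂ cF₂ (absorb cF₂ (P-conn PF) F⊆Off₂ f∈F₂ f∈F) E₀⊆F₂

      leg-through : ∀ {X Y Z K A} → Component (D ─ (Y ∪ Z)) A → X ⊆ A → Nonempty X → Nonempty Y → X # Y →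
        Connected K → K ⊆ D → X ⊆ K → Y ⊆ K → (∀ {v} → v ∈ K → v ∉ Y → v ∉ Y ∪ Z) → Touch A Y
      leg-through {Y = Y} cA X⊆A (x , x∈) (v , v∈) d (_ , cK) K⊆D X⊆K Y⊆K avoid with first-entry Y (cK (X⊆K x∈) (Y⊆K v∈)) (d x∈) v∈
      ... | z , t , path , _ , t∈ , e = z , t , component-path cA (X⊆A x∈) (conn-mono in-region path) , t∈ , e
        where
        in-region : ∀ {v} → v ∈ _ ─ Y → v ∈ D ─ (Y ∪ _)
        in-region m with ─⁻ _ _ m
        ... | a , b = ─⁺ (K⊆D a) (avoid a b)

      -- `O` replaces the leg `X` that is reached first from `y`. The centre absorbs `X`; it then
      -- touches `Y` through `K`, `Z` through `L`, and `O` at `y`.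
      triple : ∀ {o y X Y Z K L} → o ∈ O → Adj G o y → Leads D y X Y Z → P X → P Y → P Z → X ⊆ D → Y ⊆ D → Z ⊆ D →
        X # Y → X # Z → Y # Z → Connected K → Connected L → K ⊆ D → L ⊆ D → X ⊆ K → Y ⊆ K → X ⊆ L → Z ⊆ L → K # Z → L # Y → ⊥
      triple {o} {y} {X} {Y} {Z} {K} {L} o∈ oy (x , x∈ , path) PX PY PZ X⊆ Y⊆ Z⊆ xy xz yz cK cL K⊆ L⊆ XK YK XL ZL KZ LY
        with component (D ─ (Y ∪ Z)) (conn-source path)
      ... | A , y∈A , cA = tripod-of {A} {Y} {Z} {O} (λ m → D⊆C (A⊆D m)) (connected cA) (λ m → D⊆C (Y⊆ m)) (λ m → D⊆C (Z⊆ m)) O⊆C PY PZ PO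
        (λ m k → proj₂ (─⁻ _ _ (inside-region cA m)) (∪ˡ k)) (λ m k → proj₂ (─⁻ _ _ (inside-region cA m)) (∪ʳ k)) (λ m k → O#D k (A⊆D m))
        yz (λ m k → O#D k (Y⊆ m)) (λ m k → O#D k (Z⊆ m))
        (leg-through {Z = Z} cA X⊆A (x , x∈) (proj₁ (P-conn PY)) xy cK K⊆ XK YK (λ m n k → [ n , KZ m ]′ (∪⁻ k)))
        (leg-through {Z = Y} cA' X⊆A (x , x∈) (proj₁ (P-conn PZ)) xz cL L⊆ XL ZL (λ m n k → [ n , LY m ]′ (∪⁻ k)))
        (y , o , y∈A , o∈ , adj-sym oy)
        where
        A⊆D : A ⊆ D
        A⊆D m = proj₁ (─⁻ _ _ (inside-region cA m))
        X⊆A : X ⊆ A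
        X⊆A = absorb cA (P-conn PX) (λ m → ─⁺ (X⊆ m) (λ k → [ xy m , xz m ]′ (∪⁻ k))) (component-path cA y∈A path) x∈
        flip : ∀ {v} → v ∈ Y ∪ Z → v ∈ Z ∪ Y
        flip m = [ ∪ʳ , ∪ˡ ]′ (∪⁻ m)
        cA' : Component (D ─ (Z ∪ Y)) A
        cA' = record { inside-region = λ m → ─⁺ (A⊆D m) (λ k → proj₂ (─⁻ _ _ (inside-region cA m)) ([ ∪ʳ , ∪ˡ ]′ (∪⁻ k)))
                     ; connected = connected cA
                     ; closed = λ a e m → closed cA a e (─⁺ (proj₁ (─⁻ _ _ m)) (λ k → proj₂ (─⁻ _ _ m) (flip k))) }

      -- Three P-sets, each two of which are joined away from the third, form a tripod together with O.
      opaque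
        cyclic : ∀ {X₁ X₂ X₃ K₁₂ K₁₃ K₂₃} → P X₁ → P X₂ → P X₃ → X₁ ⊆ D → X₂ ⊆ D → X₃ ⊆ D → X₁ # X₂ → X₁ # X₃ → X₂ # X₃ →
          Connected K₁₂ → Connected K₁₃ → Connected K₂₃ → K₁₂ ⊆ D → K₁₃ ⊆ D → K₂₃ ⊆ D →
          X₁ ⊆ K₁₂ → X₂ ⊆ K₁₂ → X₁ ⊆ K₁₃ → X₃ ⊆ K₁₃ → X₂ ⊆ K₂₃ → X₃ ⊆ K₂₃ → K₁₂ # X₃ → K₁₃ # X₂ → K₂₃ # X₁ → ⊥
        cyclic P₁ P₂ P₃ s₁ s₂ s₃ d12 d13 d23 c12 c13 c23 k12 k13 k23 a12 b12 a13 b13 a23 b23 x12 x13 x23 = at OD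
          where
          at : Touch O D → ⊥
          at (o , y , o∈ , y∈D , oy) with reach-one cD y∈D (proj₁ (P-conn P₁)) s₁ d12 d13 d23
          ... | inj₁ l = triple o∈ oy l P₁ P₂ P₃ s₁ s₂ s₃ d12 d13 d23 c12 c13 k12 k13 a12 b12 a13 b13 x12 x13
          ... | inj₂ (inj₁ l) = triple o∈ oy l P₂ P₁ P₃ s₂ s₁ s₃ (#-sym d12) d23 d13 c12 c23 k12 k23 b12 a12 a23 b23 x12 x23
          ... | inj₂ (inj₂ l) = triple o∈ oy l P₃ P₁ P₂ s₃ s₁ s₂ (#-sym d13) (#-sym d23) d12 c13 c23 k13 k23 b13 a13 b23 a23 x13 x23

      record Bite : Set where
        field
          B : VS
          B⊆ : B ⊆ D₀
          B-nonempty : Nonempty B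
          ∣B∣≤ : ∣ B ∣ ≤ w + w + suc κ

      record Advance : Set where
        field
          bite : Bite
        open Bite bite public
        field
          {E F} : VS
          tail' : Tail E F
          component-F : Component (D₀ ─ B) F
          F-boundary : NIn D F ⊆ NIn D D₀ ∪ B
          rest-poor : ∀ K → Component (D₀ ─ B) K → K # F → ¬ P K

      record Finish : Set where
        field
          bite : Bite
        open Bite bite public
        field
          rest-poor : ∀ K → Component (D₀ ─ B) K → ¬ P K

      opaque
        -- With a largest candidate `F`, every other piece is poor by `contradict`. Without
        -- candidates, a further `P`-piece would contain a minimal `E₂` apart from `E`. The
        -- component of `Off D E` around `E₂` and that of `Off D E₂` around `E` are then no
        -- candidates, so both leave `D₀` and swallow `E₀`. As `D₀` joins `E` to `E₂` away from
        -- `E₀`, `cyclic` applies.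
        step-on : Advance ⊎ Finish
        step-on with anySubset? candidate?
        ... | yes (F₁ , c₁) with largest candidate? F₁ c₁
        ...   | F , (E , min , E⊆D₀ , cF , PF , F⊆D₀) , max = inj₁ record
          { bite = record { B = B F ; B⊆ = B⊆D₀ ; B-nonempty = p , p∈B (proj₁ FE) ; ∣B∣≤ = ∣B∣≤ }
          ; tail' = record { E⊆D = E⊆D ; E-small = proj₂ (proj₂ (proj₁ min)) ; component-F = cF ; PF = PF ; origin = inj₁ PE }
          ; component-F = record
            { inside-region = λ m → ─⁺ (F⊆D₀ m) (λ b → proj₂ (─⁻ _ _ b) m)
            ; connected = connected cF
            ; closed = λ x∈ a y∈ → F-closed x∈ a (proj₁ (─⁻ _ _ y∈)) (proj₂ (─⁻ _ _ y∈)) }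
          ; F-boundary = λ {y} m → let (y∉ , d , d∈ , e) = N⁻ (proj₁ (∩⁻ m)) in case y ∈? D₀ of λ
              { (yes ∈D₀) → ∪ʳ (B⁺ (∪ˡ (∪ʳ (∩⁺ (off-boundary cF (proj₂ (∩⁻ m)) y∉ d∈ e) (proj₂ (∩⁻ m))))) ∈D₀ y∉)
              ; (no ∉D₀) → ∪ˡ (∩⁺ (N⁺ ∉D₀ (F⊆D₀ d∈) e) (proj₂ (∩⁻ m))) }
          ; rest-poor = λ K cK K#F PK → let (E₂ , min₂ , E₂⊆ , ntE , ntF) = away (proj₁ FE) F-closed cK K#F PK in
              Contradict.contradict E F min E⊆D₀ cF PF F⊆D₀ max E₂ min₂ E₂⊆ ntE ntF }
          where
          open Around E min E⊆D₀
          FE : Nontouching F E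
          FE = off-nontouching (inside-region cF)
          F-closed : ∀ {x y} → x ∈ F → Adj G x y → y ∈ D₀ → y ∉ B F → y ∈ F
          F-closed {x} {y} x∈ a ∈D₀ ∉B with y ∈? F
          ... | yes q = q
          ... | no q = ⊥-elim (∉B (B⁺ (∪ˡ (∪ʳ (∩⁺ (off-boundary cF (D₀⊆D ∈D₀) q x∈ a) (D₀⊆D ∈D₀)))) ∈D₀ q))
        step-on | no none with minimal-in {D} {D₀} (D₀⊆D , PD₀ , D₀-small)
        ... | E , min , E⊆D₀ = inj₂ record
          { bite = record { B = B ∅ ; B⊆ = B⊆D₀ ; B-nonempty = p , p∈B (λ m → ⊥-elim (∉⊥ m)) ; ∣B∣≤ = ∣B∣≤ }
          ; rest-poor = poor }
          where
          open Around E min E⊆D₀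
          poor : ∀ K → Component (D₀ ─ B ∅) K → ¬ P K
          poor K cK PK with away {∅} (λ m → ⊥-elim (∉⊥ m)) (λ m → ⊥-elim (∉⊥ m)) cK (λ _ m → ∉⊥ m) PK
          ... | E₂ , min₂ , E₂⊆ , ntE , _ = around (component (Off D E) (inOff₂ (proj₂ (proj₁ (P-conn PE₂))))) (component (Off D E₂) (inOff p∈E))
            where
            PE₂ : P E₂
            PE₂ = proj₁ (proj₂ (proj₁ min₂))
            E₂⊆D : E₂ ⊆ D
            E₂⊆D = proj₁ (proj₁ min₂)
            inOff₂ : E₂ ⊆ Off D E
            inOff₂ = off⁺ E₂⊆D ntE
            inOff : E ⊆ Off D E₂
            inOff = off⁺ E⊆D (nontouching-sym ntE)
            around : ∃[ Fa ] (proj₁ (proj₁ (P-conn PE₂)) ∈ Fa × Component (Off D E) Fa) → ∃[ Fb ] (p ∈ Fb × Component (Off D E₂) Fb) → ⊥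
            around (Fa , q∈ , ca) (Fb , p∈ , cb) = cyclic PE PE₂ (proj₁ a) E⊆D E₂⊆D E₀⊆D (#-sym (proj₁ ntE))
              (λ m k → proj₁ nt₀ (E⊆D₀ m) k) (λ m k → proj₁ nt₀ (E₂⊆ m) k) cD₀ (connected cb) (connected ca) D₀⊆D
              (λ m → proj₁ (─⁻ _ _ (inside-region cb m))) (λ m → proj₁ (─⁻ _ _ (inside-region ca m)))
              E⊆D₀ E₂⊆ E⊆Fb (proj₂ b) E₂⊆Fa (proj₂ a) (proj₁ nt₀) (proj₁ (off-nontouching (inside-region cb))) (proj₁ (off-nontouching (inside-region ca)))
              where
              E₂⊆Fa : E₂ ⊆ Fa
              E₂⊆Fa = absorb ca (P-conn PE₂) inOff₂ q∈ (proj₂ (proj₁ (P-conn PE₂)))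
              E⊆Fb : E ⊆ Fb
              E⊆Fb = absorb cb (P-conn PE) inOff p∈ p∈E
              a : P E₀ × E₀ ⊆ Fa
              a = swallow E⊆D₀ ca q∈ (E₂⊆ (proj₂ (proj₁ (P-conn PE₂)))) (λ f → none (Fa , E , min , E⊆D₀ , ca , P-mono E₂⊆Fa (connected ca) PE₂ , f))
              b : P E₀ × E₀ ⊆ Fb
              b = swallow E₂⊆ cb p∈ (E⊆D₀ p∈E) (λ f → none (Fb , E₂ , min₂ , E₂⊆ , cb , P-mono E⊆Fb (connected cb) PE , f))

-- Potentials and rooted decompositions.

total : ∀ {k} → (Fin k → ℕ) → ℕ
total {zero} f = 0
total {suc k} f = f fz + total (λ i → f (fs i))

lower : ∀ {k} → (Fin k → ℕ) → Fin k → ℕ → Fin k → ℕ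
lower r u h v with v ≟F u
... | yes _ = h
... | no _ = r v

lower-at : ∀ {k} (r : Fin k → ℕ) u h → lower r u h u ≡ h
lower-at r u h with u ≟F u
... | yes _ = refl
... | no ne = ⊥-elim (ne refl)

lower-off : ∀ {k} (r : Fin k → ℕ) {u v} h → v ≢ u → lower r u h v ≡ r v
lower-off r {u} {v} h ne with v ≟F u
... | yes e = ⊥-elim (ne e)
... | no _ = refl

total-cong : ∀ {k} {f f' : Fin k → ℕ} → (∀ i → f i ≡ f' i) → total f ≡ total f'
total-cong {zero} e = refl
total-cong {suc k} e = cong₂ _+_ (e fz) (total-cong (λ i → e (fs i)))

total-lower : ∀ {k} (r : Fin k → ℕ) u {h} → r u ≡ suc h → suc (total (lower r u h)) ≡ total r
total-lower r fz {h} e = trans (cong suc (cong₂ _+_ (lower-at r fz h) (total-cong {f = λ i → lower r fz h (fs i)} {f' = λ i → r (fs i)} (λ i → lower-off r {fz} {fs i} h (λ ()))))) (cong (_+ total (λ i → r (fs i))) (sym e))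
total-lower r (fs u) {h} e = trans (cong suc (cong₂ _+_ (lower-off r {fs u} h (λ ())) (total-cong shift)))
  (trans (sym (+-suc (r fz) _)) (cong (r fz +_) (total-lower (λ i → r (fs i)) u e)))
  where
  shift : ∀ i → lower r (fs u) h (fs i) ≡ lower (λ i → r (fs i)) u h i
  shift i with fs i ≟F fs u | i ≟F u
  ... | yes _ | yes _ = refl
  ... | yes refl | no ne = ⊥-elim (ne refl)
  ... | no ne | yes refl = ⊥-elim (ne refl)
  ... | no _ | no _ = refl

constantOn : ∀ {k} → Subset k → ℕ → Fin k → ℕ
constantOn S K v = if lookup S v then K else 0

total-constantOn : ∀ {k} (S : Subset k) K → total (constantOn S K) ≡ K * ∣ S ∣
total-constantOn S K = trans (go S) (cong (K *_) (sym (card-is S)))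
  where
  go : ∀ {k} (S : Subset k) → total (constantOn S K) ≡ K * ∣ S ∣ᵥ
  go [] = sym (*-zeroʳ K)
  go (inside ∷ S) = trans (cong (K +_) (go S)) (sym (*-suc K ∣ S ∣ᵥ))
  go (outside ∷ S) = go S

constantOn-∈ : ∀ {k} {S : Subset k} {K v} → v ∈ S → constantOn S K v ≡ K
constantOn-∈ {K = K} m = cong (if_then K else 0) ([]=⇒lookup m)

-- Rooted tree decompositions as forests of components.  A component C with B ⊆ C has the bag N C ∪ B; its children
-- decompose C - B.  Each node has an epoch and a level; Old is the set of vertices inherited from the previous epoch.
-- Only the last child may have the level of its parent.
module Decompositions (G : Graph) (Λ β : ℕ) where
  open Connectivity G

  -- Levels bound how many nodes of an epoch wait for further children at once. A `side` child may
  -- leave its parent waiting, so it loses a level; a `last` child takes all that remains (`W ⊆ C`),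
  -- which releases the parent and permits chains of any length at one level. The condition
  -- `N C # Old` keeps vertices from surviving into a third epoch.
  data Kind (e ℓ : ℕ) (Old W C : VS) : ℕ → ℕ → VS → Set where
    side : ∀ {ℓ'} → ℓ' < ℓ → Kind e ℓ Old W C e ℓ' Old
    last : ∀ {ℓ'} → ℓ' ≤ ℓ → W ⊆ C → Kind e ℓ Old W C e ℓ' Old
    epoch : ∀ {ℓ'} → ℓ' ≤ Λ → N C # Old → Kind e ℓ Old W C (suc e) ℓ' (N C)

  data Forest (e ℓ : ℕ) (Old W : VS) : Set where
    leaf : (∀ {x} → x ∉ W) → Forest e ℓ Old W
    node : ∀ C B {e' ℓ' Old'} → C ⊆ W → (∀ {x y} → x ∈ C → Adj G x y → y ∈ W → y ∈ C) → B ⊆ C → ∣ N C ∪ B ∣ ≤ β →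
      Kind e ℓ Old W C e' ℓ' Old' → Forest e' ℓ' Old' (C ─ B) → Forest e ℓ Old (W ─ C) → Forest e ℓ Old W

  NodeOf : ℕ → ℕ → VS → VS → Set
  NodeOf e ℓ Old C = ∃[ B ] (B ⊆ C × ∣ N C ∪ B ∣ ≤ β × Forest e ℓ Old (C ─ B))

  Child : ℕ → ℕ → VS → VS → Set
  Child e ℓ Old K = (∃[ ℓ' ] (ℓ' < ℓ × NodeOf e ℓ' Old K)) ⊎ (∃[ ℓ' ] (ℓ' ≤ Λ × N K # Old × NodeOf (suc e) ℓ' (N K) K))

  module _ {e ℓ : ℕ} {Old : VS} (F : VS)
    (finish : ∀ W → F ⊆ W → W ⊆ F → Forest e ℓ Old W) where

    -- The components outside `F` are split off one by one, and `F` is saved for the end, where it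
    -- may become a `last` child.
    assemble : ∀ m W → ∣ W ∣ ≤ m → F ⊆ W → (∀ {x y} → x ∈ F → Adj G x y → y ∈ W → y ∈ F) →
      (∀ K → Component W K → K # F → Child e ℓ Old K) → Forest e ℓ Old W
    assemble m W le F⊆W F-closed child with any? (λ x → (x ∈? W) ×-dec ¬? (x ∈? F))
    ... | no none = finish W F⊆W (λ {x} m → case x ∈? F of λ { (yes f) → f ; (no f) → ⊥-elim (none (x , m , f)) })
    assemble zero W le F⊆W F-closed child | yes (x , x∈ , _) = ⊥-elim (<⇒≱ (card>0 x∈) le)
    assemble (suc m) W le F⊆W F-closed child | yes (x , x∈W , x∉F) with component W x∈W
    ... | K , x∈K , cK = attach (child K cK K#F)
      where
      K#F : K # F
      K#F y∈K y∈F = x∉F (go (proj₂ (connected cK) y∈K x∈K) y∈F)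
        where
        go : ∀ {y z} → Path K y z → y ∈ F → z ∈ F
        go (here _) f = f
        go (step _ a p) f = go p (F-closed f a (inside-region cK (conn-source p)))
      others : Forest e ℓ Old (W ─ K)
      others = assemble m (W ─ K) (≤-pred (≤-trans (card-< (p─q⊆p W K) x∈W (λ q → proj₂ (─⁻ W K q) x∈K)) le))
        (λ f → ─⁺ (F⊆W f) (λ k → K#F k f)) (λ f a y∈ → F-closed f a (proj₁ (─⁻ _ _ y∈)))
        (λ K' cK' d → child K' (record
          { inside-region = λ m → proj₁ (─⁻ _ _ (inside-region cK' m))
          ; connected = connected cK'
          ; closed = λ z∈ a y∈ → closed cK' z∈ a (─⁺ y∈ (λ y∈K → proj₂ (─⁻ _ _ (inside-region cK' z∈))
              (closed cK y∈K (adj-sym a) (proj₁ (─⁻ _ _ (inside-region cK' z∈)))))) }) d)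
      attach : Child e ℓ Old K → Forest e ℓ Old W
      attach (inj₁ (ℓ' , lt , B , B⊆ , b , f)) = node K B (inside-region cK) (closed cK) B⊆ b (side lt) f others
      attach (inj₂ (ℓ' , lt , d , B , B⊆ , b , f)) = node K B (inside-region cK) (closed cK) B⊆ b (epoch lt d) f others

  forest-of : ∀ {e ℓ Old} W → (∀ K → Component W K → Child e ℓ Old K) → Forest e ℓ Old W
  forest-of W child = assemble ∅ (λ _ _ f → leaf (λ m → ∉⊥ (f m))) ∣ W ∣ W ≤-refl (λ m → ⊥-elim (∉⊥ m)) (λ m → ⊥-elim (∉⊥ m))
    (λ K cK _ → child K cK)

  forest-with-last : ∀ {e ℓ Old} W F → Component W F → NodeOf e ℓ Old F →
    (∀ K → Component W K → K # F → Child e ℓ Old K) → Forest e ℓ Old W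
  forest-with-last W F cF (B , B⊆ , b , f) child = assemble F
    (λ W' F⊆ ⊆F → node F B F⊆ (λ _ _ m → ⊆F m) B⊆ b (last ≤-refl ⊆F) f (leaf (λ m → proj₂ (─⁻ _ _ m) (⊆F (proj₁ (─⁻ _ _ m))))))
    ∣ W ∣ W ≤-refl (inside-region cF) (closed cF) child

-- The first cut, the boundary of the piece being swept, and the bite of one step of the sweep.
growth : ℕ → ℕ
growth κ = (w + suc κ) + (w + (w + w + suc κ))
  where
  w : ℕ
  w = suc κ + suc κ

-- Construction of the decomposition, epoch by epoch.

module Constants (K κ κq : ℕ) where

  w g M : ℕ
  w = suc κ + suc κ
  g = growth κ
  M = suc κq + suc κq

  -- `Rmax` bounds the sum of the richness bounds when at most `M` old vertices start with `K` each.
  -- In `β`, the first summand bounds the boundary of a component, old vertices plus all that the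
  -- ledger allows; the second covers what a node adds in a sweep or at a change of epoch.
  Rmax Λ β : ℕ
  Rmax = K * M
  Λ = suc (Rmax + Rmax)
  β = (M + g * Rmax) + (g + suc κq)

module Build (G : Graph) (K κ κq : ℕ) (bal : Balanced G κ 4)
  (poor : ∀ u D → u ∉ D → ¬ Tripods.Rich.Rich G u K D) where
  open Connectivity G
  open Tripods G

  open Constants K κ κq
  open Decompositions G Λ β
  open Pieces G

  -- Odd levels belong to components with potential `R`. The even level `R + R` just below is that
  -- of all the nodes of a sweep, and still lies above the level of potential `R - 1`.
  level : ℕ → ℕ
  level R = suc (R + R)

  module _ (bal-q : Balanced G κq (2 * (g * K))) where

    N-child : ∀ {C B C'} → Component (C ─ B) C' → N C' ⊆ N C ∪ B
    N-child {C} {B} {C'} c {y} m with N⁻ m | y ∈? C | y ∈? B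
    ... | _ | _ | yes b = ∪ʳ b
    ... | y∉ , d , d∈ , a | yes y∈C | no b = ⊥-elim (y∉ (closed c d∈ a (─⁺ y∈C b)))
    ... | y∉ , d , d∈ , a | no y∉C | no _ = ∪ˡ (N⁺ y∉C (proj₁ (─⁻ _ _ (inside-region c d∈))) a)

    -- `S₀` is the boundary inherited at the start of the epoch. The `ledger` expresses the
    -- amortisation: each unit by which `total r` has decreased pays for `g` boundary vertices
    -- outside `S₀`.
    record State (S₀ : VS) (r : V → ℕ) (C : VS) : Set where
      field
        S₀#C : S₀ # C
        S₀-small : ∣ S₀ ∣ ≤ M
        bounded : ∀ {u} → u ∈ S₀ → ¬ Rich.Rich u (r u) C
        ledger : ∣ N C ─ S₀ ∣ + g * total r ≤ g * Rmax

      N-small : ∣ N C ∣ ≤ M + g * Rmax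
      N-small = ≤-trans (card-split (N C) S₀) (+-mono-≤ (≤-trans (card-mono (λ m → proj₂ (∩⁻ m))) S₀-small)
        (≤-trans (m≤m+n _ _) ledger))

    bag-bound : ∀ {C B b} → ∣ N C ∣ ≤ M + g * Rmax → ∣ B ∣ ≤ b → b ≤ g + suc κq → ∣ N C ∪ B ∣ ≤ β
    bag-bound {C} {B} a b le = ≤-trans (∣∪∣≤ (N C) B) (+-mono-≤ a (≤-trans b le))

    Builder : ℕ → Set
    Builder m = ∀ C → ∣ C ∣ ≤ m → Connected C → ∀ e S₀ r → State S₀ r C → NodeOf e (level (total r)) S₀ C

    module NewEpoch (m : ℕ) (ih : Builder m) (C : VS) (∣C∣≤ : ∣ C ∣ ≤ suc m) (cC : Connected C) (e : ℕ) (S₀ : VS) (r : V → ℕ)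
      (st : State S₀ r C) (gone : N C # S₀) where
      open State st
      p : V
      p = proj₁ (proj₁ cC)
      p∈C : p ∈ C
      p∈C = proj₂ (proj₁ cC)
      -- Once no old vertex is left in the boundary, the ledger bounds all of it by `g * Rmax`,
      -- which is `2 * (g * K)` times `κq + 1`: exactly the ratio of `bal-q`.
      enough : ∣ N C ∣ ≤ 2 * (g * K) * suc κq
      enough = ≤-trans (card-mono (λ m → ─⁺ m (gone m))) (≤-trans (m≤m+n _ _) (≤-trans ledger (≤-reflexive eq)))
        where
        eq : g * (K * M) ≡ 2 * (g * K) * suc κq
        eq = begin
          g * (K * (suc κq + suc κq)) ≡⟨ sym (*-assoc g K _) ⟩
          g * K * (suc κq + suc κq) ≡⟨ *-distribˡ-+ (g * K) (suc κq) (suc κq) ⟩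
          g * K * suc κq + g * K * suc κq ≡⟨ sym (*-distribʳ-+ (suc κq) (g * K) (g * K)) ⟩
          (g * K + g * K) * suc κq ≡⟨ cong (λ z → (g * K + z) * suc κq) (sym (+-identityʳ (g * K))) ⟩
          2 * (g * K) * suc κq ∎
          where open ≡-Reasoning
      X : VS
      X = proj₁ (bal-q (N C) (suc κq) enough)
      cutX : Cut κq (suc κq) (N C) X
      cutX = proj₂ (bal-q (N C) (suc κq) enough)
      B : VS
      B = (X ∪ ⁅ p ⁆) ∩ C
      p∈B : p ∈ B
      p∈B = ∩⁺ (∪ʳ (x∈⁅x⁆ p)) p∈C

      child : ∀ C' → Component (C ─ B) C' → Child e (level (total r)) S₀ C'
      child C' c = inj₂ (level (total r') , s≤s (+-mono-≤ R≤ R≤) , N#S₀ ,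
        ih C' (≤-pred (≤-trans (card-< C'⊆C p∈C (λ q → proj₂ (─⁻ _ _ (inside-region c q)) p∈B)) ∣C∣≤)) (connected c) (suc e) (N C') r' record
          { S₀#C = λ m → proj₁ (N⁻ m)
          ; S₀-small = N'≤M
          ; bounded = λ {u} m → subst (λ h → ¬ Rich.Rich u h C') (sym (constantOn-∈ m)) (poor u C' (proj₁ (N⁻ m)))
          ; ledger = ≤-trans (+-mono-≤ (≤-trans (card-mono (λ m → ⊥-elim (proj₂ (─⁻ _ _ m) (proj₁ (─⁻ _ _ m))))) (≤-reflexive (∣⊥∣≡0 (n G)))) (*-monoʳ-≤ g R≤)) ≤-refl })
        where
        C'⊆C : C' ⊆ C
        C'⊆C m = proj₁ (─⁻ _ _ (inside-region c m))
        r' : V → ℕ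
        r' = constantOn (N C') K
        -- At most `κq + 1` vertices come from the boundary that was divided and at most `κq + 1`
        -- from the separator with `p`; this is the origin of `M`.
        N'≤M : ∣ N C' ∣ ≤ M
        N'≤M = ≤-trans (card-mono (λ m → ∩⁺ m ∈⊤)) (piece-boundary {R = 𝕍} {N C} {X} {p} cutX (connected c)
          (λ m x → proj₂ (─⁻ _ _ (inside-region c m)) (∩⁺ (∪ˡ x) (C'⊆C m)))
          (λ m → [ ∪ˡ , (λ b → ∪ʳ (proj₁ (∩⁻ b))) ]′ (∪⁻ (N-child c (proj₁ (∩⁻ m))))))
        R≤ : total r' ≤ Rmax
        R≤ = ≤-trans (≤-reflexive (total-constantOn (N C') K)) (*-monoʳ-≤ K N'≤M)
        N#S₀ : N C' # S₀
        N#S₀ m s = [ (λ a → gone a s) , (λ b → S₀#C s (proj₂ (∩⁻ b))) ]′ (∪⁻ (N-child c m))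

      result : NodeOf e (level (total r)) S₀ C
      result = B , (λ m → proj₂ (∩⁻ m)) ,
        bag-bound {C} {B} N-small (≤-trans (card-mono (λ m → proj₁ (∩⁻ m))) (≤-trans (card-add X p) (s≤s (proj₁ cutX)))) (m≤n+m _ g) ,
        forest-of (C ─ B) child

    module Descend (m : ℕ) (ih : Builder m) (C : VS) (∣C∣≤ : ∣ C ∣ ≤ suc m) (cC : Connected C) (e : ℕ) (S₀ : VS) (r : V → ℕ)
      (st : State S₀ r C) (u : V) (u∈S₀ : u ∈ S₀) (h : ℕ) (ru : r u ≡ suc h) where
      open State st
      open Rich u using (rich?; rich-conn; rich-mono)

      P : VS → Set
      P = Rich.Rich u h

      r' : V → ℕ
      r' = lower r u h
      R' : ℕ
      R' = total r'
      R-eq : suc R' ≡ total r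
      R-eq = total-lower r u ru

      -- Not being `P` allows the bound of `u` to drop to `h`. This releases `g` units of the
      -- ledger, enough for the `b` new boundary vertices.
      poorer : ∀ C' {b} → C' ⊆ C → ∀ {p} → p ∈ C → p ∉ C' → Connected C' → ¬ P C' →
        ∣ N C' ─ S₀ ∣ ≤ ∣ N C ─ S₀ ∣ + b → b ≤ g → NodeOf e (level R') S₀ C'
      poorer C' {b} C'⊆C p∈ p∉ cC' ¬P le b≤g = ih C' (≤-pred (≤-trans (card-< C'⊆C p∈ p∉) ∣C∣≤)) cC' e S₀ r' record
        { S₀#C = λ s m → S₀#C s (C'⊆C m)
        ; S₀-small = S₀-small
        ; bounded = bounded'
        ; ledger = ≤-trans (+-monoˡ-≤ (g * R') (≤-trans le (+-monoʳ-≤ _ b≤g))) (≤-trans (≤-reflexive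
            (trans (+-assoc (∣ N C ─ S₀ ∣) g (g * R')) (cong (∣ N C ─ S₀ ∣ +_) (trans (sym (*-suc g R')) (cong (g *_) R-eq))))) ledger) }
        where
        bounded' : ∀ {v} → v ∈ S₀ → ¬ Rich.Rich v (r' v) C'
        bounded' {v} v∈ with v ≟F u
        ... | yes refl = ¬P
        ... | no _ = λ q → bounded v∈ (Rich.rich-mono v (r v) C'⊆C cC q)

      below-level : level R' < level (total r)
      below-level = s≤s (≤-trans (n≤1+n _) (≤-reflexive (trans (cong suc (sym (+-suc R' R'))) (cong₂ _+_ R-eq R-eq))))

      below-spine : level R' < total r + total r
      below-spine = ≤-reflexive (trans (cong suc (sym (+-suc R' R'))) (cong₂ _+_ R-eq R-eq))

      diff-∪ : ∀ {A A' B b} → A ⊆ A' ∪ B → ∣ B ∣ ≤ b → ∣ A ─ S₀ ∣ ≤ ∣ A' ─ S₀ ∣ + b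
      diff-∪ {A} {A'} {B} f le = ≤-trans (card-∪ {p = A ─ S₀} {q = A' ─ S₀} {r = B} (λ m → let (a , s) = ─⁻ _ _ m in
        [ (λ a' → ∪ˡ (─⁺ a' s)) , ∪ʳ ]′ (∪⁻ (f a)))) (+-monoʳ-≤ _ le)

      easy : ¬ P C → NodeOf e (level (total r)) S₀ C
      easy ¬P = ⁅ p ⁆ , ⁅⁆⊆ p∈C , bag-bound {C} {⁅ p ⁆} N-small (≤-reflexive (∣⁅x⁆∣≡1 p)) 1≤ , forest-of (C ─ ⁅ p ⁆) child
        where
        p : V
        p = proj₁ (proj₁ cC)
        p∈C : p ∈ C
        p∈C = proj₂ (proj₁ cC)
        1≤g : 1 ≤ g
        1≤g = s≤s z≤n
        1≤ : 1 ≤ g + suc κq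
        1≤ = s≤s z≤n
        child : ∀ C' → Component (C ─ ⁅ p ⁆) C' → Child e (level (total r)) S₀ C'
        child C' c = inj₁ (level R' , below-level , poorer C' C'⊆C p∈C (λ q → proj₂ (─⁻ _ _ (inside-region c q)) (x∈⁅x⁆ p)) (connected c)
          (λ q → ¬P (rich-mono h C'⊆C cC q)) (diff-∪ (N-child c) (≤-reflexive (∣⁅x⁆∣≡1 p))) 1≤g)
          where
          C'⊆C : C' ⊆ C
          C'⊆C m = proj₁ (─⁻ _ _ (inside-region c m))

      module Hard (PC : P C) where
        module S = Spine G κ bal P (rich? h) (rich-conn h) (rich-mono h)

        no-tripod : ¬ Tripod P C
        no-tripod t = bounded u∈S₀ (subst (λ k → Rich.Rich u k C) (sym ru) (cC , t))

        start : ∃[ E ] (S.Minimal C E × E ⊆ C)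
        start = S.minimal-in (id , PC , ≤-trans (card-mono (λ m → ⊥-elim (proj₁ (N⁻ (proj₁ (∩⁻ m))) (proj₂ (∩⁻ m)))))
          (≤-trans (≤-reflexive (∣⊥∣≡0 (n G))) z≤n))

        open S.FirstCut C (proj₁ start) cC (proj₁ (proj₂ start)) using (p; p∈B; ∣B∣≤; E⊆C; p∈E; module Piece) renaming (B to B₀; B⊆C to B₀⊆C)

        p∈C : p ∈ C
        p∈C = E⊆C p∈E

        ∣B₀∣≤g : ∣ B₀ ∣ ≤ g
        ∣B₀∣≤g = ≤-trans ∣B∣≤ (m≤m+n _ _)

        module Along (D : VS) (cD : Component (C ─ B₀) D) (PD : P D) where
          open Piece D cD PD using (outer) renaming (K⊆C to D⊆C; K#B to D#B₀)
          module T = S.Sweep C D (proj₁ outer) no-tripod (connected cD) D⊆C (proj₁ (proj₂ outer))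
            (proj₁ (proj₂ (proj₂ outer))) (proj₁ (proj₂ (proj₂ (proj₂ outer)))) (proj₂ (proj₂ (proj₂ (proj₂ outer))))

          module Region {E F : VS} (tail : T.Tail E F) where
            open T.Tail tail

            -- The boundary of the remainder is charged to `C` directly and not to the preceding
            -- step: apart from `N C`, it consists of vertices of the first cut and of at most `w`
            -- vertices of `D`. So a side piece costs at most `g` however many steps came before.
            N-F : N F ⊆ N C ∪ (B₀ ∪ NIn D F)
            N-F {y} m with y ∈? D
            ... | yes y∈D = ∪ʳ (∪ʳ (∩⁺ m y∈D))
            ... | no y∉D = let (_ , d , d∈ , a) = N⁻ m in [ ∪ˡ , (λ b → ∪ʳ (∪ˡ b)) ]′ (∪⁻ (N-child cD (N⁺ y∉D (F⊆D d∈) a)))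

            bag≤ : ∀ {B} → ∣ B ∣ ≤ w + w + suc κ → ∣ N F ∪ B ∣ ≤ β
            bag≤ {B} le = ≤-trans (card-∪ {p = N F ∪ B} {q = N C} {r = (B₀ ∪ NIn D F) ∪ B} shuffle)
              (+-mono-≤ N-small (≤-trans (≤-trans (∣∪∣≤ (B₀ ∪ NIn D F) B) (+-mono-≤ (≤-trans (∣∪∣≤ B₀ (NIn D F)) (+-mono-≤ ∣B∣≤ F-small)) le))
                (≤-trans (≤-reflexive (+-assoc (w + suc κ) w _)) (m≤m+n g _))))
              where
              shuffle : N F ∪ B ⊆ N C ∪ ((B₀ ∪ NIn D F) ∪ B)
              shuffle m with ∪⁻ m
              ... | inj₂ b = ∪ʳ (∪ʳ b)
              ... | inj₁ a = [ ∪ˡ , (λ z → ∪ʳ (∪ˡ z)) ]′ (∪⁻ (N-F a))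

            side-child : ∀ {B} → ∣ B ∣ ≤ w + w + suc κ → ∀ C' → Component (F ─ B) C' → ¬ P C' → Child e (total r + total r) S₀ C'
            side-child {B} le C' c ¬P = inj₁ (level R' , below-spine , poorer C' (λ m → D⊆C (F⊆D (C'⊆F m))) p∈C
              (λ m → D#B₀ (F⊆D (C'⊆F m)) p∈B) (connected c) ¬P (diff-∪ {B = (B₀ ∪ NIn D F) ∪ B} shuffle
                (≤-trans (∣∪∣≤ (B₀ ∪ NIn D F) B) (+-mono-≤ (≤-trans (∣∪∣≤ B₀ (NIn D F)) (+-mono-≤ ∣B∣≤ F-small)) le)))
              (≤-reflexive (+-assoc (w + suc κ) w _)))
              where
              C'⊆F : C' ⊆ F
              C'⊆F m = proj₁ (─⁻ _ _ (inside-region c m))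
              shuffle : N C' ⊆ N C ∪ ((B₀ ∪ NIn D F) ∪ B)
              shuffle m with ∪⁻ (N-child c m)
              ... | inj₂ b = ∪ʳ (∪ʳ b)
              ... | inj₁ a = [ ∪ˡ , (λ z → ∪ʳ (∪ˡ z)) ]′ (∪⁻ (N-F a))

          -- The part ahead becomes the last child and keeps the level; the side pieces are not `P`
          -- and return to the recursion with a smaller potential.
          sweep : ∀ j {E F} (tail : T.Tail E F) → ∣ F ∣ ≤ j → NodeOf e (total r + total r) S₀ F
          sweep j {E} {F} tail le with T.Step.step-on tail
          ... | inj₂ fin = B , B⊆ , Region.bag≤ tail ∣B∣≤' , forest-of (F ─ B) (λ C' c → Region.side-child tail ∣B∣≤' C' c (rest-poor C' c))
            where open T.Step.Finish fin renaming (∣B∣≤ to ∣B∣≤')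
          sweep zero {E} {F} tail le | inj₁ adv = ⊥-elim (<⇒≱ (card>0 (B⊆ (proj₂ B-nonempty))) le)
            where open T.Step.Advance adv
          sweep (suc j) {E} {F} tail le | inj₁ adv = B , B⊆ , Region.bag≤ tail ∣B∣≤' ,
            forest-with-last (F ─ B) F' component-F (sweep j tail' (≤-pred (≤-trans (card-< (λ m → proj₁ (─⁻ _ _ (inside-region component-F m)))
              (B⊆ (proj₂ B-nonempty)) (λ m → proj₂ (─⁻ _ _ (inside-region component-F m)) (proj₂ B-nonempty))) le)))
              (λ C' c d → Region.side-child tail ∣B∣≤' C' c (rest-poor C' c d))
            where open T.Step.Advance adv renaming (∣B∣≤ to ∣B∣≤'; F to F')

          result : NodeOf e (total r + total r) S₀ D
          result = sweep ∣ D ∣ (T.whole PD) ≤-refl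

        child : ∀ C' → Component (C ─ B₀) C' → Child e (level (total r)) S₀ C'
        child C' c with rich? h C'
        ... | yes PC' = inj₁ (total r + total r , ≤-refl , Along.result C' c PC')
        ... | no ¬P = inj₁ (level R' , below-level , poorer C' (λ m → proj₁ (─⁻ _ _ (inside-region c m))) p∈C
              (λ q → proj₂ (─⁻ _ _ (inside-region c q)) p∈B) (connected c) ¬P (diff-∪ (N-child c) ∣B₀∣≤g) ≤-refl)

        result : NodeOf e (level (total r)) S₀ C
        result = B₀ , B₀⊆C , bag-bound {C} {B₀} N-small ∣B₀∣≤g (m≤m+n g _) , forest-of (C ─ B₀) child

      result : NodeOf e (level (total r)) S₀ C
      result with rich? h C
      ... | yes PC = Hard.result PC
      ... | no ¬P = easy ¬P

    -- An old vertex `u` in the boundary touches `C`, so `C` is 0-rich for `u` and `r u` is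
    -- positive. `Descend` lowers it in every component that it hands back to the recursion; when no
    -- old vertex is left in the boundary, a new epoch begins.
    build : ∀ m → Builder m
    build zero C le cC e S₀ r st = ⊥-elim (<⇒≱ (card>0 (proj₂ (proj₁ cC))) le)
    build (suc m) C le cC e S₀ r st with any? (λ u → (u ∈? N C) ×-dec (u ∈? S₀))
    ... | no none = NewEpoch.result m (build m) C le cC e S₀ r st (λ a b → none (_ , a , b))
    ... | yes (u , u∈N , u∈S₀) with r u in ru
    ...   | suc h = Descend.result m (build m) C le cC e S₀ r st u u∈S₀ h ru
    ...   | zero = ⊥-elim (State.bounded st u∈S₀ (subst (λ h → Rich.Rich u h C) (sym ru) (cC , touch⇒N u∈N)))

    -- Epoch 0 is reserved for an empty root bag; every component of `G` opens epoch 1 with an empty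
    -- old boundary.
    decomposition : Forest 0 0 ∅ 𝕍
    decomposition = forest-of 𝕍 (λ C c → inj₂ (level (total (r₀)) , s≤s (+-mono-≤ R≤ R≤) , (λ _ → ∉⊥) ,
      subst (λ S → NodeOf 1 (level (total (r₀))) S C) (sym (N-empty c)) (build (n G) C (∣p∣≤n C) (connected c) 1 ∅ (r₀) record
        { S₀#C = λ m → ⊥-elim (∉⊥ m)
        ; S₀-small = ≤-trans (≤-reflexive (∣⊥∣≡0 (n G))) z≤n
        ; bounded = λ m → ⊥-elim (∉⊥ m)
        ; ledger = ≤-trans (+-mono-≤ (≤-trans (card-mono (λ m → subst (_ ∈_) (N-empty c) (proj₁ (─⁻ _ _ m)))) (≤-reflexive (∣⊥∣≡0 (n G)))) (*-monoʳ-≤ g R≤)) ≤-refl })))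
      where
      r₀ : V → ℕ
      r₀ = constantOn (∅ {n G}) K
      N-empty : ∀ {C} → Component 𝕍 C → N C ≡ ∅
      N-empty c = ⊆-antisym (λ m → let (y∉ , d , d∈ , a) = N⁻ m in ⊥-elim (y∉ (closed c d∈ a ∈⊤))) (λ m → ⊥-elim (∉⊥ m))
      R≤ : total (r₀) ≤ Rmax
      R≤ = ≤-trans (≤-reflexive (total-constantOn (∅ {n G}) K)) (*-monoʳ-≤ K (≤-trans (≤-reflexive (∣⊥∣≡0 (n G))) z≤n))

-- Depth-first enumeration of the decomposition.

δ : ℕ → ℕ → ℕ
δ e e' with e ≟ e'
... | yes _ = 1
... | no _ = 0

δ≤1 : ∀ e e' → δ e e' ≤ 1
δ≤1 e e' with e ≟ e'
... | yes _ = s≤s z≤n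
... | no _ = z≤n

δ-≢ : ∀ {e e'} → e ≢ e' → δ e e' ≡ 0
δ-≢ {e} {e'} ne with e ≟ e'
... | yes q = ⊥-elim (ne q)
... | no _ = refl

δ-refl : ∀ e → δ e e ≡ 1
δ-refl e with e ≟ e
... | yes _ = refl
... | no ne = ⊥-elim (ne refl)

Active : Set
Active = List (ℕ × ℕ)

count : ℕ → Active → ℕ
count e []ᴸ = 0
count e ((_ , e') ∷ᴸ xs) = δ e e' + count e xs

-- The nodes 0, ..., m of a rooted tree in depth-first preorder.  active t lists, with their epochs, the nodes forming the
-- t-th bag of a path decomposition of the tree; U is the set of vertices covered so far.
module Runs (G : Graph) (Λ β : ℕ) where
  open Connectivity G
  open Decompositions G Λ β

  record Node : Set where
    field
      par ep : ℕ
      bg : VS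
      active : Active
  open Node

  record Run : Set where
    field
      m : ℕ
      nd : ℕ → Node
      lay : V → ℕ
      U : VS
      par< : ∀ t → 1 ≤ t → t ≤ m → par (nd t) < t
      self : ∀ t → t ≤ m → (t , ep (nd t)) ∈ᴸ active (nd t)
      parent : ∀ t → 1 ≤ t → t ≤ m → (par (nd t) , ep (nd (par (nd t)))) ∈ᴸ active (nd t)
      active≤ : ∀ t a → t ≤ m → a ∈ᴸ active (nd t) → proj₁ a ≤ t × proj₂ a ≡ ep (nd (proj₁ a))
      -- A node that has been dropped never returns, so the times at which a node is active form an
      -- interval that starts at the node itself.
      active-pred : ∀ t a → suc t ≤ m → a ∈ᴸ active (nd (suc t)) → proj₁ a ≢ suc t → a ∈ᴸ active (nd t)
      bg-small : ∀ t → t ≤ m → ∣ bg (nd t) ∣ ≤ β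
      bg⊆U : ∀ t → t ≤ m → bg (nd t) ⊆ U
      U-covered : ∀ {v} → v ∈ U → ∃[ t ] (t ≤ m × v ∈ bg (nd t))
      inherit : ∀ t {v} → 1 ≤ t → t ≤ m → v ∈ bg (nd t) → v ∈ bg (nd (par (nd t))) ⊎ (∀ s → s < t → v ∉ bg (nd s))
      edge-covered : ∀ {u v} → u ∈ U → v ∈ U → Adj G u v → ∃[ t ] (t ≤ m × u ∈ bg (nd t) × v ∈ bg (nd t))
      lay-ep : ∀ t {v} → t ≤ m → v ∈ bg (nd t) → lay v ≡ ep (nd t) ⊎ suc (lay v) ≡ ep (nd t)
      few : ∀ t e → t ≤ m → count e (active (nd t)) ≤ Λ + 2

  record _⊑_ (S S' : Run) : Set where
    private
      module S = Run S
      module S' = Run S'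
    field
      m≤ : S.m ≤ S'.m
      nd≡ : ∀ t → t ≤ S.m → S'.nd t ≡ S.nd t
      lay≡ : ∀ {v} → v ∈ S.U → S'.lay v ≡ S.lay v
  open _⊑_

  ⊑-trans : ∀ {S S' S''} → S ⊑ S' → Run.U S ⊆ Run.U S' → S' ⊑ S'' → S ⊑ S''
  ⊑-trans a u b = record
    { m≤ = ≤-trans (m≤ a) (m≤ b)
    ; nd≡ = λ t l → trans (nd≡ b t (≤-trans l (m≤ a))) (nd≡ a t l)
    ; lay≡ = λ v → trans (lay≡ b (u v)) (lay≡ a v) }

  root : Run
  root = record
    { m = 0 ; nd = λ _ → r ; lay = λ _ → 0 ; U = ∅
    ; par< = λ t a b → ⊥-elim (<⇒≱ a b)
    ; self = λ { zero _ → ahere refl }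
    ; parent = λ t a b → ⊥-elim (<⇒≱ a b)
    ; active≤ = λ { zero a _ (ahere refl) → z≤n , refl }
    ; active-pred = λ _ _ ()
    ; bg-small = λ _ _ → ≤-trans (≤-reflexive (∣⊥∣≡0 (n G))) z≤n
    ; bg⊆U = λ _ _ m → m
    ; U-covered = λ m → ⊥-elim (∉⊥ m)
    ; inherit = λ t a b → ⊥-elim (<⇒≱ a b)
    ; edge-covered = λ m → ⊥-elim (∉⊥ m)
    ; lay-ep = λ _ _ m → ⊥-elim (∉⊥ m)
    ; few = λ _ e _ → ≤-trans (≤-reflexive (+-identityʳ (δ e 0))) (≤-trans (δ≤1 e 0) (≤-trans (s≤s z≤n) (m≤n+m 2 Λ))) }
    where
    r : Node
    r = record { par = 0 ; ep = 0 ; bg = ∅ ; active = (0 , 0) ∷ᴸ []ᴸ }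

  module Push (S : Run) (p e : ℕ) (τ : Active) (b : VS) (p≤m : p ≤ Run.m S)
    (p∈τ : (p , ep (Run.nd S p)) ∈ᴸ τ) (τ⊆ : ∀ {a} → a ∈ᴸ τ → a ∈ᴸ active (Run.nd S (Run.m S))) (b-small : ∣ b ∣ ≤ β)
    (b∩U : ∀ {v} → v ∈ b → v ∈ Run.U S → v ∈ bg (Run.nd S p))
    (b-edges : ∀ {u v} → u ∈ b → u ∉ Run.U S → v ∈ Run.U S → Adj G u v → v ∈ b)
    (b-lay : ∀ {v} → v ∈ b → v ∈ Run.U S → Run.lay S v ≡ e ⊎ suc (Run.lay S v) ≡ e)
    (b-few : ∀ e' → δ e' e + count e' τ ≤ Λ + 2) where
    open Run S

    new : Node
    new = record { par = p ; ep = e ; bg = b ; active = (suc m , e) ∷ᴸ τ }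

    nd' : ℕ → Node
    nd' = nd [ suc m ↦ new ]

    nd'-new : nd' (suc m) ≡ new
    nd'-new with suc m ≟ suc m
    ... | yes _ = refl
    ... | no ne = ⊥-elim (ne refl)

    nd'-old : ∀ t → t ≤ m → nd' t ≡ nd t
    nd'-old t l with t ≟ suc m
    ... | yes refl = ⊥-elim (<-irrefl refl l)
    ... | no _ = refl

    lay' : V → ℕ
    lay' v with v ∈? U
    ... | yes _ = lay v
    ... | no _ = e

    lay'-old : ∀ {v} → v ∈ U → lay' v ≡ lay v
    lay'-old {v} m with v ∈? U
    ... | yes _ = refl
    ... | no no-U = ⊥-elim (no-U m)

    lay'-new : ∀ {v} → v ∉ U → lay' v ≡ e
    lay'-new {v} m with v ∈? U
    ... | yes v∈ = ⊥-elim (m v∈)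
    ... | no _ = refl

    data Age (t : ℕ) : Set where
      aged : t ≤ m → nd' t ≡ nd t → Age t
      fresh : t ≡ suc m → nd' t ≡ new → Age t

    age : ∀ t → t ≤ suc m → Age t
    age t l with t ≟ suc m
    ... | yes refl = fresh refl nd'-new
    ... | no ne = aged (≤-pred (≤∧≢⇒< l ne)) (nd'-old t (≤-pred (≤∧≢⇒< l ne)))

    pushed : Run
    pushed = record
      { m = suc m ; nd = nd' ; lay = lay' ; U = U ∪ b
      ; par< = par<' ; self = self' ; parent = parent' ; active≤ = active≤' ; active-pred = active-pred'
      ; bg-small = bg-small' ; bg⊆U = bg⊆U' ; U-covered = U-covered' ; inherit = inherit' ; edge-covered = edge-covered'
      ; lay-ep = lay-ep' ; few = few' }
      where
      par<' : ∀ t → 1 ≤ t → t ≤ suc m → par (nd' t) < t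
      par<' t l1 l with age t l
      ... | aged le q rewrite q = par< t l1 le
      ... | fresh refl q rewrite q = s≤s p≤m
      self' : ∀ t → t ≤ suc m → (t , ep (nd' t)) ∈ᴸ active (nd' t)
      self' t l with age t l
      ... | aged le q rewrite q = self t le
      ... | fresh refl q rewrite q = ahere refl
      parent' : ∀ t → 1 ≤ t → t ≤ suc m → (par (nd' t) , ep (nd' (par (nd' t)))) ∈ᴸ active (nd' t)
      parent' t l1 l with age t l
      ... | aged le q rewrite q | nd'-old (par (nd t)) (≤-trans (<⇒≤ (par< t l1 le)) le) = parent t l1 le
      ... | fresh refl q rewrite q | nd'-old p p≤m = athere p∈τ
      active≤' : ∀ t a → t ≤ suc m → a ∈ᴸ active (nd' t) → proj₁ a ≤ t × proj₂ a ≡ ep (nd' (proj₁ a))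
      active≤' t a l a∈ with age t l
      ... | aged le q rewrite q = let (x , y) = active≤ t a le a∈ in x , trans y (cong ep (sym (nd'-old _ (≤-trans x le))))
      active≤' t a l a∈ | fresh refl q rewrite q with a∈
      ...   | ahere refl = ≤-refl , cong ep (sym nd'-new)
      ...   | athere a∈τ = let (x , y) = active≤ m a ≤-refl (τ⊆ a∈τ) in m≤n⇒m≤1+n x , trans y (cong ep (sym (nd'-old _ x)))
      active-pred' : ∀ t a → suc t ≤ suc m → a ∈ᴸ active (nd' (suc t)) → proj₁ a ≢ suc t → a ∈ᴸ active (nd' t)
      active-pred' t a l a∈ ne with age (suc t) l
      ... | aged le q rewrite q | nd'-old t (<⇒≤ le) = active-pred t a le a∈ ne
      active-pred' t a l a∈ ne | fresh refl q rewrite q | nd'-old m ≤-refl with a∈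
      ...   | ahere refl = ⊥-elim (ne refl)
      ...   | athere a∈τ = τ⊆ a∈τ
      bg-small' : ∀ t → t ≤ suc m → ∣ bg (nd' t) ∣ ≤ β
      bg-small' t l with age t l
      ... | aged le q rewrite q = bg-small t le
      ... | fresh refl q rewrite q = b-small
      bg⊆U' : ∀ t → t ≤ suc m → bg (nd' t) ⊆ U ∪ b
      bg⊆U' t l {v} v∈ with age t l
      ... | aged le q rewrite q = ∪ˡ (bg⊆U t le v∈)
      ... | fresh refl q rewrite q = ∪ʳ v∈
      old-bag : ∀ {t v} → t ≤ m → v ∈ bg (nd t) → v ∈ bg (nd' t)
      old-bag {t} l v∈ rewrite nd'-old t l = v∈
      new-bag : ∀ {v} → v ∈ b → v ∈ bg (nd' (suc m))
      new-bag v∈ rewrite nd'-new = v∈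
      U-covered' : ∀ {v} → v ∈ U ∪ b → ∃[ t ] (t ≤ suc m × v ∈ bg (nd' t))
      U-covered' v∈ with ∪⁻ v∈
      ... | inj₂ v∈b = suc m , ≤-refl , new-bag v∈b
      ... | inj₁ v∈U with U-covered v∈U
      ...   | t , l , m' = t , m≤n⇒m≤1+n l , old-bag l m'
      inherit' : ∀ t {v} → 1 ≤ t → t ≤ suc m → v ∈ bg (nd' t) → v ∈ bg (nd' (par (nd' t))) ⊎ (∀ s → s < t → v ∉ bg (nd' s))
      inherit' t {v} l1 l v∈ with age t l
      ... | aged le q rewrite q | nd'-old (par (nd t)) (≤-trans (<⇒≤ (par< t l1 le)) le) with inherit t l1 le v∈
      ...   | inj₁ x = inj₁ x
      ...   | inj₂ y = inj₂ (λ s lt v∈' → y s lt (subst (λ z → v ∈ bg z) (nd'-old s (≤-trans (<⇒≤ lt) le)) v∈'))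
      inherit' t {v} l1 l v∈ | fresh refl q rewrite q | nd'-old p p≤m with v ∈? U
      ...   | yes v∈U = inj₁ (b∩U v∈ v∈U)
      ...   | no v∉U = inj₂ (λ s lt v∈' → v∉U (bg⊆U s (≤-pred lt) (subst (λ z → v ∈ bg z) (nd'-old s (≤-pred lt)) v∈')))
      edge-covered' : ∀ {u v} → u ∈ U ∪ b → v ∈ U ∪ b → Adj G u v → ∃[ t ] (t ≤ suc m × u ∈ bg (nd' t) × v ∈ bg (nd' t))
      edge-covered' {u} {v} u∈ v∈ a with u ∈? U | v ∈? U
      ... | yes u∈U | yes v∈U with edge-covered u∈U v∈U a
      ...   | t , l , x , y = t , m≤n⇒m≤1+n l , old-bag l x , old-bag l y
      edge-covered' {u} {v} u∈ v∈ a | yes u∈U | no v∉U = suc m , ≤-refl , new-bag (b-edges v∈b v∉U u∈U (adj-sym a)) , new-bag v∈b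
        where
        v∈b : v ∈ b
        v∈b = [ (λ x → ⊥-elim (v∉U x)) , id ]′ (∪⁻ v∈)
      edge-covered' {u} {v} u∈ v∈ a | no u∉U | yes v∈U = suc m , ≤-refl , new-bag u∈b , new-bag (b-edges u∈b u∉U v∈U a)
        where
        u∈b : u ∈ b
        u∈b = [ (λ x → ⊥-elim (u∉U x)) , id ]′ (∪⁻ u∈)
      edge-covered' {u} {v} u∈ v∈ a | no u∉U | no v∉U = suc m , ≤-refl ,
        new-bag ([ (λ x → ⊥-elim (u∉U x)) , id ]′ (∪⁻ u∈)) , new-bag ([ (λ x → ⊥-elim (v∉U x)) , id ]′ (∪⁻ v∈))
      lay-ep' : ∀ t {v} → t ≤ suc m → v ∈ bg (nd' t) → lay' v ≡ ep (nd' t) ⊎ suc (lay' v) ≡ ep (nd' t)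
      lay-ep' t {v} l v∈ with age t l
      ... | aged le q rewrite q | lay'-old (bg⊆U t le v∈) = lay-ep t le v∈
      lay-ep' t {v} l v∈ | fresh refl q rewrite q = case v ∈? U of λ
        { (yes v∈U) → subst (λ z → z ≡ e ⊎ suc z ≡ e) (sym (lay'-old v∈U)) (b-lay v∈ v∈U)
        ; (no v∉U) → inj₁ (lay'-new v∉U) }
      few' : ∀ t e' → t ≤ suc m → count e' (active (nd' t)) ≤ Λ + 2
      few' t e' l with age t l
      ... | aged le q rewrite q = few t e' le
      ... | fresh refl q rewrite q = b-few e'

    ⊑-pushed : S ⊑ pushed
    ⊑-pushed = record { m≤ = n≤1+n m ; nd≡ = nd'-old ; lay≡ = lay'-old }

module Interpret (G : Graph) (Λ β : ℕ) where
  open Connectivity G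
  open Decompositions G Λ β
  open Runs G Λ β
  open Node
  open _⊑_

  -- The forest over `W` is about to be hung below the node `p`. The list `σ` holds the nodes above
  -- that still await children and have to stay active throughout.
  record Context (S : Run) (e ℓ : ℕ) (Old W : VS) (p : ℕ) (σ : Active) : Set where
    open Run S
    field
      p≤m : p ≤ m
      ep-p : ep (nd p) ≡ e
      available : ∀ {a} → a ∈ᴸ (p , e) ∷ᴸ σ → a ∈ᴸ active (nd m)
      W#U : W # U
      Old⊆U : Old ⊆ U
      boundary : ∀ {x y} → x ∈ W → Adj G x y → y ∉ W → y ∈ bg (nd p)
      old-lay : ∀ {v} → v ∈ bg (nd p) → v ∈ Old → suc (lay v) ≡ e
      new-lay : ∀ {v} → v ∈ bg (nd p) → v ∉ Old → lay v ≡ e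
      -- Besides the waiting nodes of epoch `e` there must be space for `ℓ` further ones, for `p`,
      -- and for a child of `p`; hence the 2.
      room : count e σ + (ℓ + 2) ≤ Λ + 2
      few-σ : ∀ e' → count e' σ ≤ Λ + 2
      no-later : ∀ e' → e < e' → count e' σ ≡ 0

  record Result (S : Run) (W : VS) (σ : Active) : Set where
    field
      S' : Run
      extends : S ⊑ S'
      U⊆ : Run.U S ⊆ Run.U S'
      W⊆ : W ⊆ Run.U S'
      ⊆UW : Run.U S' ⊆ Run.U S ∪ W
      still : ∀ {a} → a ∈ᴸ σ → a ∈ᴸ active (Run.nd S' (Run.m S'))

  -- σ' is what stays active below the child.
  record KindFacts (S : Run) (e : ℕ) (p : ℕ) (σ : Active) (C B : VS) (e' ℓ' : ℕ) (Old' : VS) (σ' : Active) : Set where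
    open Run S
    field
      inherited-lay : ∀ {v} → v ∈ N C → v ∈ bg (nd p) → lay v ≡ e' ⊎ suc (lay v) ≡ e'
      node-few : ∀ e'' → δ e'' e' + count e'' ((p , e) ∷ᴸ σ) ≤ Λ + 2
      σ'⊆ : ∀ {a} → a ∈ᴸ σ' → a ∈ᴸ (p , e) ∷ᴸ σ
      Old'⊆U : N C ⊆ bg (nd p) → Old' ⊆ U
      old-lay' : ∀ {v} → v ∈ N C → v ∈ bg (nd p) → v ∈ Old' → suc (lay v) ≡ e'
      new-lay' : ∀ {v} → v ∈ N C → v ∈ bg (nd p) → v ∉ Old' → lay v ≡ e'
      room' : count e' σ' + (ℓ' + 2) ≤ Λ + 2
      few' : ∀ e'' → count e'' σ' ≤ Λ + 2
      no-later' : ∀ e'' → e' < e'' → count e'' σ' ≡ 0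

  module _ {S e ℓ Old W p σ} (ctx : Context S e ℓ Old W p σ) {C B : VS} where
    open Run S
    open Context ctx

    private
      suc-room : ∀ {ℓ'} → ℓ' < ℓ → suc (count e σ) + (ℓ' + 2) ≤ Λ + 2
      suc-room {ℓ'} lt = ≤-trans (≤-reflexive (sym (+-suc (count e σ) (ℓ' + 2)))) (≤-trans (+-monoʳ-≤ (count e σ) (+-monoˡ-≤ 2 lt)) room)

      two : suc (suc (count e σ)) ≤ Λ + 2
      two = ≤-trans (≤-reflexive (+-comm 2 (count e σ))) (≤-trans (+-monoʳ-≤ (count e σ) (m≤n+m 2 ℓ)) room)

      inherit-same : ∀ {v} → v ∈ N C → v ∈ bg (nd p) → lay v ≡ e ⊎ suc (lay v) ≡ e
      inherit-same {v} _ v∈ with v ∈? Old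
      ... | yes o = inj₂ (old-lay v∈ o)
      ... | no o = inj₁ (new-lay v∈ o)

      few-with-p : ∀ e'' → δ e'' e + count e'' σ ≤ Λ + 2
      few-with-p e'' with e'' ≟ e
      ... | yes refl = ≤-trans (n≤1+n _) two
      ... | no _ = few-σ e''

      few-same : ∀ e'' → δ e'' e + (δ e'' e + count e'' σ) ≤ Λ + 2
      few-same e'' with e'' ≟ e
      ... | yes refl = two
      ... | no _ = few-σ e''

      later-with-p : ∀ e'' → e < e'' → δ e'' e + count e'' σ ≡ 0
      later-with-p e'' lt = trans (cong (_+ count e'' σ) (δ-≢ (λ q → <⇒≢ lt (sym q)))) (no-later e'' lt)

    facts-side : ∀ {ℓ'} → ℓ' < ℓ → KindFacts S e p σ C B e ℓ' Old ((p , e) ∷ᴸ σ)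
    facts-side {ℓ'} lt = record
      { inherited-lay = inherit-same ; node-few = few-same ; σ'⊆ = id ; Old'⊆U = λ _ → Old⊆U
      ; old-lay' = λ _ → old-lay ; new-lay' = λ _ → new-lay
      ; room' = subst (λ z → z + count e σ + (ℓ' + 2) ≤ Λ + 2) (sym (δ-refl e)) (suc-room lt)
      ; few' = few-with-p ; no-later' = later-with-p }

    -- No sibling follows, so `p` is dropped from the list. The room is preserved without a loss of
    -- level, and a sweep may take any number of steps.
    facts-last : ∀ {ℓ'} → ℓ' ≤ ℓ → KindFacts S e p σ C B e ℓ' Old σ
    facts-last {ℓ'} le = record
      { inherited-lay = inherit-same ; node-few = few-same ; σ'⊆ = athere ; Old'⊆U = λ _ → Old⊆U
      ; old-lay' = λ _ → old-lay ; new-lay' = λ _ → new-lay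
      ; room' = ≤-trans (+-monoʳ-≤ (count e σ) (+-monoˡ-≤ 2 le)) room ; few' = few-σ ; no-later' = no-later }

    -- No waiting node has a later epoch, so the new epoch begins with the full room `Λ`. The
    -- boundary avoids `Old`, so its vertices have layer `e` and become the old ones of epoch
    -- `e + 1`.
    facts-epoch : ∀ {ℓ'} → ℓ' ≤ Λ → N C # Old → KindFacts S e p σ C B (suc e) ℓ' (N C) ((p , e) ∷ᴸ σ)
    facts-epoch {ℓ'} le d = record
      { inherited-lay = λ a b → inj₂ (cong suc (new-lay b (d a)))
      ; node-few = node-few ; σ'⊆ = id ; Old'⊆U = λ f m → bg⊆U p p≤m (f m)
      ; old-lay' = λ a b _ → cong suc (new-lay b (d a))
      ; new-lay' = λ a _ na → ⊥-elim (na a)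
      ; room' = ≤-trans (≤-reflexive (cong (_+ (ℓ' + 2)) (later-with-p (suc e) ≤-refl))) (+-monoˡ-≤ 2 le)
      ; few' = few-with-p ; no-later' = λ e'' lt → later-with-p e'' (<⇒≤ lt) }
      where
      node-few : ∀ e'' → δ e'' (suc e) + (δ e'' e + count e'' σ) ≤ Λ + 2
      node-few e'' with e'' ≟ suc e
      ... | no _ = few-with-p e''
      ... | yes refl = ≤-trans (≤-reflexive (cong suc (later-with-p (suc e) ≤-refl))) (≤-trans (s≤s z≤n) (m≤n+m 2 Λ))

    module Place (C⊆W : C ⊆ W) (closedC : ∀ {x y} → x ∈ C → Adj G x y → y ∈ W → y ∈ C) (B⊆C : B ⊆ C) (bag≤ : ∣ N C ∪ B ∣ ≤ β)
      {e' ℓ' : ℕ} {Old' : VS} {σ' : Active} (facts : KindFacts S e p σ C B e' ℓ' Old' σ') where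
      open KindFacts facts

      b : VS
      b = N C ∪ B

      NC⊆p : N C ⊆ bg (nd p)
      NC⊆p m = let (y∉ , d , d∈ , a) = N⁻ m in boundary (C⊆W d∈) a (λ y∈W → y∉ (closedC d∈ a y∈W))

      C#U : C # U
      C#U m = W#U (C⊆W m)

      NC⊆U : N C ⊆ U
      NC⊆U m = bg⊆U p p≤m (NC⊆p m)

      in-N : ∀ {v} → v ∈ b → v ∈ U → v ∈ N C
      in-N m u = [ id , (λ q → ⊥-elim (C#U (B⊆C q) u)) ]′ (∪⁻ m)

      in-B : ∀ {v} → v ∈ b → v ∉ U → v ∈ B
      in-B m u = [ (λ q → ⊥-elim (u (NC⊆U q))) , id ]′ (∪⁻ m)

      module Pu = Push S p e' ((p , e) ∷ᴸ σ) b p≤m (ahere (cong (p ,_) ep-p)) available bag≤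
        (λ m u → NC⊆p (in-N m u))
        (λ m u∉ v∈ a → ∪ˡ (N⁺ (λ c → C#U c v∈) (B⊆C (in-B m u∉)) a))
        (λ m u → inherited-lay (in-N m u) (NC⊆p (in-N m u))) node-few

      new-at : ∀ {A : Set} (f : Node → A) → f (Pu.nd' (suc m)) ≡ f Pu.new
      new-at f = cong f Pu.nd'-new

      bag⁻ : ∀ {v} → v ∈ bg (Pu.nd' (suc m)) → v ∈ b
      bag⁻ {v} = subst (v ∈_) (new-at bg)

      child-context : Context Pu.pushed e' ℓ' Old' (C ─ B) (suc m) σ'
      child-context = record
        { p≤m = ≤-refl
        ; ep-p = new-at ep
        ; available = λ {a} a∈ → subst (a ∈ᴸ_) (sym (new-at active)) (keep a∈)
        ; W#U = λ m u → let (c , nb) = ─⁻ _ _ m in [ C#U c , (λ q → [ (λ r → proj₁ (N⁻ r) c) , nb ]′ (∪⁻ q)) ]′ (∪⁻ u)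
        ; Old⊆U = λ m → ∪ˡ (Old'⊆U NC⊆p m)
        ; boundary = λ {x} {y} x∈ a y∉ → subst (y ∈_) (sym (new-at bg)) (case y ∈? C of λ
            { (yes c) → ∪ʳ (case y ∈? B of λ { (yes q) → q ; (no q) → ⊥-elim (y∉ (─⁺ c q)) })
            ; (no c) → ∪ˡ (N⁺ c (proj₁ (─⁻ _ _ x∈)) a) })
        ; old-lay = λ {v} m o → let u = Old'⊆U NC⊆p o ; nc = in-N (bag⁻ m) u in
            trans (cong suc (Pu.lay'-old u)) (old-lay' nc (NC⊆p nc) o)
        ; new-lay = λ {v} m o → case v ∈? U of λ
            { (yes u) → let nc = in-N (bag⁻ m) u in trans (Pu.lay'-old u) (new-lay' nc (NC⊆p nc) o)
            ; (no u) → Pu.lay'-new u }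
        ; room = room' ; few-σ = few' ; no-later = no-later' }
        where
        keep : ∀ {a} → a ∈ᴸ (suc m , e') ∷ᴸ σ' → a ∈ᴸ (suc m , e') ∷ᴸ ((p , e) ∷ᴸ σ)
        keep (ahere q) = ahere q
        keep (athere q) = athere (σ'⊆ q)

      module After (r : Result Pu.pushed (C ─ B) σ') where
        open Result r
        module S'' = Run S'

        S⊑S' : S ⊑ S'
        S⊑S' = ⊑-trans Pu.⊑-pushed ∪ˡ extends

        U⊆S' : U ⊆ S''.U
        U⊆S' m = U⊆ (∪ˡ m)

        C⊆S' : C ⊆ S''.U
        C⊆S' {x} m with x ∈? B
        ... | yes q = U⊆ (∪ʳ (∪ʳ q))
        ... | no q = W⊆ (─⁺ m q)

        S'⊆ : S''.U ⊆ U ∪ C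
        S'⊆ m with ∪⁻ (⊆UW m)
        ... | inj₂ q = ∪ʳ (proj₁ (─⁻ _ _ q))
        ... | inj₁ q with ∪⁻ q
        ...   | inj₁ u = ∪ˡ u
        ...   | inj₂ v = [ (λ z → ∪ˡ (NC⊆U z)) , (λ z → ∪ʳ (B⊆C z)) ]′ (∪⁻ v)

        finish : W ⊆ C → (∀ {a} → a ∈ᴸ σ → a ∈ᴸ σ') → Result S W σ
        finish W⊆C f = record
          { S' = S' ; extends = S⊑S' ; U⊆ = U⊆S' ; W⊆ = λ m → C⊆S' (W⊆C m)
          ; ⊆UW = λ m → [ ∪ˡ , (λ c → ∪ʳ (C⊆W c)) ]′ (∪⁻ (S'⊆ m)) ; still = λ a → still (f a) }

        sibling-context : (∀ {a} → a ∈ᴸ (p , e) ∷ᴸ σ → a ∈ᴸ σ') → Context S' e ℓ Old (W ─ C) p σ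
        sibling-context f = record
          { p≤m = ≤-trans p≤m (m≤ S⊑S')
          ; ep-p = trans (cong ep p-eq) ep-p
          ; available = λ a → still (f a)
          ; W#U = λ m u → let (w , nc) = ─⁻ _ _ m in [ W#U w , nc ]′ (∪⁻ (S'⊆ u))
          ; Old⊆U = λ m → U⊆S' (Old⊆U m)
          ; boundary = λ {x} {y} x∈ a y∉ → subst (y ∈_) (sym (cong bg p-eq)) (boundary (proj₁ (─⁻ _ _ x∈)) a (λ y∈W →
              case y ∈? C of λ { (yes c) → proj₂ (─⁻ _ _ x∈) (closedC c (adj-sym a) (proj₁ (─⁻ _ _ x∈)))
                               ; (no c) → y∉ (─⁺ y∈W c) }))
          ; old-lay = λ m o → let m' = p-bag m in trans (cong suc (lay≡ S⊑S' (bg⊆U p p≤m m'))) (old-lay m' o)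
          ; new-lay = λ m o → let m' = p-bag m in trans (lay≡ S⊑S' (bg⊆U p p≤m m')) (new-lay m' o)
          ; room = room ; few-σ = few-σ ; no-later = no-later }
          where
          p-eq : S''.nd p ≡ nd p
          p-eq = nd≡ S⊑S' p p≤m
          p-bag : ∀ {v} → v ∈ bg (S''.nd p) → v ∈ bg (nd p)
          p-bag {v} = subst (v ∈_) (cong bg p-eq)

        continue : Result S' (W ─ C) σ → Result S W σ
        continue r' = record
          { S' = R.S' ; extends = ⊑-trans S⊑S' U⊆S' R.extends ; U⊆ = λ m → R.U⊆ (U⊆S' m)
          ; W⊆ = λ {x} m → case x ∈? C of λ { (yes c) → R.U⊆ (C⊆S' c) ; (no c) → R.W⊆ (─⁺ m c) }
          ; ⊆UW = λ m → [ (λ u → [ ∪ˡ , (λ c → ∪ʳ (C⊆W c)) ]′ (∪⁻ (S'⊆ u))) , (λ q → ∪ʳ (proj₁ (─⁻ _ _ q))) ]′ (∪⁻ (R.⊆UW m))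
          ; still = R.still }
          where module R = Result r'

  interpret : ∀ {e ℓ Old W} → Forest e ℓ Old W → ∀ {S p σ} → Context S e ℓ Old W p σ → Result S W σ
  interpret (leaf empty) {S} ctx = record
    { S' = S ; extends = record { m≤ = ≤-refl ; nd≡ = λ _ _ → refl ; lay≡ = λ _ → refl }
    ; U⊆ = id ; W⊆ = λ m → ⊥-elim (empty m) ; ⊆UW = ∪ˡ ; still = λ a → Context.available ctx (athere a) }
  interpret (node C B C⊆W cl B⊆C b (side lt) f rest) {S} ctx = A.continue (interpret rest (A.sibling-context id))
    where
    module P = Place ctx C⊆W cl B⊆C b (facts-side ctx lt)
    module A = P.After (interpret f P.child-context)
  interpret (node C B C⊆W cl B⊆C b (epoch le d) f rest) {S} ctx = A.continue (interpret rest (A.sibling-context id))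
    where
    module P = Place ctx C⊆W cl B⊆C b (facts-epoch ctx le d)
    module A = P.After (interpret f P.child-context)
  interpret (node C B C⊆W cl B⊆C b (last le W⊆C) f rest) {S} ctx = A.finish W⊆C id
    where
    module P = Place ctx C⊆W cl B⊆C b (facts-last ctx le)
    module A = P.After (interpret f P.child-context)

  full-run : Forest 0 0 ∅ 𝕍 → Σ Run λ S → ∀ v → v ∈ Run.U S
  full-run f = R.S' , λ v → R.W⊆ ∈⊤
    where
    context : Context root 0 0 ∅ 𝕍 0 []ᴸ
    context = record
      { p≤m = z≤n ; ep-p = refl ; available = id ; W#U = λ _ m → ∉⊥ m ; Old⊆U = id
      ; boundary = λ _ _ q → ⊥-elim (q ∈⊤)
      ; old-lay = λ m _ → ⊥-elim (∉⊥ m) ; new-lay = λ m _ → ⊥-elim (∉⊥ m)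
      ; room = m≤n+m 2 Λ ; few-σ = λ _ → z≤n ; no-later = λ _ _ → refl }
    module R = Result (interpret f context)

-- Reading off the good tree decomposition and the layered path decomposition.

≡ᵇ-refl : ∀ k → (k ≡ᵇ k) ≡ true
≡ᵇ-refl zero = refl
≡ᵇ-refl (suc k) = ≡ᵇ-refl k

≡ᵇ-sound : ∀ k l → (k ≡ᵇ l) ≡ true → k ≡ l
≡ᵇ-sound zero zero _ = refl
≡ᵇ-sound (suc k) (suc l) e = cong suc (≡ᵇ-sound k l e)

path-step : ∀ {k} {i j : Fin k} → toℕ j ≡ suc (toℕ i) → Adj (PathGraph k) i j
path-step {i = i} {j} e = (λ { refl → m≢1+m+n (toℕ i) (trans e (cong suc (sym (+-identityʳ (toℕ i))))) }) ,
  inj₁ (subst (λ z → (z ≡ᵇ suc (toℕ i)) ≡ true) (sym e) (≡ᵇ-refl (toℕ i)))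

path-down : ∀ {k} {S : Fin (suc k) → Set} (i a : Fin (suc k)) → toℕ a ≤ toℕ i →
  (∀ j → toℕ a ≤ toℕ j → toℕ j ≤ toℕ i → S j) → Conn (PathGraph (suc k)) S i a
path-down {k} {S} i a le all = go (toℕ i) i refl le all
  where
  go : ∀ t (i : Fin (suc k)) → toℕ i ≡ t → toℕ a ≤ toℕ i → (∀ j → toℕ a ≤ toℕ j → toℕ j ≤ toℕ i → S j) → Conn (PathGraph (suc k)) S i a
  go t i e le all with a ≟F i
  ... | yes refl = here (all i ≤-refl ≤-refl)
  go zero i e le all | no ne = ⊥-elim (ne (toℕ-injective (≤-antisym le (≤-trans (≤-reflexive e) z≤n))))
  go (suc t) i e le all | no ne = step (all i le ≤-refl) (Connectivity.adj-sym (PathGraph (suc k)) (path-step {i = i'} {i} (trans e (cong suc (sym i'≡t)))))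
    (go t i' i'≡t a≤i' (λ j a≤j j≤i' → all j a≤j (≤-trans j≤i' i'≤i)))
    where
    t<k : t < suc k
    t<k = ≤-trans (≤-reflexive (sym e)) (<⇒≤ (toℕ<n i))
    i' : Fin (suc k)
    i' = fromℕ< t<k
    i'≡t : toℕ i' ≡ t
    i'≡t = toℕ-fromℕ< t<k
    i'≤i : toℕ i' ≤ toℕ i
    i'≤i = ≤-trans (≤-reflexive i'≡t) (≤-trans (n≤1+n t) (≤-reflexive (sym e)))
    a≤i' : toℕ a ≤ toℕ i'
    a≤i' = ≤-trans (≤-pred (≤-trans (≤∧≢⇒< le (λ q → ne (toℕ-injective q))) (≤-reflexive e))) (≤-reflexive (sym i'≡t))

-- This serves both widths: with singletons for `F` it counts the active nodes that hold a vertex,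
-- with bags of `G` the vertices of one layer. Two epochs matter, because a vertex of layer `i`
-- occurs only in bags of epochs `i` and `i + 1`.
cover-bound : ∀ {k β} (xs : Active) (F : ℕ × ℕ → Subset k) i → (∀ x → x ∈ᴸ xs → ∣ F x ∣ ≤ β) → ∀ S →
  (∀ v → v ∈ S → ∃[ x ] (x ∈ᴸ xs × (proj₂ x ≡ i ⊎ proj₂ x ≡ suc i) × v ∈ F x)) → ∣ S ∣ ≤ (count i xs + count (suc i) xs) * β
cover-bound {k} []ᴸ F i small S cov = ≤-trans (card-mono {q = ∅} (λ {v} m → case cov v m of λ { (_ , () , _) })) (≤-reflexive (∣⊥∣≡0 k))
cover-bound {k} {β} (x@(_ , e) ∷ᴸ xs) F i small S cov = go (e ≟ i) (e ≟ suc i)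
  where
  d r : ℕ
  d = δ i e + δ (suc i) e
  r = count i xs + count (suc i) xs
  rearrange : (δ i e + count i xs) + (δ (suc i) e + count (suc i) xs) ≡ d + r
  rearrange = begin
    (δ i e + count i xs) + (δ (suc i) e + count (suc i) xs) ≡⟨ +-assoc (δ i e) (count i xs) _ ⟩
    δ i e + (count i xs + (δ (suc i) e + count (suc i) xs)) ≡⟨ cong (δ i e +_) (trans (sym (+-assoc (count i xs) (δ (suc i) e) _))
      (trans (cong (_+ count (suc i) xs) (+-comm (count i xs) (δ (suc i) e))) (+-assoc (δ (suc i) e) (count i xs) _))) ⟩
    δ i e + (δ (suc i) e + r) ≡⟨ sym (+-assoc (δ i e) (δ (suc i) e) r) ⟩
    d + r ∎
    where open ≡-Reasoning
  with-x : 1 ≤ d → ∣ S ∣ ≤ ((δ i e + count i xs) + (δ (suc i) e + count (suc i) xs)) * β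
  with-x d≥1 = ≤-trans (card-split S (F x)) (≤-trans (+-mono-≤
      (≤-trans (card-mono (λ m → proj₂ (∩⁻ m))) (≤-trans (small x (ahere refl)) (≤-trans (≤-reflexive (sym (*-identityˡ β))) (*-monoˡ-≤ β d≥1))))
      (cover-bound xs F i (λ y m → small y (athere m)) (S ─ F x) (λ v m → rest v (cov v (proj₁ (─⁻ _ _ m))) (proj₂ (─⁻ _ _ m)))))
      (≤-reflexive (trans (sym (*-distribʳ-+ β d r)) (cong (_* β) (sym rearrange)))))
    where
    rest : ∀ v → ∃[ y ] (y ∈ᴸ x ∷ᴸ xs × (proj₂ y ≡ i ⊎ proj₂ y ≡ suc i) × v ∈ F y) → v ∉ F x →
      ∃[ y ] (y ∈ᴸ xs × (proj₂ y ≡ i ⊎ proj₂ y ≡ suc i) × v ∈ F y)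
    rest v (_ , ahere refl , _ , v∈) v∉ = ⊥-elim (v∉ v∈)
    rest v (y , athere m , q , v∈) _ = y , m , q , v∈
  go : Dec (e ≡ i) → Dec (e ≡ suc i) → ∣ S ∣ ≤ ((δ i e + count i xs) + (δ (suc i) e + count (suc i) xs)) * β
  go (yes refl) _ = with-x (≤-trans (≤-reflexive (sym (δ-refl i))) (m≤m+n _ _))
  go (no _) (yes refl) = with-x (≤-trans (≤-reflexive (sym (δ-refl (suc i)))) (m≤n+m _ _))
  go (no n₁) (no n₂) = ≤-trans (cover-bound xs F i (λ y m → small y (athere m)) S (λ v m → skip (cov v m)))
    (*-monoˡ-≤ β (+-mono-≤ (m≤n+m (count i xs) (δ i e)) (m≤n+m (count (suc i) xs) (δ (suc i) e))))
    where
    skip : ∀ {v} → ∃[ y ] (y ∈ᴸ x ∷ᴸ xs × (proj₂ y ≡ i ⊎ proj₂ y ≡ suc i) × v ∈ F y) →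
      ∃[ y ] (y ∈ᴸ xs × (proj₂ y ≡ i ⊎ proj₂ y ≡ suc i) × v ∈ F y)
    skip (_ , ahere refl , q , _) = ⊥-elim ([ n₁ , n₂ ]′ q)
    skip (y , athere m , q , v∈) = y , m , q , v∈

module Extract (G : Graph) (Λ β : ℕ) (S : Runs.Run G Λ β) (all-covered : ∀ v → v ∈ Runs.Run.U S) where
  open Connectivity G
  open Runs G Λ β
  open Node
  open Run S

  Ix : Set
  Ix = Fin (suc m)

  parT : ℕ → ℕ
  -- The root is its own parent; the loop this puts into the table is discarded by `Adj`.
  parT zero = 0
  parT (suc t) = par (nd (suc t))

  T : Graph
  T = mkGraph (suc m) (λ i j → toℕ j ≡ᵇ parT (toℕ i))

  module T = Connectivity T

  ix≤ : (i : Ix) → toℕ i ≤ m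
  ix≤ i = ≤-pred (toℕ<n i)

  parT< : ∀ t → 1 ≤ t → t ≤ m → parT t < t
  parT< (suc t) l le = par< (suc t) l le

  parT≤ : ∀ t → t ≤ m → parT t ≤ t
  parT≤ zero _ = z≤n
  parT≤ (suc t) le = <⇒≤ (par< (suc t) (s≤s z≤n) le)

  parF : Ix → Ix
  parF i = fromℕ< (s≤s (≤-trans (parT≤ (toℕ i) (ix≤ i)) (ix≤ i)))

  toℕ-parF : ∀ i → toℕ (parF i) ≡ parT (toℕ i)
  toℕ-parF i = toℕ-fromℕ< (s≤s (≤-trans (parT≤ (toℕ i) (ix≤ i)) (ix≤ i)))

  par-adj : ∀ i → 1 ≤ toℕ i → Adj T i (parF i)
  par-adj i l = (λ e → <⇒≢ (parT< (toℕ i) l (ix≤ i)) (trans (sym (toℕ-parF i)) (cong toℕ (sym e)))) ,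
    inj₁ (subst (λ z → (z ≡ᵇ parT (toℕ i)) ≡ true) (sym (toℕ-parF i)) (≡ᵇ-refl (parT (toℕ i))))

  adj⇒par : ∀ {x y} → Adj T x y → toℕ y ≡ parT (toℕ x) ⊎ toℕ x ≡ parT (toℕ y)
  adj⇒par (_ , inj₁ e) = inj₁ (≡ᵇ-sound _ _ e)
  adj⇒par (_ , inj₂ e) = inj₂ (≡ᵇ-sound _ _ e)

  lower⇒par : ∀ {x y} → Adj T x y → toℕ y < toℕ x → toℕ y ≡ parT (toℕ x)
  lower⇒par {x} {y} a lt with adj⇒par a
  ... | inj₁ e = e
  ... | inj₂ e = ⊥-elim (<⇒≱ lt (≤-trans (≤-reflexive e) (parT≤ (toℕ y) (ix≤ y))))

  T-forest : IsForest T
  T-forest = Forests.lower-unique⇒forest T (full T) toℕ (λ _ _ a e → proj₁ a (toℕ-injective e))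
    (λ _ _ _ a b la lb → toℕ-injective (trans (lower⇒par a la) (sym (lower⇒par b lb))))

  T-root : ∀ t (i : Ix) → toℕ i ≤ t → Conn T (full T) i fz
  T-root t fz _ = here tt
  T-root zero (fs i) ()
  T-root (suc t) (fs i) le = step tt (par-adj (fs i) (s≤s z≤n)) (T-root t (parF (fs i))
    (≤-pred (≤-trans (≤-trans (s≤s (≤-reflexive (toℕ-parF (fs i)))) (parT< (suc (toℕ i)) (s≤s z≤n) (ix≤ (fs i)))) le)))

  T-tree : IsTree T
  T-tree = fz , (λ x y → T.conn-trans (T-root (toℕ x) x ≤-refl) (T.conn-sym (T-root (toℕ y) y ≤-refl))) , T-forest

  bagF : Ix → VS
  bagF i = bg (nd (toℕ i))

  -- Each node containing `v` leads, through parents containing `v`, to the first such node. The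
  -- graph is a parameter, because the argument is used in the tree and also in the path that
  -- carries the merged bags.
  module First (E' : Ix → Ix → Bool) (Q : Ix → Set) (v : V) (base : ∀ i → v ∈ bagF i → Q i)
    (link : ∀ i → 1 ≤ toℕ i → v ∈ bagF i → v ∈ bagF (parF i) → Conn (mkGraph (suc m) E') Q i (parF i)) where
    module 𝔾 = Connectivity (mkGraph (suc m) E')

    IsFirst : Ix → Set
    IsFirst f = v ∈ bagF f × (∀ s → s < toℕ f → v ∉ bg (nd s))

    to-first : ∀ t i → toℕ i ≤ t → v ∈ bagF i → ∃[ f ] (IsFirst f × Conn (mkGraph (suc m) E') Q i f)
    to-first t fz _ v∈ = fz , (v∈ , λ _ ()) , here (base fz v∈)
    to-first zero (fs i) () v∈
    to-first (suc t) (fs i) le v∈ with inherit (suc (toℕ i)) (s≤s z≤n) (ix≤ (fs i)) v∈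
    ... | inj₂ new = fs i , (v∈ , new) , here (base (fs i) v∈)
    ... | inj₁ v∈p with subst (λ z → v ∈ bg (nd z)) (sym (toℕ-parF (fs i))) v∈p
    ...   | v∈p' with to-first t (parF (fs i)) (≤-pred (≤-trans (≤-trans (s≤s (≤-reflexive (toℕ-parF (fs i)))) (parT< (suc (toℕ i)) (s≤s z≤n) (ix≤ (fs i)))) le)) v∈p'
    ...     | f , first , c = f , first , 𝔾.conn-trans (link (fs i) (s≤s z≤n) v∈ v∈p') c

    first-unique : ∀ {f f'} → IsFirst f → IsFirst f' → f ≡ f'
    first-unique {f} {f'} (a , b) (a' , b') with <-cmp (toℕ f) (toℕ f')
    ... | tri< lt _ _ = ⊥-elim (b' _ lt a)
    ... | tri≈ _ e _ = toℕ-injective e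
    ... | tri> _ _ gt = ⊥-elim (b _ gt a')

    joined : ∀ i j → v ∈ bagF i → v ∈ bagF j → Conn (mkGraph (suc m) E') Q i j
    joined i j vi vj with to-first (toℕ i) i ≤-refl vi | to-first (toℕ j) j ≤-refl vj
    ... | f , F , c | f' , F' , c' with first-unique F F'
    ...   | refl = 𝔾.conn-trans c (𝔾.conn-sym c')

  at : ∀ {t} → t ≤ m → Ix
  at le = fromℕ< (s≤s le)

  ∈at : ∀ {t v} (le : t ≤ m) → v ∈ bg (nd t) → v ∈ bagF (at le)
  ∈at {v = v} le = subst (λ z → v ∈ bg (nd z)) (sym (toℕ-fromℕ< (s≤s le)))

  tree-decomposition : TreeDecomp G (full G) T
  tree-decomposition = record
    { bag = bagF
    ; bag⊆S = λ _ _ _ → tt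
    ; edgeCov = λ u v _ _ a → let (t , le , x , y) = edge-covered (all-covered u) (all-covered v) a in at le , ∈at le x , ∈at le y
    ; vertCov = λ v _ → let (t , le , x) = U-covered (all-covered v) in at le , ∈at le x
    ; subtree = λ v x y → First.joined (Graph.E T) (λ z → v ∈ bagF z) v (λ _ q → q)
        (λ i l a b → step a (par-adj i l) (here b)) x y }

  entry : Ix → ℕ × ℕ
  entry a = toℕ a , ep (nd (toℕ a))

  ActiveAt : Ix → Ix → Set
  ActiveAt i a = entry a ∈ᴸ active (nd (toℕ i))

  activeAt? : ∀ i a → Dec (ActiveAt i a)
  activeAt? i a = anyᴸ? (λ y → map′ (λ { (refl , refl) → refl }) (λ { refl → refl , refl }) ((toℕ a ≟ proj₁ y) ×-dec (ep (nd (toℕ a)) ≟ proj₂ y))) _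

  active-self : ∀ i → ActiveAt i i
  active-self i = self (toℕ i) (ix≤ i)

  active-par : ∀ i → 1 ≤ toℕ i → ActiveAt i (parF i)
  active-par (fs i) _ = subst (λ z → (z , ep (nd z)) ∈ᴸ active (nd (suc (toℕ i)))) (sym (toℕ-parF (fs i))) (parent (suc (toℕ i)) (s≤s z≤n) (ix≤ (fs i)))

  active-before : ∀ {i a} → ActiveAt i a → toℕ a ≤ toℕ i
  active-before {i} m' = proj₁ (active≤ (toℕ i) _ (ix≤ i) m')

  active-between : ∀ {i a} → ActiveAt i a → ∀ j → toℕ a ≤ toℕ j → toℕ j ≤ toℕ i → ActiveAt j a
  active-between {i} {a} act j a≤j j≤i = go (toℕ i) (ix≤ i) act j≤i
    where
    go : ∀ t → t ≤ m → entry a ∈ᴸ active (nd t) → toℕ j ≤ t → ActiveAt j a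
    go t le act j≤t with toℕ j ≟ t
    ... | yes refl = act
    go zero le act j≤t | no ne = ⊥-elim (ne (≤-antisym j≤t z≤n))
    go (suc t) le act j≤t | no ne = go t (<⇒≤ le) (active-pred t (entry a) le act (λ e → <⇒≱ (≤∧≢⇒< j≤t ne) (≤-trans (≤-reflexive (sym e)) a≤j)))
      (≤-pred (≤∧≢⇒< j≤t ne))

  q : ℕ
  q = (Λ + 2) + (Λ + 2)

  count≤q : ∀ (i : Ix) L → count L (active (nd (toℕ i))) + count (suc L) (active (nd (toℕ i))) ≤ q
  count≤q i L = +-mono-≤ (few (toℕ i) L (ix≤ i)) (few (toℕ i) (suc L) (ix≤ i))

  epoch-of : ∀ a {v} → v ∈ bagF a → ep (nd (toℕ a)) ≡ lay v ⊎ ep (nd (toℕ a)) ≡ suc (lay v)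
  epoch-of a m' = [ (λ e → inj₁ (sym e)) , (λ e → inj₂ (sym e)) ]′ (lay-ep (toℕ a) (ix≤ a) m')

  module Subtree (v : V) where
    Q : Ix → Set
    Q x = v ∈ bagF x

    here? : ∀ i a → Dec (ActiveAt i a × v ∈ bagF a)
    here? i a = activeAt? i a ×-dec (v ∈? bagF a)

    pbag : Ix → Subset (suc m)
    pbag i = sub (here? i)

    cover-edge : ∀ x y → Q x → Q y → toℕ y ≡ parT (toℕ x) → x ≢ y → x ∈ pbag x × y ∈ pbag x
    cover-edge fz y _ _ e ne = ⊥-elim (ne (toℕ-injective (sym e)))
    cover-edge x@(fs _) y vx vy e ne = sub⁺ (here? x) (active-self x , vx) ,
      sub⁺ (here? x) (subst (ActiveAt x) (toℕ-injective (trans (toℕ-parF x) (sym e))) (active-par x (s≤s z≤n)) , vy)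

    path-decomposition : PathDecomp T Q m
    path-decomposition = record
      { bag = pbag
      ; bag⊆S = λ x a m' → proj₂ (sub⁻ (here? x) m')
      ; edgeCov = λ x y vx vy a → case adj⇒par a of λ
          { (inj₁ e) → x , cover-edge x y vx vy e (proj₁ a)
          ; (inj₂ e) → let (b , c) = cover-edge y x vy vx e (λ z → proj₁ a (sym z)) in y , c , b }
      ; vertCov = λ x vx → x , sub⁺ (here? x) (active-self x , vx)
      ; subtree = λ a x y mx my → Connectivity.conn-trans (PathGraph (suc m)) (down a x mx) (Connectivity.conn-sym (PathGraph (suc m)) (down a y my)) }
      where
      down : ∀ a x → a ∈ pbag x → Conn (PathGraph (suc m)) (λ z → a ∈ pbag z) x a
      down a x mx with sub⁻ (here? x) mx
      ... | act , va = path-down x a (active-before act) (λ j l l' → sub⁺ (here? j) (active-between act j l l' , va))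

    only : ℕ × ℕ → Subset (suc m)
    only (a , _) = sub (λ (b : Ix) → toℕ b ≟ a)

    only-small : ∀ x → ∣ only x ∣ ≤ 1
    only-small (a , e) with nonempty? (only (a , e))
    ... | no ne = ≤-trans (card-mono {q = ∅} (λ m' → ⊥-elim (ne (_ , m')))) (≤-trans (≤-reflexive (∣⊥∣≡0 (suc m))) z≤n)
    ... | yes (b , b∈) = ≤-trans (card-mono {q = ⁅ b ⁆} (λ {c} m' → subst (_∈ ⁅ b ⁆)
            (toℕ-injective (trans (sub⁻ (λ (b : Ix) → toℕ b ≟ a) b∈) (sym (sub⁻ (λ (b : Ix) → toℕ b ≟ a) m')))) (x∈⁅x⁆ b))) (≤-reflexive (∣⁅x⁆∣≡1 b))

    narrow : WidthAtMost path-decomposition q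
    narrow i = ≤-trans (≤-reflexive (sym (card-is (pbag i)))) (≤-trans (cover-bound (active (nd (toℕ i))) only (lay v) (λ x _ → only-small x) (pbag i)
      (λ a a∈ → let (act , va) = sub⁻ (here? i) a∈ in entry a , act , epoch-of a va , sub⁺ (λ (b : Ix) → toℕ b ≟ toℕ a) refl))
      (≤-trans (≤-reflexive (*-identityʳ _)) (≤-trans (count≤q i (lay v)) (n≤1+n q))))

  good : GoodTD G β q
  good = T , T-tree , tree-decomposition ,
    (λ x → ≤-trans (≤-reflexive (sym (card-is (bagF x)))) (≤-trans (bg-small (toℕ x) (ix≤ x)) (n≤1+n β))) ,
    (λ v → m , Subtree.path-decomposition v , Subtree.narrow v)

  contains? : ∀ i v → Dec (∃[ a ] (ActiveAt i a × v ∈ bagF a))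
  contains? i v = any? (λ a → activeAt? i a ×-dec (v ∈? bagF a))

  gbag : Ix → VS
  gbag i = sub (contains? i)

  gbag⁺ : ∀ i a {v} → ActiveAt i a → v ∈ bagF a → v ∈ gbag i
  gbag⁺ i a act v∈ = sub⁺ (contains? i) (a , act , v∈)

  path-decomposition : PathDecomp G (full G) m
  path-decomposition = record
    { bag = gbag
    ; bag⊆S = λ _ _ _ → tt
    ; edgeCov = λ u v _ _ a → let (t , le , x , y) = edge-covered (all-covered u) (all-covered v) a in
        at le , gbag⁺ _ _ (active-self (at le)) (∈at le x) , gbag⁺ _ _ (active-self (at le)) (∈at le y)
    ; vertCov = λ v _ → let (t , le , x) = U-covered (all-covered v) in at le , gbag⁺ _ _ (active-self (at le)) (∈at le x)
    ; subtree = λ v x y mx my → connect v (sub⁻ (contains? x) mx) (sub⁻ (contains? y) my) }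
    where
    open Connectivity (PathGraph (suc m)) using () renaming (conn-trans to p-trans; conn-sym to p-sym)
    Q : V → Ix → Set
    Q v z = v ∈ gbag z
    down : ∀ v {i a} → ActiveAt i a → v ∈ bagF a → Conn (PathGraph (suc m)) (Q v) i a
    down v {i} {a} act va = path-down i a (active-before act) (λ j l l' → gbag⁺ j a (active-between act j l l') va)
    connect : ∀ v {x y} → ∃[ a ] (ActiveAt x a × v ∈ bagF a) → ∃[ b ] (ActiveAt y b × v ∈ bagF b) → Conn (PathGraph (suc m)) (Q v) x y
    -- Both `a` and `b` lead to the first node containing `v`; each link from a node to its parent
    -- is bridged by the interval on which the parent stays active.
    connect v (a , act , va) (b , act' , vb) = p-trans (down v act va) (p-trans
      (First.joined (Graph.E (PathGraph (suc m))) (Q v) v (λ i vi → gbag⁺ i i (active-self i) vi)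
        (λ i l vi vp → down v (active-par i l) vp) a b va vb)
      (p-sym (down v act' vb)))

  layering : IsLayering G lay
  layering u v a = let (t , le , x , y) = edge-covered (all-covered u) (all-covered v) a in
    ≤-trans (below (lay-ep t le x)) (above (lay-ep t le y))
    where
    below : ∀ {u t} → lay u ≡ t ⊎ suc (lay u) ≡ t → lay u ≤ t
    below (inj₁ refl) = ≤-refl
    below (inj₂ refl) = n≤1+n _
    above : ∀ {u t} → lay u ≡ t ⊎ suc (lay u) ≡ t → t ≤ suc (lay u)
    above (inj₁ refl) = n≤1+n _
    above (inj₂ refl) = ≤-refl

  layer⁻ : ∀ {k} (ℓ : Fin k → ℕ) i {v} → v ∈ layer ℓ i → ℓ v ≡ i
  layer⁻ ℓ i {v} m' = ≡ᵇ-sound _ _ (trans (sym (lookup∘tabulate (λ v → ℓ v ≡ᵇ i) v)) ([]=⇒lookup m'))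

  layered : LayeredPathwidthAtMost G (q * β)
  layered = m , path-decomposition , lay , layering , λ x i →
    ≤-trans (≤-reflexive (sym (card-is (gbag x ∩ layer lay i)))) (≤-trans
      (cover-bound (active (nd (toℕ x))) (λ y → bg (nd (proj₁ y))) i
        (λ y y∈ → bg-small (proj₁ y) (≤-trans (proj₁ (active≤ (toℕ x) y (ix≤ x) y∈)) (ix≤ x))) (gbag x ∩ layer lay i)
        (λ v v∈ → let (a , act , va) = sub⁻ (contains? x) (proj₁ (∩⁻ v∈)) in entry a , act ,
          subst (λ k → ep (nd (toℕ a)) ≡ k ⊎ ep (nd (toℕ a)) ≡ suc k) (layer⁻ lay i (proj₂ (∩⁻ v∈))) (epoch-of a va) , va))
      (*-monoˡ-≤ β (count≤q x i)))

-- Lower bounds: rich sets force large bags.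

union-bound : ∀ {k l β} (P : Subset k) (F : Fin k → Subset l) → (∀ x → ∣ F x ∣ ≤ β) → ∀ S →
  (∀ {v} → v ∈ S → ∃[ x ] (x ∈ P × v ∈ F x)) → ∣ S ∣ ≤ ∣ P ∣ * β
union-bound {l = l} {β} P F small S cov = go (∣ P ∣) P refl S cov
  where
  go : ∀ c P → ∣ P ∣ ≡ c → ∀ S → (∀ {v} → v ∈ S → ∃[ x ] (x ∈ P × v ∈ F x)) → ∣ S ∣ ≤ c * β
  go zero P e S cov = ≤-trans (card-mono {q = ∅} (λ m → let (x , x∈ , _) = cov m in ⊥-elim (<⇒≢ (card>0 x∈) (sym e)))) (≤-reflexive (∣⊥∣≡0 l))
  go (suc c) P e S cov with card-nonempty P (≤-trans (s≤s z≤n) (≤-reflexive (sym e)))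
  ... | x , x∈ = ≤-trans (card-split S (F x)) (+-mono-≤ (≤-trans (card-mono (λ m → proj₂ (∩⁻ m))) (small x))
        (go c (P ─ ⁅ x ⁆) (suc-injective (trans (card-remove x∈) e)) (S ─ F x) rest))
    where
    rest : ∀ {v} → v ∈ S ─ F x → ∃[ y ] (y ∈ P ─ ⁅ x ⁆ × v ∈ F y)
    rest m with ─⁻ S (F x) m
    ... | v∈ , v∉ with cov v∈
    ...   | y , y∈ , v∈y = y , ─⁺ y∈ (λ q → v∉ (subst (λ z → _ ∈ F z) (x∈⁅y⁆⇒x≡y _ q) v∈y)) , v∈y

path-between : ∀ {k} {Q : Fin k → Set} {i l} (j : Fin k) → Conn (PathGraph k) Q i l → toℕ i ≤ toℕ j → toℕ j ≤ toℕ l → Q j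
path-between {Q = Q} j (here q) i≤ ≤l = subst Q (toℕ-injective (≤-antisym i≤ ≤l)) q
path-between {Q = Q} {i} j (step {w = i'} q a c) i≤ ≤l with toℕ i ≟ toℕ j
... | yes e = subst Q (toℕ-injective e) q
... | no ne = path-between j c (≤-trans (near a) (≤∧≢⇒< i≤ ne)) ≤l
  where
  near : Adj (PathGraph _) i i' → toℕ i' ≤ suc (toℕ i)
  near (_ , inj₁ e) = ≤-reflexive (≡ᵇ-sound _ _ e)
  near (_ , inj₂ e) = ≤-trans (n≤1+n _) (≤-trans (≤-reflexive (sym (≡ᵇ-sound _ _ e))) (n≤1+n _))

module _ {G : Graph} {S : VSet G} {m : ℕ} (D : PathDecomp G S m) where

  vertex-between : ∀ {v i l} j → v ∈ bag D i → v ∈ bag D l → toℕ i ≤ toℕ j → toℕ j ≤ toℕ l → v ∈ bag D j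
  vertex-between j vi vl = path-between j (subtree D _ _ _ vi vl)

  set-between : ∀ {Q : VSet G} → (∀ {v} → Q v → S v) → ∀ {x y i l} j → Conn G Q x y → x ∈ bag D i → y ∈ bag D l →
    toℕ i ≤ toℕ j → toℕ j ≤ toℕ l → ∃[ z ] (Q z × z ∈ bag D j)
  set-between Q⊆S j (here q) xi yl i≤ ≤l = _ , q , vertex-between j xi yl i≤ ≤l
  set-between Q⊆S {x} j (step {w = x'} q a c) xi yl i≤ ≤l with edgeCov D x x' (Q⊆S q) (Q⊆S (Connectivity.conn-source G c)) a
  ... | t , xt , x't with ≤-total (toℕ t) (toℕ j)
  ...   | inj₁ t≤ = set-between Q⊆S j c x't yl t≤ ≤l
  ...   | inj₂ j≤ = x , q , vertex-between j xi xt i≤ j≤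

-- The bags are an arbitrary sequence with the two properties `hits` and `between`, so that the
-- result also applies to the sequence obtained from the subtree of the apex in a tree
-- decomposition.
module LinearBags (G : Graph) (R : Subset (n G)) {m : ℕ} (bags : Fin m → Subset (n G)) where
  open Connectivity G
  open Tripods G

  Meets : VS → Fin m → Set
  Meets D i = Nonempty (bags i ∩ D)

  module _ (hits : ∀ D → Connected D → D ⊆ R → ∃[ i ] Meets D i)
    (between : ∀ D → Connected D → D ⊆ R → ∀ i j l → toℕ i ≤ toℕ j → toℕ j ≤ toℕ l → Meets D i → Meets D l → Meets D j) where

    rich⇒large-bag : ∀ u h D → D ⊆ R → Rich.Rich u h D → ∃[ i ] (h < ∣ bags i ∩ D ∣)
    rich⇒large-bag u zero D D⊆R (cD , _) with hits D cD D⊆R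
    ... | i , _ , m = i , card>0 m
    rich⇒large-bag u (suc h) D D⊆R (cD , A , E₁ , E₂ , E₃ , (A⊆ , f₁ , f₂ , f₃) , cA , (r₁ , r₂ , r₃) , (a₁ , a₂ , a₃) , (d12 , d13 , d23) , (t₁ , t₂ , t₃))
      = sort (rich⇒large-bag u h E₁ (λ m → D⊆R (f₁ m)) r₁) (rich⇒large-bag u h E₂ (λ m → D⊆R (f₂ m)) r₂) (rich⇒large-bag u h E₃ (λ m → D⊆R (f₃ m)) r₃)
      where
      Large : VS → Fin m → Set
      Large E i = h < ∣ bags i ∩ E ∣
      meets : ∀ {E i} → Large E i → Meets E i
      meets l = card-nonempty _ (≤-trans (s≤s z≤n) l)
      -- The bag of the middle set also meets the union of A with the two outer sets.
      middle : ∀ {X Y Z} i j l → X ⊆ D → Y ⊆ D → Z ⊆ D → Rich.Rich u h X → Rich.Rich u h Z → Touch A X → Touch A Z →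
        A # Y → X # Y → Z # Y → Large X i → Large Y j → Large Z l → toℕ i ≤ toℕ j → toℕ j ≤ toℕ l → ∃[ i ] (suc h < ∣ bags i ∩ D ∣)
      middle {X} {Y} {Z} i j l X⊆ Y⊆ Z⊆ rX rZ tX tZ aY xY zY li lj ll ij jl = j , (≤-trans (s≤s lj) (card-< (λ m → ∩⁺ (proj₁ (∩⁻ m)) (Y⊆ (proj₂ (∩⁻ m))))
          (∩⁺ (proj₁ (∩⁻ (proj₂ extra))) (L⊆D (proj₂ (∩⁻ (proj₂ extra))))) (λ m → L#Y (proj₂ (∩⁻ (proj₂ extra))) (proj₂ (∩⁻ m)))))
        where
        L : VS
        L = (A ∪ X) ∪ Z
        cL : Connected L
        cL = connected-∪-touch (connected-∪-touch cA (Rich.rich-conn u h rX) tX) (Rich.rich-conn u h rZ) (touch-mono ∪ˡ id tZ)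
        L⊆D : L ⊆ D
        L⊆D = ∪-lub (∪-lub A⊆ X⊆) Z⊆
        L#Y : L # Y
        L#Y m = [ (λ q → [ aY , xY ]′ (∪⁻ q)) , zY ]′ (∪⁻ m)
        extra : Meets L j
        extra = between L cL (λ m → D⊆R (L⊆D m)) i j l ij jl
          (let (v , m) = meets li in v , ∩⁺ (proj₁ (∩⁻ m)) (∪ˡ (∪ʳ (proj₂ (∩⁻ m))))) (let (v , m) = meets ll in v , ∩⁺ (proj₁ (∩⁻ m)) (∪ʳ (proj₂ (∩⁻ m))))
      sort : ∃[ i ] Large E₁ i → ∃[ i ] Large E₂ i → ∃[ i ] Large E₃ i → ∃[ i ] (suc h < ∣ bags i ∩ D ∣)
      sort (i , li) (j , lj) (l , ll) with ≤-total (toℕ i) (toℕ j) | ≤-total (toℕ j) (toℕ l) | ≤-total (toℕ i) (toℕ l)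
      ... | inj₁ ij | inj₁ jl | _ = middle i j l f₁ f₂ f₃ r₁ r₃ t₁ t₃ a₂ d12 (#-sym d23) li lj ll ij jl
      ... | inj₁ ij | inj₂ lj' | inj₁ il = middle i l j f₁ f₃ f₂ r₁ r₂ t₁ t₂ a₃ d13 d23 li ll lj il lj'
      ... | inj₁ ij | inj₂ lj' | inj₂ li' = middle l i j f₃ f₁ f₂ r₃ r₂ t₃ t₂ a₁ (#-sym d13) (#-sym d12) ll li lj li' ij
      ... | inj₂ ji | inj₁ jl | inj₁ il = middle j i l f₂ f₁ f₃ r₂ r₃ t₂ t₃ a₁ (#-sym d12) (#-sym d13) lj li ll ji il
      ... | inj₂ ji | inj₁ jl | inj₂ li' = middle j l i f₂ f₃ f₁ r₂ r₁ t₂ t₁ a₃ d23 d13 lj ll li jl li'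
      ... | inj₂ ji | inj₂ lj' | _ = middle l j i f₃ f₂ f₁ r₃ r₁ t₃ t₁ a₂ (#-sym d23) d12 ll lj li lj' ji

module TreeIntersection (T : Graph) (isTree : IsTree T) where
  open Connectivity T
  open Forests T

  private
    order : Order 𝕍
    order = forest⇒order ∣ 𝕍 {n T} ∣ 𝕍 ≤-refl (λ C → proj₂ (proj₂ isTree) (cycle-mono (λ _ → tt) C))
  open Order order

  len : ∀ {S x y} → Conn T S x y → ℕ
  len (here _) = 0
  len (step _ _ c) = suc (len c)

  pos-adj : ∀ {x y} → Adj T x y → pos x ≢ pos y
  pos-adj a e = proj₁ a (pos-inj ∈⊤ ∈⊤ e)

  -- If the first step goes up to `w`, the connection must later leave `w` downwards, and the only
  -- lower neighbour of `w` is `x`. The detour is cut off, and what remains is shorter.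
  climb : ∀ {S} ℓ {x y} (c : Conn T S x y) → len c ≤ ℓ → pos y < pos x →
    ∃[ p ] (Adj T x p × pos p < pos x × Σ (Conn T S p y) λ c' → len c' < len c)
  climb ℓ (here _) _ lt = ⊥-elim (<-irrefl refl lt)
  climb zero (step _ _ _) () _
  climb (suc ℓ) {x} {y} (step {w = w} s a c) (s≤s le) lt with <-cmp (pos w) (pos x)
  ... | tri< wx _ _ = w , a , wx , c , ≤-refl
  ... | tri≈ _ e _ = ⊥-elim (pos-adj a (sym e))
  ... | tri> _ _ xw with climb ℓ c le (<-trans lt xw)
  ...   | p , a' , pw , c' , l' with lower-unique ∈⊤ ∈⊤ ∈⊤ a' (adj-sym a) pw xw
  ...     | refl with climb ℓ c' (≤-trans (<⇒≤ l') le) lt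
  ...       | p' , a'' , px , c'' , l'' = p' , a'' , px , c'' , ≤-trans l'' (≤-trans (<⇒≤ l') (n≤1+n _))

  -- By `climb`, both connections contain the only lower neighbour of the higher endpoint. Moving
  -- there decreases the sum of the positions.
  conn-∩ : ∀ {S S' : VSet T} {x y} → Conn T S x y → Conn T S' x y → Conn T (λ z → S z × S' z) x y
  conn-∩ {S} {S'} c c' = go _ _ _ ≤-refl c c'
    where
    go : ∀ f x y → pos x + pos y ≤ f → Conn T S x y → Conn T S' x y → Conn T (λ z → S z × S' z) x y
    descend : ∀ f x y → pos x + pos y ≤ f → pos y < pos x → Conn T S x y → Conn T S' x y → Conn T (λ z → S z × S' z) x y
    descend zero x y le lt _ _ = ⊥-elim (<⇒≱ (≤-trans (s≤s z≤n) lt) (≤-trans (m≤m+n _ _) le))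
    descend (suc f) x y le lt c c' with climb (len c) c ≤-refl lt | climb (len c') c' ≤-refl lt
    ... | p , a , px , d , _ | p' , a' , px' , d' , _ with lower-unique ∈⊤ ∈⊤ ∈⊤ a a' px px'
    ...   | refl = step (conn-source c , conn-source c') a (go f p y (≤-pred (≤-trans (+-monoˡ-≤ (pos y) px) le)) d d')
    go f x y le c c' with <-cmp (pos x) (pos y)
    ... | tri> _ _ gt = descend f x y le gt c c'
    ... | tri≈ _ e _ with pos-inj {x} {y} ∈⊤ ∈⊤ e
    ...   | refl = here (conn-source c , conn-source c')
    go f x y le c c' | tri< lt _ _ = conn-sym (descend f y x (≤-trans (≤-reflexive (+-comm (pos y) (pos x))) le) lt (conn-sym c) (conn-sym c'))

ternary-size : ℕ → ℕ
ternary-size zero = 1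
ternary-size (suc h) = suc (ternary-size h + (ternary-size h + ternary-size h))

-- The complete ternary tree of height h on the interval of ternary-size h vertices from s, with root s and parent function
-- ternary-parent h s x, where x is the parent of the root.
module Ternary where
  start₁ start₂ start₃ : ℕ → ℕ → ℕ
  start₁ h s = suc s
  start₂ h s = suc s + ternary-size h
  start₃ h s = start₂ h s + ternary-size h

  ternary-parent : ℕ → ℕ → ℕ → ℕ → ℕ
  ternary-parent zero s x i = x
  ternary-parent (suc h) s x i with i ≤? s | i <? start₂ h s | i <? start₃ h s
  ... | yes _ | _ | _ = x
  ... | no _ | yes _ | _ = ternary-parent h (start₁ h s) s i
  ... | no _ | no _ | yes _ = ternary-parent h (start₂ h s) s i
  ... | no _ | no _ | no _ = ternary-parent h (start₃ h s) s i

  ternary-parent< : ∀ h {s x i} → x < s → s ≤ i → ternary-parent h s x i < i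
  ternary-parent< zero x<s s≤i = ≤-trans x<s s≤i
  ternary-parent< (suc h) {s} {x} {i} x<s s≤i with i ≤? s | i <? start₂ h s | i <? start₃ h s
  ... | yes _ | _ | _ = ≤-trans x<s s≤i
  ... | no n₁ | yes _ | _ = ternary-parent< h ≤-refl (≰⇒> n₁)
  ... | no _ | no n₂ | yes _ = ternary-parent< h (m≤m+n (suc s) (ternary-size h)) (≮⇒≥ n₂)
  ... | no _ | no _ | no n₃ = ternary-parent< h (≤-trans (m≤m+n (suc s) (ternary-size h)) (m≤m+n _ _)) (≮⇒≥ n₃)

  -- Stated for an arbitrary `par`, so that a subtree can be recognised inside the parent function
  -- of the whole tree.
  IsTernary : ℕ → ℕ → ℕ → (ℕ → ℕ) → Set
  IsTernary zero s x par = par s ≡ x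
  IsTernary (suc h) s x par = par s ≡ x × (IsTernary h (start₁ h s) s par × (IsTernary h (start₂ h s) s par × IsTernary h (start₃ h s) s par))

  root-parent : ∀ h {s x par} → IsTernary h s x par → par s ≡ x
  root-parent zero e = e
  root-parent (suc h) (e , _) = e

  size>0 : ∀ h → 1 ≤ ternary-size h
  size>0 zero = ≤-refl
  size>0 (suc h) = s≤s z≤n

  total-size : ∀ h s → start₃ h s + ternary-size h ≡ s + ternary-size (suc h)
  total-size h s = begin
    suc s + a + a + a ≡⟨ +-assoc (suc s + a) a a ⟩
    suc s + a + (a + a) ≡⟨ +-assoc (suc s) a (a + a) ⟩
    suc s + (a + (a + a)) ≡⟨ sym (+-suc s (a + (a + a))) ⟩
    s + ternary-size (suc h) ∎
    where
    open ≡-Reasoning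
    a = ternary-size h

  ternary-cong : ∀ h {s x par par'} → (∀ i → s ≤ i → i < s + ternary-size h → par i ≡ par' i) → IsTernary h s x par → IsTernary h s x par'
  ternary-cong zero {s} eq t = trans (sym (eq s ≤-refl (≤-reflexive (+-comm 1 s)))) t
  ternary-cong (suc h) {s} eq (e , t₁ , t₂ , t₃) = trans (sym (eq s ≤-refl (m<m+n s (s≤s z≤n)))) e ,
    ternary-cong h (λ i a b → eq i (≤-trans (n≤1+n s) a) (≤-trans b (≤-trans (m≤m+n _ _) (≤-trans (m≤m+n _ _) (≤-reflexive (total-size h s)))))) t₁ ,
    ternary-cong h (λ i a b → eq i (≤-trans (n≤1+n s) (≤-trans (m≤m+n _ _) a)) (≤-trans b (≤-trans (m≤m+n _ _) (≤-reflexive (total-size h s))))) t₂ ,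
    ternary-cong h (λ i a b → eq i (≤-trans (n≤1+n s) (≤-trans (≤-trans (m≤m+n _ _) (m≤m+n _ _)) a)) (≤-trans b (≤-reflexive (total-size h s)))) t₃

  parent-isTernary : ∀ h s x → IsTernary h s x (ternary-parent h s x)
  parent-isTernary zero s x = refl
  parent-isTernary (suc h) s x = at-root ,
    ternary-cong h in₁ (parent-isTernary h (start₁ h s) s) ,
    ternary-cong h in₂ (parent-isTernary h (start₂ h s) s) ,
    ternary-cong h in₃ (parent-isTernary h (start₃ h s) s)
    where
    at-root : ternary-parent (suc h) s x s ≡ x
    at-root with s ≤? s | s <? start₂ h s | s <? start₃ h s
    ... | yes _ | _ | _ = refl
    ... | no ne | _ | _ = ⊥-elim (ne ≤-refl)
    in₁ : ∀ i → start₁ h s ≤ i → i < start₁ h s + ternary-size h → ternary-parent h (start₁ h s) s i ≡ ternary-parent (suc h) s x i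
    in₁ i a b with i ≤? s | i <? start₂ h s | i <? start₃ h s
    ... | yes le | _ | _ = ⊥-elim (<⇒≱ a le)
    ... | no _ | yes _ | _ = refl
    ... | no _ | no ne | _ = ⊥-elim (ne b)
    in₂ : ∀ i → start₂ h s ≤ i → i < start₂ h s + ternary-size h → ternary-parent h (start₂ h s) s i ≡ ternary-parent (suc h) s x i
    in₂ i a b with i ≤? s | i <? start₂ h s | i <? start₃ h s
    ... | yes le | _ | _ = ⊥-elim (<⇒≱ (≤-trans (m≤m+n (suc s) (ternary-size h)) a) le)
    ... | no _ | yes lt | _ = ⊥-elim (<⇒≱ lt a)
    ... | no _ | no _ | yes _ = refl
    ... | no _ | no _ | no ne = ⊥-elim (ne b)
    in₃ : ∀ i → start₃ h s ≤ i → i < start₃ h s + ternary-size h → ternary-parent h (start₃ h s) s i ≡ ternary-parent (suc h) s x i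
    in₃ i a b with i ≤? s | i <? start₂ h s | i <? start₃ h s
    ... | yes le | _ | _ = ⊥-elim (<⇒≱ (≤-trans (≤-trans (m≤m+n (suc s) (ternary-size h)) (m≤m+n _ _)) a) le)
    ... | no _ | yes lt | _ = ⊥-elim (<⇒≱ lt (≤-trans (m≤m+n _ _) a))
    ... | no _ | no _ | yes lt = ⊥-elim (<⇒≱ lt a)
    ... | no _ | no _ | no _ = refl

-- Vertex 0 is an apex over the complete ternary tree on the vertices 1, ..., ternary-size h.
module ApexTernary (h₀ : ℕ) where
  open Ternary

  par : ℕ → ℕ
  par = ternary-parent h₀ 1 0

  edge : Fin (suc (ternary-size h₀)) → Fin (suc (ternary-size h₀)) → Bool
  edge fz _ = true
  edge (fs i) j = toℕ j ≡ᵇ par (suc (toℕ i))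

  A₀ : Graph
  A₀ = mkGraph (suc (ternary-size h₀)) edge

  open Connectivity A₀
  open Forests A₀ using (lower-unique⇒forest)
  open Tripods A₀ using (module Rich)
  open Rich fz using () renaming (Rich to RichAt)

  apex-adj : ∀ {v} → v ≢ fz → Adj A₀ v fz
  apex-adj ne = ne , inj₂ refl

  lower⇒par : ∀ {x y} → x ≢ fz → y ≢ fz → Adj A₀ x y → toℕ y < toℕ x → toℕ y ≡ par (toℕ x)
  lower⇒par {fz} ne _ _ _ = ⊥-elim (ne refl)
  lower⇒par {fs x} {fz} _ ne _ _ = ⊥-elim (ne refl)
  lower⇒par {fs x} {fs y} _ _ (_ , inj₁ e) lt = ≡ᵇ-sound _ _ e
  lower⇒par {fs x} {fs y} _ _ (_ , inj₂ e) lt = ⊥-elim (<⇒≱ lt (≤-trans (≤-reflexive (≡ᵇ-sound _ _ e)) (<⇒≤ (ternary-parent< h₀ {1} {0} {suc (toℕ y)} (s≤s z≤n) (s≤s z≤n)))))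

  apex-forest : IsApexForest A₀
  apex-forest = fz , lower-unique⇒forest (_≢ fz) toℕ (λ _ _ a e → proj₁ a (toℕ-injective e))
    (λ w x y a b la lb → toℕ-injective (trans (lower⇒par w x a la) (sym (lower⇒par w y b lb))))

  par-adj : ∀ {x y} → x ≢ fz → x ≢ y → par (toℕ x) ≡ toℕ y → Adj A₀ x y
  par-adj {fz} ne _ _ = ⊥-elim (ne refl)
  par-adj {fs x} {y} _ xy e = xy , inj₁ (trans (cong (toℕ y ≡ᵇ_) e) (≡ᵇ-refl (toℕ y)))

  interval? : ∀ s l (v : V) → Dec (s ≤ toℕ v × toℕ v < s + l)
  interval? s l v = (s ≤? toℕ v) ×-dec (toℕ v <? s + l)

  J : ℕ → ℕ → VS
  J s l = sub (interval? s l)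

  vertex : ∀ s h → s + ternary-size h ≤ suc (ternary-size h₀) → V
  vertex s h le = fromℕ< (≤-trans (m<m+n s (size>0 h)) le)

  toℕ-vertex : ∀ s h le → toℕ (vertex s h le) ≡ s
  toℕ-vertex s h le = toℕ-fromℕ< (≤-trans (m<m+n s (size>0 h)) le)

  vertex∈ : ∀ s h le → vertex s h le ∈ J s (ternary-size h)
  vertex∈ s h le = sub⁺ (interval? s (ternary-size h)) (≤-reflexive (sym (toℕ-vertex s h le)) ,
    ≤-trans (s≤s (≤-reflexive (toℕ-vertex s h le))) (m<m+n s (size>0 h)))

  ternary-rich : ∀ h s x → 1 ≤ s → s + ternary-size h ≤ suc (ternary-size h₀) → IsTernary h s x par → RichAt h (J s (ternary-size h))
  ternary-rich zero s x s≥1 le t = connected-from v∈ all , v , fz , v∈ , x∈⁅x⁆ fz , apex-adj (λ e → <⇒≢ s≥1 (trans (cong toℕ (sym e)) (toℕ-vertex s 0 le)))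
    where
    v : V
    v = vertex s 0 le
    v∈ : v ∈ J s 1
    v∈ = vertex∈ s 0 le
    all : ∀ {y} → y ∈ J s 1 → Path (J s 1) v y
    all y∈ with sub⁻ (interval? s 1) y∈
    ... | a , b with toℕ-injective (trans (toℕ-vertex s 0 le) (≤-antisym a (≤-pred (≤-trans b (≤-reflexive (+-comm s 1))))))
    ...   | refl = here v∈
  ternary-rich (suc h) s x s≥1 le (e , t₁ , t₂ , t₃) = connected-from v∈ all ,
    ⁅ v ⁆ , E₁ , E₂ , E₃ , (⁅⁆⊆ v∈ , E₁⊆ , E₂⊆ , E₃⊆) , connected-⁅⁆ v , (r₁ , r₂ , r₃) ,
    (v# s₁ ≤-refl , v# s₂ s≤s₂ , v# s₃ s≤s₃) ,
    (apart s₁ s₂ ≤-refl , apart s₁ s₃ (m≤m+n s₂ a) , apart s₂ s₃ ≤-refl) ,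
    (touches s₁ le₁ ≤-refl (root-parent h t₁) , touches s₂ le₂ s≤s₂ (root-parent h t₂) , touches s₃ le₃ s≤s₃ (root-parent h t₃))
    where
    a = ternary-size h
    s₁ = start₁ h s
    s₂ = start₂ h s
    s₃ = start₃ h s
    whole : VS
    whole = J s (ternary-size (suc h))
    v : V
    v = vertex s (suc h) le
    v∈ : v ∈ whole
    v∈ = vertex∈ s (suc h) le
    v≡s : toℕ v ≡ s
    v≡s = toℕ-vertex s (suc h) le
    le₃ : s₃ + a ≤ suc (ternary-size h₀)
    le₃ = ≤-trans (≤-reflexive (total-size h s)) le
    le₂ : s₂ + a ≤ suc (ternary-size h₀)
    le₂ = ≤-trans (m≤m+n _ _) le₃
    le₁ : s₁ + a ≤ suc (ternary-size h₀)
    le₁ = ≤-trans (m≤m+n _ _) le₂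
    E₁ E₂ E₃ : VS
    E₁ = J s₁ a
    E₂ = J s₂ a
    E₃ = J s₃ a
    s≤s₂ : suc s ≤ s₂
    s≤s₂ = m≤m+n _ _
    s≤s₃ : suc s ≤ s₃
    s≤s₃ = ≤-trans s≤s₂ (m≤m+n _ _)
    r₁ = ternary-rich h s₁ s (s≤s z≤n) le₁ t₁
    r₂ = ternary-rich h s₂ s (s≤s z≤n) le₂ t₂
    r₃ = ternary-rich h s₃ s (s≤s z≤n) le₃ t₃
    within : ∀ s' → suc s ≤ s' → s' + a ≤ s₃ + a → J s' a ⊆ whole
    within s' l u m with sub⁻ (interval? s' a) m
    ... | p , q = sub⁺ (interval? s (ternary-size (suc h))) (≤-trans (n≤1+n s) (≤-trans l p) , ≤-trans q (≤-trans u (≤-reflexive (total-size h s))))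
    E₁⊆ : E₁ ⊆ whole
    E₁⊆ = within s₁ ≤-refl (+-monoˡ-≤ a (≤-trans (m≤m+n _ _) (m≤m+n _ _)))
    E₂⊆ : E₂ ⊆ whole
    E₂⊆ = within s₂ s≤s₂ (+-monoˡ-≤ a (m≤m+n _ _))
    E₃⊆ : E₃ ⊆ whole
    E₃⊆ = within s₃ s≤s₃ ≤-refl
    v# : ∀ s' → suc s ≤ s' → ⁅ v ⁆ # J s' a
    v# s' l m m' = <⇒≱ l (≤-trans (proj₁ (sub⁻ (interval? s' a) m')) (≤-reflexive (trans (cong toℕ (x∈⁅y⁆⇒x≡y _ m)) v≡s)))
    apart : ∀ s' s'' → s' + a ≤ s'' → J s' a # J s'' a
    apart s' s'' l m m' = <⇒≱ (proj₂ (sub⁻ (interval? s' a) m)) (≤-trans l (proj₁ (sub⁻ (interval? s'' a) m')))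
    touches : ∀ s' (l : s' + a ≤ suc (ternary-size h₀)) → suc s ≤ s' → par s' ≡ s → Touch ⁅ v ⁆ (J s' a)
    touches s' l lt e = v , w , x∈⁅x⁆ v , vertex∈ s' h l , adj-sym (par-adj w≢0 w≢v (trans (cong par w≡) (trans e (sym v≡s))))
      where
      w : V
      w = vertex s' h l
      w≡ : toℕ w ≡ s'
      w≡ = toℕ-vertex s' h l
      w≢0 : w ≢ fz
      w≢0 q = <⇒≢ (≤-trans (s≤s z≤n) lt) (trans (cong toℕ (sym q)) w≡)
      w≢v : w ≢ v
      w≢v q = <⇒≢ lt (trans (sym v≡s) (trans (cong toℕ (sym q)) w≡))
    through : ∀ s' {y} (l : s' + a ≤ suc (ternary-size h₀)) → suc s ≤ s' → par s' ≡ s → Connected (J s' a) → J s' a ⊆ whole →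
      y ∈ J s' a → Path whole v y
    through s' l lt e c ⊆w y∈ with touches s' l lt e
    ... | v' , w , v'∈ , w∈ , ad with x∈⁅y⁆⇒x≡y _ v'∈
    ...   | refl = step v∈ ad (conn-mono ⊆w (proj₂ c w∈ y∈))
    all : ∀ {y} → y ∈ whole → Path whole v y
    all {y} y∈ with sub⁻ (interval? s (ternary-size (suc h))) y∈
    ... | p , q with toℕ y ≟ s | toℕ y <? s₂ | toℕ y <? s₃
    ...   | yes e' | _ | _ with toℕ-injective (trans v≡s (sym e'))
    ...     | refl = here v∈
    all {y} y∈ | p , q | no ne | yes lt | _ = through s₁ le₁ ≤-refl (root-parent h t₁) (Rich.rich-conn fz h r₁) E₁⊆
      (sub⁺ (interval? s₁ a) (≤∧≢⇒< p (λ z → ne (sym z)) , lt))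
    all {y} y∈ | p , q | no ne | no n₂ | yes lt = through s₂ le₂ s≤s₂ (root-parent h t₂) (Rich.rich-conn fz h r₂) E₂⊆
      (sub⁺ (interval? s₂ a) (≮⇒≥ n₂ , lt))
    all {y} y∈ | p , q | no ne | no n₂ | no n₃ = through s₃ le₃ s≤s₃ (root-parent h t₃) (Rich.rich-conn fz h r₃) E₃⊆
      (sub⁺ (interval? s₃ a) (≮⇒≥ n₃ , ≤-trans q (≤-reflexive (sym (total-size h s)))))

  D₀ : VS
  D₀ = J 1 (ternary-size h₀)

  rich : RichAt h₀ D₀
  rich = ternary-rich h₀ 1 0 ≤-refl ≤-refl (parent-isTernary h₀ 1 0)

  D₀-avoids : ∀ {v} → v ∈ D₀ → v ≢ fz
  D₀-avoids m refl = <⇒≱ (s≤s z≤n) (proj₁ (sub⁻ (interval? 1 (ternary-size h₀)) m))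

  local-pathwidth> : ∀ {p} → PathwidthAtMost A₀ (Ball A₀ fz 1) p → h₀ ≤ p
  local-pathwidth> {p} (m , PD , narrow) = ≤-pred (≤-trans (proj₂ large) (≤-trans (card-mono (λ m → proj₁ (∩⁻ m))) (≤-trans (≤-reflexive (card-is _)) (narrow (proj₁ large)))))
    where
    ball : ∀ {v} → v ∈ D₀ → Ball A₀ fz 1 v
    ball m = 1 , ≤-refl , cons (adj-sym (apex-adj (D₀-avoids m))) nil
    open LinearBags A₀ D₀ (bag PD)
    large : ∃[ i ] (h₀ < ∣ bag PD i ∩ D₀ ∣)
    large = rich⇒large-bag hits between fz h₀ D₀ id rich
      where
      hits : ∀ D → Connected D → D ⊆ D₀ → ∃[ i ] Meets D i
      hits D ((d , d∈) , _) D⊆ with vertCov PD d (ball (D⊆ d∈))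
      ... | i , m = i , d , ∩⁺ m d∈
      between : ∀ D → Connected D → D ⊆ D₀ → ∀ i j l → toℕ i ≤ toℕ j → toℕ j ≤ toℕ l → Meets D i → Meets D l → Meets D j
      between D (_ , c) D⊆ i j l ij jl (x , mx) (y , my) with set-between PD {_∈ D} (λ m → ball (D⊆ m)) j
        (c (proj₂ (∩⁻ mx)) (proj₂ (∩⁻ my))) (proj₁ (∩⁻ mx)) (proj₁ (∩⁻ my)) ij jl
      ... | z , z∈ , zj = z , ∩⁺ zj z∈

  -- The apex lies in a subtree of small pathwidth, whose path decomposition orders the bags of all the other vertices.
  good-bound : ∀ {w p} → GoodTD A₀ w p → h₀ < suc p * suc w
  good-bound {w} {p} (T , isTree , TD , narrow , sub-narrow) with sub-narrow fz
  ... | m , PD , pnarrow = ≤-trans (proj₂ large) (≤-trans (union-bound (bag PD (proj₁ large)) (bag TD) (λ x → ≤-trans (≤-reflexive (card-is _)) (narrow x)) _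
          (λ v∈ → sub⁻ (in-bag? (proj₁ large)) (proj₁ (∩⁻ v∈)))) (*-monoˡ-≤ (suc w) (≤-trans (≤-reflexive (card-is _)) (pnarrow (proj₁ large)))))
    where
    in-bag? : ∀ i v → Dec (∃[ x ] (x ∈ bag PD i × v ∈ bag TD x))
    in-bag? i v = any? (λ x → (x ∈? bag PD i) ×-dec (v ∈? bag TD x))
    gbag : Fin (suc m) → VS
    gbag i = sub (in-bag? i)
    open LinearBags A₀ D₀ gbag
    Touching : VS → VSet T
    Touching D x = ∃[ d ] (d ∈ D × d ∈ bag TD x)
    module CT = Connectivity T
    follow : ∀ {D d d' x x'} → Path D d d' → d ∈ bag TD x → d' ∈ bag TD x' → Conn T (Touching D) x x'
    follow {D} {d} (here m) dx d'x = CT.conn-mono (λ q → d , m , q) (subtree TD d _ _ dx d'x)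
    follow {D} {d} (step m a c) dx d'x with edgeCov TD d _ tt tt a
    ... | y , dy , wy = CT.conn-trans (CT.conn-mono (λ q → d , m , q) (subtree TD d _ _ dx dy)) (follow c wy d'x)
    large : ∃[ i ] (h₀ < ∣ gbag i ∩ D₀ ∣)
    large = rich⇒large-bag hits between fz h₀ D₀ id rich
      where
      hits : ∀ D → Connected D → D ⊆ D₀ → ∃[ i ] Meets D i
      -- Since `d` is adjacent to the apex, some bag contains both, and its node lies in the subtree
      -- of the apex.
      hits D ((d , d∈) , _) D⊆ with edgeCov TD d fz tt tt (apex-adj (D₀-avoids (D⊆ d∈)))
      ... | x , dx , ax with vertCov PD x ax
      ...   | i , xi = i , d , ∩⁺ (sub⁺ (in-bag? i) (x , xi , dx)) d∈
      between : ∀ D → Connected D → D ⊆ D₀ → ∀ i j l → toℕ i ≤ toℕ j → toℕ j ≤ toℕ l → Meets D i → Meets D l → Meets D j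
      -- The nodes whose bags meet `D` are connected in `T`, by `follow`. Within the subtree of the
      -- apex they still connect `x` to `x'`, by `conn-∩`, so the path decomposition of this subtree
      -- has such a node in its middle bag.
      between D (_ , c) D⊆ i j l ij jl (d , m) (d' , m') with sub⁻ (in-bag? i) (proj₁ (∩⁻ m)) | sub⁻ (in-bag? l) (proj₁ (∩⁻ m'))
      ... | x , xi , dx | x' , x'l , d'x with set-between PD {λ z → (fz ∈ bag TD z) × Touching D z} proj₁ j
              (TreeIntersection.conn-∩ T isTree (subtree TD fz x x' (bag⊆S PD i x xi) (bag⊆S PD l x' x'l))
                (follow (c (proj₂ (∩⁻ m)) (proj₂ (∩⁻ m'))) dx d'x)) xi x'l ij jl
      ...   | z , (_ , e , e∈ , ez) , zj = e , ∩⁺ (sub⁺ (in-bag? j) (z , zj , ez)) e∈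

-- From layers to balls, and the equivalences.

module Balls (G : Graph) where
  open Connectivity G

  walk? : ∀ k u v → Dec (Walk G k u v)
  walk? zero u v = map′ (λ { refl → nil }) (λ { nil → refl }) (u ≟F v)
  walk? (suc k) u v = map′ (λ (_ , a , c) → cons a c) (λ { (cons a c) → _ , a , c }) (any? (λ w → adj? u w ×-dec walk? k w v))

  ball? : ∀ v r u → Dec (Ball G v r u)
  ball? v r u = map′ (λ (k , c) → toℕ k , ≤-pred (toℕ<n k) , c)
    (λ (k , le , c) → fromℕ< (s≤s le) , subst (λ k → Walk G k v u) (sym (toℕ-fromℕ< (s≤s le))) c)
    (any? {n = suc r} (λ k → walk? (toℕ k) v u))

  module _ {ℓ : V → ℕ} (layering : IsLayering G ℓ) where

    walk-layers : ∀ {k u v} → Walk G k u v → ℓ u ≤ k + ℓ v × ℓ v ≤ k + ℓ u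
    walk-layers nil = ≤-refl , ≤-refl
    walk-layers (cons {k} {u} {w} {v} a c) with walk-layers c
    ... | p , q = ≤-trans (layering u w a) (s≤s p) ,
      ≤-trans q (≤-trans (+-monoʳ-≤ k (layering w u (adj-sym a))) (≤-reflexive (+-suc k (ℓ u))))

    few-layers : ∀ {c} j b B → (∀ i → ∣ B ∩ layer ℓ i ∣ ≤ c) → ∀ S → S ⊆ B → (∀ {v} → v ∈ S → b ≤ ℓ v × ℓ v < b + j) → ∣ S ∣ ≤ j * c
    few-layers zero b B small S S⊆ range = ≤-trans (card-mono {q = ∅} (λ m → let (p , q) = range m in
      ⊥-elim (<⇒≱ q (≤-trans (≤-reflexive (+-identityʳ b)) p)))) (≤-reflexive (∣⊥∣≡0 (n G)))
    few-layers (suc j) b B small S S⊆ range = ≤-trans (card-split S (layer ℓ (b + j))) (+-mono-≤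
      (≤-trans (card-mono (λ m → ∩⁺ (S⊆ (proj₁ (∩⁻ m))) (proj₂ (∩⁻ m)))) (small (b + j)))
      (few-layers j b B small (S ─ layer ℓ (b + j)) (λ m → S⊆ (proj₁ (─⁻ _ _ m))) (λ {v} m → let (v∈ , v∉) = ─⁻ _ _ m in
        proj₁ (range v∈) , ≤∧≢⇒< (≤-pred (≤-trans (proj₂ (range v∈)) (≤-reflexive (+-suc b j)))) (λ e → v∉ (in-layer e)))))
      where
      in-layer : ∀ {v i} → ℓ v ≡ i → v ∈ layer ℓ i
      in-layer {v} {i} e = lookup⇒[]= v _ (trans (lookup∘tabulate (λ v → ℓ v ≡ᵇ i) v) (subst (λ z → (z ≡ᵇ i) ≡ true) (sym e) (≡ᵇ-refl i)))

  -- Layers change by at most one along an edge, so a ball of radius `r` lies in `2 * r + 1`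
  -- consecutive layers, each of which contributes at most `c` to a bag.
  layered⇒local : ∀ {c} → LayeredPathwidthAtMost G c → ∀ v r → PathwidthAtMost G (Ball G v r) ((c + c) * r + c)
  layered⇒local {c} (m , PD , ℓ , layering , small) v r = m , restricted , narrow
    where
    lbag : Fin (suc m) → VS
    lbag x = bag PD x ∩ sub (ball? v r)
    restricted : PathDecomp G (Ball G v r) m
    restricted = record
      { bag = lbag
      ; bag⊆S = λ x u m → sub⁻ (ball? v r) (proj₂ (∩⁻ m))
      ; edgeCov = λ u w bu bw a → let (x , p , q) = edgeCov PD u w tt tt a in x , ∩⁺ p (sub⁺ (ball? v r) bu) , ∩⁺ q (sub⁺ (ball? v r) bw)
      ; vertCov = λ u bu → let (x , p) = vertCov PD u tt in x , ∩⁺ p (sub⁺ (ball? v r) bu)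
      ; subtree = λ u x y p q → Connectivity.conn-mono (PathGraph (suc m)) (λ z → ∩⁺ z (proj₂ (∩⁻ p))) (subtree PD u x y (proj₁ (∩⁻ p)) (proj₁ (∩⁻ q))) }
    b : ℕ
    b = ℓ v ∸ r
    range : ∀ {u} → Ball G v r u → b ≤ ℓ u × ℓ u < b + suc (r + r)
    range {u} (k , le , c) with walk-layers layering c
    ... | p , q = m≤n+o⇒m∸n≤o (ℓ v) r (≤-trans p (+-monoˡ-≤ (ℓ u) le)) ,
      ≤-trans (s≤s (≤-trans q (+-mono-≤ le (m≤n+m∸n (ℓ v) r)))) (≤-reflexive (trans (cong suc (trans (sym (+-assoc r r b)) (+-comm (r + r) b))) (sym (+-suc b (r + r)))))
    narrow : WidthAtMost restricted ((c + c) * r + c)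
    narrow x = ≤-trans (≤-reflexive (sym (card-is (lbag x)))) (≤-trans
      (few-layers layering (suc (r + r)) b (bag PD x) (λ i → ≤-trans (≤-reflexive (card-is _)) (small x i)) (lbag x) (λ m → proj₁ (∩⁻ m))
        (λ m → range (sub⁻ (ball? v r) (proj₂ (∩⁻ m)))))
      (≤-trans (≤-reflexive eq) (n≤1+n _)))
      where
      eq : suc (r + r) * c ≡ (c + c) * r + c
      eq = trans (+-comm c ((r + r) * c)) (cong (_+ c) (trans (*-distribʳ-+ c r r) (trans (cong₂ _+_ (*-comm r c) (*-comm r c)) (sym (*-distribʳ-+ r c c)))))

Decomposable : Class → Set
Decomposable 𝒢 = ∃[ β ] ∃[ q ] (∀ G → 𝒢 G → GoodTD G β q × LayeredPathwidthAtMost G (q * β))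

opaque
  decomposable-from : ∀ 𝒢 K κ κq → (∀ G → 𝒢 G → Balanced G κ 4 × (∀ u D → u ∉ D → ¬ Tripods.Rich.Rich G u K D) ×
    Balanced G κq (2 * (growth κ * K))) → Decomposable 𝒢
  decomposable-from 𝒢 K κ κq given = β , (Λ + 2) + (Λ + 2) , decompose
    where
    open Constants K κ κq using (Λ; β)
    decompose : ∀ G → 𝒢 G → GoodTD G β ((Λ + 2) + (Λ + 2)) × LayeredPathwidthAtMost G (((Λ + 2) + (Λ + 2)) * β)
    decompose G G∈ with given G G∈
    ... | bal , poor , bal-q with Interpret.full-run G Λ β (Build.decomposition G K κ κq bal poor bal-q)
    ... | S , covered = Extract.good G Λ β S covered , Extract.layered G Λ β S covered

opaque
  excludes⇒decomposable : ∀ 𝒢 → MinorClosed 𝒢 → ExcludesApexForest 𝒢 → Decomposable 𝒢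
  -- The ratio 4 is that of the cuts in a sweep. The other ratio undoes the growth of the boundary
  -- within an epoch; it depends only on the first separator size and the richness bound.
  excludes⇒decomposable 𝒢 closed𝒢 (H , (a , forest) , H∉) = decomposable-from 𝒢 (legHeight T T) (separator-bound T 4)
    (separator-bound T (2 * (growth (separator-bound T 4) * legHeight T T))) given
    where
    open ApexForest H a forest using (T; par; par<; model⇒minor)
    module _ (G : Graph) (G∈ : 𝒢 G) where
      free : ¬ ApexModel G T par
      free m = H∉ (closed𝒢 G H G∈ (model⇒minor m))
      given : Balanced G (separator-bound T 4) 4 × (∀ u D → u ∉ D → ¬ Tripods.Rich.Rich G u (legHeight T T) D) ×
        Balanced G (separator-bound T (2 * (growth (separator-bound T 4) * legHeight T T))) (2 * (growth (separator-bound T 4) * legHeight T T))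
      given = Balance.balanced G T par par< free 4 ,
        (λ u D u∉ rich → free (Tripods.Rich.Embed.rich⇒model G u T par par< D (s≤s z≤n) u∉ rich)) ,
        Balance.balanced G T par par< free _

linear⇒bounded : ∀ 𝒢 → LinearLocalPathwidth 𝒢 → BoundedLocalPathwidth 𝒢
linear⇒bounded 𝒢 (a , b , f) = (λ r → a * r + b) , f

layered⇒linear : ∀ 𝒢 → BoundedLayeredPathwidth 𝒢 → LinearLocalPathwidth 𝒢
layered⇒linear 𝒢 (c , f) = c + c , c , λ G G∈ → Balls.layered⇒local G (f G G∈)

bounded⇒excludes : ∀ 𝒢 → BoundedLocalPathwidth 𝒢 → ExcludesApexForest 𝒢
bounded⇒excludes 𝒢 (f , local) = A₀ , apex-forest , λ A₀∈ → <-irrefl refl (local-pathwidth> (local A₀ A₀∈ fz 1))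
  -- Radius 1 suffices, since the ball around the apex contains the whole tree; height `f 1 + 1`
  -- exceeds the bound by one.
  where open ApexTernary (suc (f 1))

good⇒excludes : ∀ 𝒢 → HasGoodTDs 𝒢 → ExcludesApexForest 𝒢
good⇒excludes 𝒢 (w , p , f) = A₀ , apex-forest , λ A₀∈ → <-irrefl refl (good-bound (f A₀ A₀∈))
  -- Bags of at most `p + 1` nodes, each holding at most `w + 1` vertices, give merged bags of at
  -- most this size.
  where open ApexTernary (suc p * suc w)

theorem5 : (𝒢 : Class) → MinorClosed 𝒢 →
    (ExcludesApexForest 𝒢 ⇔ BoundedLocalPathwidth 𝒢) ×
    (ExcludesApexForest 𝒢 ⇔ LinearLocalPathwidth 𝒢) ×
    (ExcludesApexForest 𝒢 ⇔ BoundedLayeredPathwidth 𝒢) ×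
    (ExcludesApexForest 𝒢 ⇔ HasGoodTDs 𝒢)
theorem5 𝒢 closed𝒢 =
  mk⇔ (λ ex → linear⇒bounded 𝒢 (layered⇒linear 𝒢 (layered ex))) (bounded⇒excludes 𝒢) ,
  mk⇔ (λ ex → layered⇒linear 𝒢 (layered ex)) (λ l → bounded⇒excludes 𝒢 (linear⇒bounded 𝒢 l)) ,
  mk⇔ layered (λ l → bounded⇒excludes 𝒢 (linear⇒bounded 𝒢 (layered⇒linear 𝒢 l))) ,
  mk⇔ good (good⇒excludes 𝒢)
  where
  bounded-layered : Decomposable 𝒢 → BoundedLayeredPathwidth 𝒢
  bounded-layered (β , q , f) = q * β , λ G G∈ → proj₂ (f G G∈)
  have-good : Decomposable 𝒢 → HasGoodTDs 𝒢
  have-good (β , q , f) = β , q , λ G G∈ → proj₁ (f G G∈)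
  layered : ExcludesApexForest 𝒢 → BoundedLayeredPathwidth 𝒢
  layered ex = bounded-layered (excludes⇒decomposable 𝒢 closed𝒢 ex)
  good : ExcludesApexForest 𝒢 → HasGoodTDs 𝒢
  good ex = have-good (excludes⇒decomposable 𝒢 closed𝒢 ex)
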